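{- Let $n \in \mathbb{N}$ be odd and let $\mathbf{u} = (u_1,u_2,u_3) \in \mathbb{N}^3$ be a solution to $$\frac{4}{n} = \frac{1}{u_1} + \frac{1}{u_2} + \frac{1}{u_3}.$$ Then $$\prod_{p \mid n} (-u_1/u_3, -u_2/u_3)_p = -1,$$ where the product is over the primes $p$ dividing $n$.
   Context: $\mathbb{N}$ denotes the positive integers. For a prime $p$ and $a,b \in \mathbb{Q}_p^*$, $(a,b)_p \in \{\pm 1\}$ denotes the Hilbert symbol: it is $1$ if $z^2 = ax^2+by^2$ has a non-trivial solution in $\mathbb{Q}_p$, and $-1$ otherwise. An empty product equals $1$. -}

module Defs where

open import Data.Integer as ℤ using (ℤ; +_; 0ℤ; 1ℤ; -1ℤ)
import Data.Integer.Properties as ℤ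
open import Data.Integer.Divisibility.Signed
  using (_∣_; divides; ∣m∣n⇒∣m+n; ∣n⇒∣m*n)
open import Data.Integer.Tactic.RingSolver using (solve-∀)
open import Data.List using (List; filter; foldr; map; upTo)
open import Data.Nat as ℕ using (ℕ; suc; NonZero)
import Data.Nat.Divisibility as ℕ
import Data.Nat.Properties as ℕ
open import Data.Nat.Primality using (Prime; prime?)
open import Data.Product using (_×_; ∃-syntax)
open import Data.Rational as ℚ using (ℚ)
open import Relation.Binary.PropositionalEquality using (_≡_; refl; sym; subst)
open import Relation.Nullary using (¬_; contradiction)
open import Relation.Nullary.Decidable using (_×-dec_)

-- ℤₚ is the inverse limit of the rings ℤ/pᵏ: `approx k` is any integer
-- representing the class modulo pᵏ, so equality is _≈ᶻ_ rather than _≡_.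
record ℤₚ (p : ℕ) : Set where
  field
    approx   : ℕ → ℤ
    coherent : ∀ k → + (p ℕ.^ k) ∣ approx (suc k) ℤ.- approx k

open ℤₚ public

module _ {p : ℕ} where

  infix  4 _≈ᶻ_
  infixl 6 _+ᶻ_
  infixl 7 _*ᶻ_

  _≈ᶻ_ : ℤₚ p → ℤₚ p → Set
  x ≈ᶻ y = ∀ k → + (p ℕ.^ k) ∣ approx x k ℤ.- approx y k

  _+ᶻ_ : ℤₚ p → ℤₚ p → ℤₚ p
  approx   (x +ᶻ y) k = approx x k ℤ.+ approx y k
  coherent (x +ᶻ y) k =
    subst (+ (p ℕ.^ k) ∣_)
      (eq (approx x (suc k)) (approx x k) (approx y (suc k)) (approx y k))
      (∣m∣n⇒∣m+n (coherent x k) (coherent y k))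
    where
    eq : ∀ a b c d → (a ℤ.- b) ℤ.+ (c ℤ.- d) ≡ (a ℤ.+ c) ℤ.- (b ℤ.+ d)
    eq = solve-∀

  _*ᶻ_ : ℤₚ p → ℤₚ p → ℤₚ p
  approx   (x *ᶻ y) k = approx x k ℤ.* approx y k
  coherent (x *ᶻ y) k =
    subst (+ (p ℕ.^ k) ∣_)
      (eq (approx x (suc k)) (approx x k) (approx y (suc k)) (approx y k))
      (∣m∣n⇒∣m+n (∣n⇒∣m*n (approx y (suc k)) (coherent x k))
                 (∣n⇒∣m*n (approx x k) (coherent y k)))
    where
    eq : ∀ a b c d →
         c ℤ.* (a ℤ.- b) ℤ.+ b ℤ.* (c ℤ.- d) ≡ a ℤ.* c ℤ.- b ℤ.* d
    eq = solve-∀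

  fromℤ : ℤ → ℤₚ p
  approx   (fromℤ i) _ = i
  coherent (fromℤ i) k =
    subst (+ (p ℕ.^ k) ∣_) (sym (ℤ.+-inverseʳ i)) (divides 0ℤ refl)

-- ℚₚ is the fraction field of ℤₚ.  Every non-zero p-adic integer is a unit
-- times a power of p, so for p prime it suffices to invert the positive
-- integers.
record ℚₚ (p : ℕ) : Set where
  constructor _÷_
  field
    num         : ℤₚ p
    den         : ℕ
    .{{den≢0}}  : NonZero den

open ℚₚ public using (num; den)

module _ {p : ℕ} where

  infix  4 _≈_
  infixl 6 _+_
  infixl 7 _*_

  _≈_ : ℚₚ p → ℚₚ p → Set
  (x ÷ d) ≈ (y ÷ e) = x *ᶻ fromℤ (+ e) ≈ᶻ y *ᶻ fromℤ (+ d)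

  _+_ : ℚₚ p → ℚₚ p → ℚₚ p
  (x ÷ d) + (y ÷ e) = _÷_ (x *ᶻ fromℤ (+ e) +ᶻ y *ᶻ fromℤ (+ d)) (d ℕ.* e)
                          {{ℕ.m*n≢0 d e}}

  _*_ : ℚₚ p → ℚₚ p → ℚₚ p
  (x ÷ d) * (y ÷ e) = _÷_ (x *ᶻ y) (d ℕ.* e) {{ℕ.m*n≢0 d e}}

  fromℚ : ℚ → ℚₚ p
  fromℚ q = fromℤ (ℚ.↥ q) ÷ (ℚ.↧ₙ q)

  0ₚ : ℚₚ p
  0ₚ = fromℚ ℚ.0ℚ

HasNontrivialSolution : ∀ {p} → ℚₚ p → ℚₚ p → Set
HasNontrivialSolution {p} a b =
  ∃[ x ] ∃[ y ] ∃[ z ]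
    ¬ (x ≈ 0ₚ × y ≈ 0ₚ × z ≈ 0ₚ) × z * z ≈ a * (x * x) + b * (y * y)

-- The Hilbert symbol as the graph of a function: `HilbertSymbol p a b s` says
-- (a , b)ₚ = s.  It is the Hilbert symbol for p prime and a, b non-zero.
-- Choosing between the two cases is not constructively trivial, so existence
-- of the value has to be proved for given arguments; uniqueness is below.
data HilbertSymbol (p : ℕ) (a b : ℚₚ p) : ℤ → Set where
  solvable   :   HasNontrivialSolution a b → HilbertSymbol p a b 1ℤ
  unsolvable : ¬ HasNontrivialSolution a b → HilbertSymbol p a b -1ℤ

hilbertSymbol-unique : ∀ {p a b s t} →
  HilbertSymbol p a b s → HilbertSymbol p a b t → s ≡ t
hilbertSymbol-unique (solvable _)   (solvable _)   = refl
hilbertSymbol-unique (solvable x)   (unsolvable ¬x) = contradiction x ¬x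
hilbertSymbol-unique (unsolvable ¬x) (solvable x)   = contradiction x ¬x
hilbertSymbol-unique (unsolvable _) (unsolvable _) = refl

primeDivisors : ℕ → List ℕ
primeDivisors n = filter (λ p → prime? p ×-dec p ℕ.∣? n) (upTo (suc n))

∏[p∣_] : ℕ → (ℕ → ℤ) → ℤ
∏[p∣ n ] s = foldr ℤ._*_ 1ℤ (map s (primeDivisors n))

{-# OPTIONS --safe #-}
module Submission where

open import Defs hiding (_+_; _*_; _≈_)
open import Data.Integer using (ℤ; +_; 1ℤ; -1ℤ)
open import Data.Nat using (ℕ; NonZero)
open import Data.Nat.Divisibility using (_∣_; _∤_)
open import Data.Nat.Primality using (Prime)
open import Data.Product using (Σ-syntax; _×_)
open import Data.Rational as ℚ using (_/_)
open import Relation.Binary.PropositionalEquality using (_≡_)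

import Defs
import Algebra.Properties.CommutativeMonoid.Sum
open import Data.Fin as Fin using (Fin; toℕ; fromℕ<)
import Data.Fin.Properties as Fin
import Data.Fin.Permutation as Perm
open import Data.Integer as ℤ using (0ℤ; -[1+_]; _+_; _*_; -_; _-_)
import Data.Integer.Properties as ℤ
import Data.Integer.DivMod as ℤ
open import Data.Integer.Divisibility.Signed as ℤ∣ using () renaming (_∣_ to _∣ℤ_)
import Data.Integer.Tactic.RingSolver as ℤSolver
open import Data.Nat as ℕ using (zero; suc; z≤n; s≤s; _≤_; _<_)
import Data.Nat.Properties as ℕ
import Data.Nat.DivMod as ℕ
import Data.Nat.Divisibility as ℕ
import Data.Nat.Coprimality as Coprime
open import Data.Nat.Coprimality using (Coprime)
import Data.Nat.GCD as GCD
import Data.Nat.Induction as ℕ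
import Induction.WellFounded as ℕ using (Acc; acc)
import Data.Nat.Tactic.RingSolver as ℕSolver
open import Data.Nat.Primality using (prime?; prime[2]; prime⇒irreducible; ¬prime[1]; euclidsLemma; prime⇒nonZero; prime⇒nonTrivial)
open import Data.Product using (∃-syntax; Σ; _,_; proj₁; proj₂)
open import Data.Sign as Sign using (Sign)
import Data.Sign.Properties as Sign
open import Data.Sum using (_⊎_; inj₁; inj₂; [_,_]′)
open import Function using (_∘_; id; _$_)
open import Relation.Binary.PropositionalEquality using (_≢_; refl; sym; trans; cong; cong₂; subst; subst₂; module ≡-Reasoning)
open import Relation.Nullary using (¬_; Dec; yes; no; contradiction)
import Relation.Nullary.Decidable as Dec
open import Relation.Binary.Definitions using (Tri; tri<; tri≈; tri>)
import Algebra.Solver.CommutativeMonoid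
open import Data.List using (List; []; _∷_; upTo)
import Data.List as List
open import Data.List.Membership.Propositional using () renaming (_∈_ to _∈ᴸ_)
import Data.List.Membership.Propositional.Properties as ∈
open import Data.List.Relation.Unary.All as All using (All; []; _∷_)
import Data.List.Relation.Unary.All.Properties as All
open import Data.List.Relation.Unary.Any using (here; there)
open import Data.List.Relation.Unary.AllPairs using ([]; _∷_)
open import Data.List.Relation.Unary.Unique.Propositional using (Unique)
import Data.List.Relation.Unary.Unique.Propositional.Properties as Unique
open import Data.Nat.Primality.Factorisation using (factorise; PrimeFactorisation)
open import Data.Nat.ListAction using (product)
import Data.Rational.Properties as ℚ
open import Data.Rational.Unnormalised as ℚᵘ using (mkℚᵘ; *≡*)
import Data.Rational.Unnormalised.Properties as ℚᵘ

-- Up to the factor u₃ the Hilbert symbol at p says whether u₁X² + u₂Y² + u₃Z² is isotropic over ℚₚ.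
-- Removing common factors and squares turns this form into AX² + BY² + CZ² with A, B, C squarefree and
-- pairwise coprime.  At an odd prime p the form is isotropic if p ∤ ABC, and if p ∣ A exactly if -BC is a
-- square modulo p (Hensel's lemma in one direction, infinite descent in the other).  If p ∤ n, then
-- 4/n = 1/u₁ + 1/u₂ + 1/u₃ is p-integral, so the two largest of the p-adic valuations of the uᵢ agree and
-- the leading parts cancel, which makes -BC a square.  Hence the product over p ∣ n equals the product of
-- the Jacobi symbols (-BC/A′)(-AC/B)(-AB/C), where A′ is the odd part of A, after a permutation which
-- makes B and C odd.  Quadratic reciprocity evaluates it in terms of A, B, C modulo 8, and the same
-- cancellation at 2 leaves only residues for which the value is -1.

-- Behind the statement stands Hilbert's product formula: the symbols at all places multiply to 1,
-- the real place gives -1 because the form is positive definite, and the primes outside n,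
-- including 2, give 1. Neither that formula nor the symbol at 2 is used here. Instead, congruences
-- modulo 4 and 8 are read off from the equation and fed to quadratic reciprocity; the minus signs
-- in -BC, -AC, -AB, that is the positivity of A, B, C, produce the final -1. `HilbertSymbol` asks
-- for a solution or a refutation, so every local symbol has to be decided. A Legendre symbol does
-- this: the value + yields a square root by finite search, the value - refutes every root. An odd
-- prime of A outside n has Legendre symbol 1, so the product over p ∣ n may be completed to all odd
-- primes of A; this is why Jacobi symbols appear. The Gauss-Schering formula defines them for
-- composite moduli without factorisation. Multiplicativity in the modulus is then a consequence of
-- reciprocity and not a step towards it.

module ∑ = Algebra.Properties.CommutativeMonoid.Sum Sign.*-commutativeMonoid

module ∏S = Algebra.Solver.CommutativeMonoid Sign.*-commutativeMonoid

-- Products of signs over {1, ..., n}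

infix 4 _∈[1‥_]

_∈[1‥_] : ℕ → ℕ → Set
k ∈[1‥ n ] = 1 ≤ k × k ≤ n

∏ : (n : ℕ) → (ℕ → Sign) → Sign
∏ n f = ∑.sum {n} (λ i → f (suc (toℕ i)))

toFin : ∀ {n k} → k ∈[1‥ n ] → Fin n
toFin {k = suc k} (_ , k<n) = fromℕ< k<n

toℕ-toFin : ∀ {n k} (k∈ : k ∈[1‥ n ]) → suc (toℕ (toFin k∈)) ≡ k
toℕ-toFin {k = suc k} (_ , k<n) = cong suc (Fin.toℕ-fromℕ< k<n)

suc-toℕ∈ : ∀ {n} (i : Fin n) → suc (toℕ i) ∈[1‥ n ]
suc-toℕ∈ i = s≤s z≤n , Fin.toℕ<n i

∏-cong : ∀ n {f g} → (∀ k → k ∈[1‥ n ] → f k ≡ g k) → ∏ n f ≡ ∏ n g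
∏-cong n f≗g = ∑.sum-cong-≗ {n} (λ i → f≗g _ (suc-toℕ∈ i))

∏-distrib-* : ∀ n f g → ∏ n (λ k → f k Sign.* g k) ≡ ∏ n f Sign.* ∏ n g
∏-distrib-* n f g = ∑.∑-distrib-+ {n} _ _

∏-comm : ∀ m n (f : ℕ → ℕ → Sign) →
         ∏ m (λ i → ∏ n (f i)) ≡ ∏ n (λ j → ∏ m (λ i → f i j))
∏-comm m n f = ∑.∑-comm {m} {n} _

∏-+ : ∀ n → ∏ n (λ _ → Sign.+) ≡ Sign.+
∏-+ = ∑.sum-replicate-zero

∏-permute : ∀ n f (π σ : ℕ → ℕ) →
            (∀ k → k ∈[1‥ n ] → π k ∈[1‥ n ]) → (∀ k → k ∈[1‥ n ] → σ k ∈[1‥ n ]) →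
            (∀ k → k ∈[1‥ n ] → σ (π k) ≡ k) → (∀ k → k ∈[1‥ n ] → π (σ k) ≡ k) →
            ∏ n (f ∘ π) ≡ ∏ n f
∏-permute n f π σ π∈ σ∈ σπ πσ = begin
  ∏ n (f ∘ π)                                 ≡⟨ ∑.sum-cong-≗ {n} (λ i → cong f (sym (toℕ-toFin (π∈ _ (suc-toℕ∈ i))))) ⟩
  ∑.sum (λ i → f (suc (toℕ (πF i))))          ≡⟨ sym (∑.sum-permute {n} _ (Perm.permutation πF σF πσF σπF)) ⟩
  ∏ n f                                       ∎
  where
  open ≡-Reasoning
  πF σF : Fin n → Fin n
  πF i = toFin (π∈ _ (suc-toℕ∈ i))
  σF i = toFin (σ∈ _ (suc-toℕ∈ i))
  πσF : ∀ i → πF (σF i) ≡ i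
  πσF i = Fin.toℕ-injective (ℕ.suc-injective (trans (toℕ-toFin _)
            (trans (cong π (toℕ-toFin (σ∈ _ (suc-toℕ∈ i)))) (πσ _ (suc-toℕ∈ i)))))
  σπF : ∀ i → σF (πF i) ≡ i
  σπF i = Fin.toℕ-injective (ℕ.suc-injective (trans (toℕ-toFin _)
            (trans (cong σ (toℕ-toFin (π∈ _ (suc-toℕ∈ i)))) (σπ _ (suc-toℕ∈ i)))))

⟦_⟧ : Sign → ℤ
⟦ Sign.+ ⟧ = 1ℤ
⟦ Sign.- ⟧ = -1ℤ

⟦⟧-* : ∀ s t → ⟦ s Sign.* t ⟧ ≡ ⟦ s ⟧ * ⟦ t ⟧
⟦⟧-* Sign.+ t      = sym (ℤ.*-identityˡ _)
⟦⟧-* Sign.- Sign.+ = refl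
⟦⟧-* Sign.- Sign.- = refl

⟦s⟧²≡1 : ∀ s → ⟦ s ⟧ * ⟦ s ⟧ ≡ 1ℤ
⟦s⟧²≡1 Sign.+ = refl
⟦s⟧²≡1 Sign.- = refl

-- Congruences and half-systems of residues

infix 4 _≡_[mod_]

-- A record rather than a synonym for the divisibility: a - b does not determine a and b, while from
-- the record type both can be inferred.
record _≡_[mod_] (a b : ℤ) (m : ℕ) : Set where
  constructor mod
  field
    divides : + m ∣ℤ a - b

open _≡_[mod_] public

module _ {m : ℕ} where

  mod-refl : ∀ {a b} → a ≡ b → a ≡ b [mod m ]
  mod-refl {a} refl = mod (ℤ∣.divides 0ℤ (ℤ.+-inverseʳ a))

  mod-sym : ∀ {a b} → a ≡ b [mod m ] → b ≡ a [mod m ]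
  mod-sym {a} {b} (mod a≡b) = mod $ subst (+ m ∣ℤ_) (eq a b) (ℤ∣.∣m⇒∣-m a≡b)
    where
    eq : ∀ a b → - (a - b) ≡ b - a
    eq = ℤSolver.solve-∀

  mod-trans : ∀ {a b c} → a ≡ b [mod m ] → b ≡ c [mod m ] → a ≡ c [mod m ]
  mod-trans {a} {b} {c} (mod a≡b) (mod b≡c) = mod $ subst (+ m ∣ℤ_) (eq a b c) (ℤ∣.∣m∣n⇒∣m+n a≡b b≡c)
    where
    eq : ∀ a b c → (a - b) + (b - c) ≡ a - c
    eq = ℤSolver.solve-∀

  mod-+ : ∀ {a b c d} → a ≡ b [mod m ] → c ≡ d [mod m ] → a + c ≡ b + d [mod m ]
  mod-+ {a} {b} {c} {d} (mod a≡b) (mod c≡d) = mod $ subst (+ m ∣ℤ_) (eq a b c d) (ℤ∣.∣m∣n⇒∣m+n a≡b c≡d)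
    where
    eq : ∀ a b c d → (a - b) + (c - d) ≡ (a + c) - (b + d)
    eq = ℤSolver.solve-∀

  mod-*ˡ : ∀ c {a b} → a ≡ b [mod m ] → c * a ≡ c * b [mod m ]
  mod-*ˡ c {a} {b} (mod a≡b) = mod $ subst (+ m ∣ℤ_) (eq a b c) (ℤ∣.∣n⇒∣m*n c a≡b)
    where
    eq : ∀ a b c → c * (a - b) ≡ c * a - c * b
    eq = ℤSolver.solve-∀

  mod-*ʳ : ∀ c {a b} → a ≡ b [mod m ] → a * c ≡ b * c [mod m ]
  mod-*ʳ c {a} {b} a≡b = subst₂ (_≡_[mod m ]) (ℤ.*-comm c a) (ℤ.*-comm c b) (mod-*ˡ c a≡b)

  mod-* : ∀ {a b c d} → a ≡ b [mod m ] → c ≡ d [mod m ] → a * c ≡ b * d [mod m ]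
  mod-* {b = b} {c} a≡b c≡d = mod-trans (mod-*ʳ c a≡b) (mod-*ˡ b c≡d)

  mod-0⇒∣ : ∀ {a} → a ≡ 0ℤ [mod m ] → + m ∣ℤ a
  mod-0⇒∣ {a} (mod a≡0) = subst (+ m ∣ℤ_) (ℤ.+-identityʳ a) a≡0

  ∣⇒mod-0 : ∀ {a} → + m ∣ℤ a → a ≡ 0ℤ [mod m ]
  ∣⇒mod-0 {a} m∣a = mod (subst (+ m ∣ℤ_) (sym (ℤ.+-identityʳ a)) m∣a)

  ∣-small⇒≡ : ∀ {j k} → j < m → k < m → + j ≡ + k [mod m ] → j ≡ k
  ∣-small⇒≡ {j} {k} j<m k<m j≡k = [ (λ j≤k → go j≤k k<m j≡k) , (λ k≤j → sym (go k≤j j<m (mod-sym j≡k))) ]′ (ℕ.≤-total j k)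
    where
    go : ∀ {j k} → j ≤ k → k < m → + j ≡ + k [mod m ] → j ≡ k
    go {j} {k} j≤k k<m j≡k with k ℕ.∸ j in eq
    ... | zero  = ℕ.≤-antisym j≤k (ℕ.m∸n≡0⇒m≤n eq)
    ... | suc d = contradiction m∣d (ℕ.>⇒∤ (ℕ.≤-<-trans (subst (_≤ k) eq (ℕ.m∸n≤m k j)) k<m))
      where
      m∣d : m ∣ suc d
      m∣d = subst (m ∣_) (trans (cong ℤ.∣_∣ (ℤ.m-n≡m⊖n j k)) (trans (ℤ.∣⊖∣-≤ j≤k) eq)) (ℤ∣.∣⇒∣ᵤ (divides j≡k))

-- The odd numbers are written 1 + 2h, so that {1, …, h} is a system of representatives of the
-- non-zero residues up to sign.
odd : ℕ → ℕ
odd h = suc (h ℕ.+ h)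

≤⇒<odd : ∀ {h k} → k ≤ h → k < odd h
≤⇒<odd {h} k≤h = s≤s (ℕ.≤-trans k≤h (ℕ.m≤m+n h h))

residue : ℕ → ℤ → ℕ
residue h t = t ℤ.%ℕ odd h

opaque

  signRes : ℕ → ℕ → Sign
  signRes h r with r ℕ.≤? h
  ... | yes _ = Sign.+
  ... | no  _ = Sign.-

  absRes : ℕ → ℕ → ℕ
  absRes h r with r ℕ.≤? h
  ... | yes _ = r
  ... | no  _ = odd h ℕ.∸ r

  signRes-≤ : ∀ {h r} → r ≤ h → signRes h r ≡ Sign.+
  signRes-≤ {h} {r} r≤h with r ℕ.≤? h
  ... | yes _   = refl
  ... | no  r≰h = contradiction r≤h r≰h

  signRes-> : ∀ {h r} → ¬ r ≤ h → signRes h r ≡ Sign.-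
  signRes-> {h} {r} r≰h with r ℕ.≤? h
  ... | yes r≤h = contradiction r≤h r≰h
  ... | no  _   = refl

-- Together with `absMod` this is the decomposition t ≡ ± k modulo 1 + 2h with 0 ≤ k ≤ h, read off
-- from the least residue: residues above h are reflected to the negative side.
signMod : ℕ → ℤ → Sign
signMod h t = signRes h (residue h t)

absMod : ℕ → ℤ → ℕ
absMod h t = absRes h (residue h t)

residue-mod : ∀ h t → + residue h t ≡ t [mod odd h ]
residue-mod h t = mod-sym $ mod (ℤ∣.divides (t ℤ./ℕ odd h) (begin
  t - r                            ≡⟨ cong (_- r) (ℤ.a≡a%ℕn+[a/ℕn]*n t (odd h)) ⟩
  r + (t ℤ./ℕ odd h) * + odd h - r ≡⟨ eq r _ ⟩
  (t ℤ./ℕ odd h) * + odd h         ∎))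
  where
  open ≡-Reasoning
  r = + residue h t
  eq : ∀ r x → r + x - r ≡ x
  eq = ℤSolver.solve-∀

residue<odd : ∀ h t → residue h t < odd h
residue<odd h t = ℤ.n%ℕd<d t (odd h)

residue-cong : ∀ h {s t} → s ≡ t [mod odd h ] → residue h s ≡ residue h t
residue-cong h {s} {t} s≡t = ∣-small⇒≡ (residue<odd h s) (residue<odd h t)
  (mod-trans (residue-mod h s) (mod-trans s≡t (mod-sym (residue-mod h t))))

signMod-cong : ∀ h {s t} → s ≡ t [mod odd h ] → signMod h s ≡ signMod h t
signMod-cong h s≡t = cong (signRes h) (residue-cong h s≡t)

opaque
  unfolding signRes absRes

  sign-abs : ∀ h t → ⟦ signMod h t ⟧ * + absMod h t ≡ t [mod odd h ]
  sign-abs h t with residue h t ℕ.≤? h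
  ... | yes _ = mod-trans (mod-refl (ℤ.*-identityˡ _)) (residue-mod h t)
  ... | no  _ = mod-trans (mod-trans (mod-refl eq₁) (mod (ℤ∣.divides -1ℤ (eq₂ (+ r) (+ odd h))))) (residue-mod h t)
    where
    r : ℕ
    r = residue h t
    eq₁ : -1ℤ * + (odd h ℕ.∸ r) ≡ -1ℤ * (+ odd h - + r)
    eq₁ = cong (-1ℤ *_) (trans (sym (ℤ.⊖-≥ (ℕ.<⇒≤ (residue<odd h t)))) (sym (ℤ.m-n≡m⊖n (odd h) r)))
    eq₂ : ∀ r m → -1ℤ * (m - r) - r ≡ -1ℤ * m
    eq₂ = ℤSolver.solve-∀

  absMod-≤ : ∀ h t → absMod h t ≤ h
  absMod-≤ h t with residue h t ℕ.≤? h
  ... | yes r≤h = r≤h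
  ... | no  r≰h = ℕ.m≤n+o⇒m∸n≤o (odd h) (residue h t) (ℕ.+-monoˡ-≤ h (ℕ.≰⇒> r≰h))

absMod∈ : ∀ h {t} → ¬ (+ odd h ∣ℤ t) → absMod h t ∈[1‥ h ]
absMod∈ h {t} m∤t with absMod h t in eq
... | zero  = contradiction (mod-0⇒∣ (mod-sym 0≡t)) m∤t
  where
  0≡t : 0ℤ ≡ t [mod odd h ]
  0≡t = mod-trans (mod-refl (sym (trans (cong (λ k → ⟦ signMod h t ⟧ * + k) eq) (ℤ.*-zeroʳ ⟦ signMod h t ⟧)))) (sign-abs h t)
... | suc _ = s≤s z≤n , subst (_≤ h) eq (absMod-≤ h t)

-- With equal signs m divides j - k, which is smaller than m in absolute value; with opposite signs
-- it would divide j + k, which lies between 2 and 2h < m.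
half-system-unique : ∀ h {s t j k} → j ∈[1‥ h ] → k ∈[1‥ h ] →
                     ⟦ s ⟧ * + j ≡ ⟦ t ⟧ * + k [mod odd h ] → s ≡ t × j ≡ k
half-system-unique h {j = j} {k} (1≤j , j≤h) (1≤k , k≤h) = go _ _
  where
  m = odd h
  same : + j ≡ + k [mod m ] → j ≡ k
  same = ∣-small⇒≡ (≤⇒<odd j≤h) (≤⇒<odd k≤h)
  opposite : ¬ (+ m ∣ℤ + j + + k)
  opposite m∣j+k = ℕ.>⇒∤ {j ℕ.+ k} {{ℕ.>-nonZero (ℕ.≤-trans 1≤j (ℕ.m≤m+n j k))}}
    (s≤s (ℕ.+-mono-≤ j≤h k≤h)) (ℤ∣.∣⇒∣ᵤ m∣j+k)
  eq₁ : ∀ x y → 1ℤ * x - 1ℤ * y ≡ x - y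
  eq₁ = ℤSolver.solve-∀
  eq₂ : ∀ x y → 1ℤ * x - -1ℤ * y ≡ x + y
  eq₂ = ℤSolver.solve-∀
  eq₃ : ∀ x y → - (-1ℤ * x - 1ℤ * y) ≡ x + y
  eq₃ = ℤSolver.solve-∀
  eq₄ : ∀ x y → - (-1ℤ * x - -1ℤ * y) ≡ x - y
  eq₄ = ℤSolver.solve-∀
  go : ∀ s t → ⟦ s ⟧ * + j ≡ ⟦ t ⟧ * + k [mod m ] → s ≡ t × j ≡ k
  go Sign.+ Sign.+ (mod d) = refl , same (mod $ subst (+ m ∣ℤ_) (eq₁ (+ j) (+ k)) d)
  go Sign.+ Sign.- (mod d) = contradiction (subst (+ m ∣ℤ_) (eq₂ (+ j) (+ k)) d) opposite
  go Sign.- Sign.+ (mod d) = contradiction (subst (+ m ∣ℤ_) (eq₃ (+ j) (+ k)) (ℤ∣.∣m⇒∣-m d)) opposite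
  go Sign.- Sign.- (mod d) = refl , same (mod $ subst (+ m ∣ℤ_) (eq₄ (+ j) (+ k)) (ℤ∣.∣m⇒∣-m d))

half-system : ∀ h {s k t} → k ∈[1‥ h ] → ⟦ s ⟧ * + k ≡ t [mod odd h ] →
              signMod h t ≡ s × absMod h t ≡ k
half-system h {s} {k} {t} k∈ sk≡t = half-system-unique h (absMod∈ h m∤t) k∈
  (mod-trans (sign-abs h t) (mod-sym sk≡t))
  where
  m∤t : ¬ (+ odd h ∣ℤ t)
  m∤t m∣t = ℕ.>⇒∤ {k} {{ℕ.>-nonZero (proj₁ k∈)}} (≤⇒<odd (proj₂ k∈))
    (subst (odd h ∣_) (trans (cong ℤ.∣_∣ eq) refl) (ℤ∣.∣⇒∣ᵤ (ℤ∣.∣n⇒∣m*n ⟦ s ⟧ (mod-0⇒∣ (mod-trans sk≡t (∣⇒mod-0 m∣t))))))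
    where
    eq : ⟦ s ⟧ * (⟦ s ⟧ * + k) ≡ + k
    eq = trans (sym (ℤ.*-assoc ⟦ s ⟧ ⟦ s ⟧ (+ k))) (trans (cong (_* + k) (⟦s⟧²≡1 s)) (ℤ.*-identityˡ _))

-- Jacobi symbols

-- The inverse is data, since the inverse permutation of {1, ..., h} and the Newton step of `hensel`
-- compute with it.
record Invertible (m : ℕ) (c : ℤ) : Set where
  constructor unit
  field
    inverse   : ℤ
    isInverse : c * inverse ≡ 1ℤ [mod m ]

open Invertible public

module _ {m : ℕ} where

  invertible-* : ∀ {a b} → Invertible m a → Invertible m b → Invertible m (a * b)
  invertible-* {a} {b} (unit a⁻¹ aa⁻¹≡1) (unit b⁻¹ bb⁻¹≡1) = unit (a⁻¹ * b⁻¹)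
    (mod-trans (mod-refl (eq a b a⁻¹ b⁻¹)) (mod-* aa⁻¹≡1 bb⁻¹≡1))
    where
    eq : ∀ a b c d → a * b * (c * d) ≡ a * c * (b * d)
    eq = ℤSolver.solve-∀

  invertible-neg : ∀ {a} → Invertible m a → Invertible m (- a)
  invertible-neg {a} (unit a⁻¹ aa⁻¹≡1) = unit (- a⁻¹) (mod-trans (mod-refl (eq a a⁻¹)) aa⁻¹≡1)
    where
    eq : ∀ a b → - a * - b ≡ a * b
    eq = ℤSolver.solve-∀

  invertible-cong : ∀ {a b} → a ≡ b [mod m ] → Invertible m a → Invertible m b
  invertible-cong a≡b (unit a⁻¹ aa⁻¹≡1) = unit a⁻¹ (mod-trans (mod-*ʳ a⁻¹ (mod-sym a≡b)) aa⁻¹≡1)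

  invertible-cancel : ∀ {a} x → Invertible m a → + m ∣ℤ a * x → + m ∣ℤ x
  invertible-cancel {a} x (unit a⁻¹ aa⁻¹≡1) m∣ax = mod-0⇒∣ (mod-trans (mod-sym x≡)
    (∣⇒mod-0 (ℤ∣.∣n⇒∣m*n a⁻¹ m∣ax)))
    where
    eq : ∀ a b x → b * (a * x) ≡ a * b * x
    eq = ℤSolver.solve-∀
    x≡ : a⁻¹ * (a * x) ≡ x [mod m ]
    x≡ = mod-trans (mod-refl (eq a a⁻¹ x)) (mod-trans (mod-*ʳ x aa⁻¹≡1) (mod-refl (ℤ.*-identityˡ x)))

  coprime⇒invertible : ∀ c → Coprime ℤ.∣ c ∣ m → Invertible m c
  coprime⇒invertible (+ a) a⊥m with Coprime.coprime-Bézout a⊥m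
  ... | GCD.Bézout.Identity.+- x y eq = unit (+ x) $ mod (ℤ∣.divides (+ y) (begin
    + a * + x - 1ℤ                ≡⟨ cong (_- 1ℤ) (trans (sym (ℤ.pos-* a x)) (cong +_ (trans (ℕ.*-comm a x) (sym eq)))) ⟩
    + (1 ℕ.+ y ℕ.* m) - 1ℤ         ≡⟨ cong (_- 1ℤ) (trans (ℤ.pos-+ 1 (y ℕ.* m)) (cong (λ z → 1ℤ + z) (ℤ.pos-* y m))) ⟩
    1ℤ + + y * + m - 1ℤ           ≡⟨ eq′ (+ y * + m) ⟩
    + y * + m                     ∎))
    where
    open ≡-Reasoning
    eq′ : ∀ z → 1ℤ + z - 1ℤ ≡ z
    eq′ = ℤSolver.solve-∀
  ... | GCD.Bézout.Identity.-+ x y eq = unit (- (+ x)) $ mod (ℤ∣.divides (- (+ y)) (begin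
    + a * - (+ x) - 1ℤ            ≡⟨ eq₁ (+ a) (+ x) ⟩
    - (1ℤ + + x * + a)            ≡⟨ cong (λ z → - (1ℤ + z)) (sym (ℤ.pos-* x a)) ⟩
    - (+ (1 ℕ.+ x ℕ.* a))          ≡⟨ cong (λ z → - (+ z)) eq ⟩
    - (+ (y ℕ.* m))               ≡⟨ cong -_ (ℤ.pos-* y m) ⟩
    - (+ y * + m)                 ≡⟨ ℤ.neg-distribˡ-* (+ y) (+ m) ⟩
    - (+ y) * + m                 ∎))
    where
    open ≡-Reasoning
    eq₁ : ∀ a x → a * - x - 1ℤ ≡ - (1ℤ + x * a)
    eq₁ = ℤSolver.solve-∀
  coprime⇒invertible -[1+ a ] a⊥m = invertible-neg {a = + suc a} (coprime⇒invertible (+ suc a) a⊥m)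

prime∤⇒coprime : ∀ {p a} → Prime p → p ∤ a → Coprime a p
prime∤⇒coprime {p} {a} p-prime p∤a {d} (d∣a , d∣p) with prime⇒irreducible p-prime d∣p
... | inj₁ d≡1 = d≡1
... | inj₂ refl = contradiction d∣a p∤a

opaque

  prime∤⇒invertible : ∀ {p} → Prime p → ∀ c → ¬ (+ p ∣ℤ c) → Invertible p c
  prime∤⇒invertible p-prime c p∤c =
    coprime⇒invertible c (prime∤⇒coprime p-prime (p∤c ∘ ℤ∣.∣ᵤ⇒∣))

∤-half-system : ∀ h {k} → k ∈[1‥ h ] → ¬ (+ odd h ∣ℤ + k)
∤-half-system h {suc k} (_ , k≤h) m∣k = ℕ.>⇒∤ (≤⇒<odd k≤h) (ℤ∣.∣⇒∣ᵤ m∣k)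

-- The Jacobi symbol (c / 1 + 2h), by the Gauss–Schering formula.
opaque

  jacobi : ℤ → ℕ → Sign
  jacobi c h = ∏ h (λ k → signMod h (c * + k))

  jacobi-def : ∀ c h → jacobi c h ≡ ∏ h (λ k → signMod h (c * + k))
  jacobi-def c h = refl

module _ (h : ℕ) where

  private m = odd h

  module _ (a t : ℤ) (m∤at : ¬ (+ m ∣ℤ a * t)) where

    private
      s = signMod h t
      k = absMod h t
      u = a * + k

      su≡at : ⟦ s ⟧ * u ≡ a * t [mod m ]
      su≡at = mod-trans (mod-refl (eq ⟦ s ⟧ a (+ k))) (mod-*ˡ a (sign-abs h t))
        where
        eq : ∀ s a k → s * (a * k) ≡ a * (s * k)
        eq = ℤSolver.solve-∀

      step : ⟦ s Sign.* signMod h u ⟧ * + absMod h u ≡ a * t [mod m ]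
      step = mod-trans (mod-refl (trans (cong (_* + absMod h u) (⟦⟧-* s (signMod h u))) (ℤ.*-assoc ⟦ s ⟧ _ _)))
        (mod-trans (mod-*ˡ ⟦ s ⟧ (sign-abs h u)) su≡at)

      absMod-u∈ : absMod h u ∈[1‥ h ]
      absMod-u∈ = absMod∈ h λ m∣u →
        m∤at (mod-0⇒∣ (mod-trans (mod-sym su≡at) (∣⇒mod-0 (ℤ∣.∣n⇒∣m*n ⟦ s ⟧ m∣u))))

    -- From t ≡ s k follows a t ≡ s (a k): passing from t to its representative k costs the sign s.
    -- This cocycle rule makes `jacobi` multiplicative.
    signMod-* : signMod h (a * t) ≡ signMod h t Sign.* signMod h (a * + absMod h t)
    signMod-* = proj₁ (half-system h {s Sign.* signMod h u} absMod-u∈ step)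

    absMod-* : absMod h (a * t) ≡ absMod h (a * + absMod h t)
    absMod-* = proj₂ (half-system h {s Sign.* signMod h u} absMod-u∈ step)

  invertible-∤ : ∀ {a k} → Invertible m a → k ∈[1‥ h ] → ¬ (+ m ∣ℤ a * + k)
  invertible-∤ {k = k} a-inv k∈ = ∤-half-system h k∈ ∘ invertible-cancel (+ k) a-inv

  absMod-inverse : ∀ {a} (a-inv : Invertible m a) → ∀ k → k ∈[1‥ h ] →
                   absMod h (inverse a-inv * + absMod h (a * + k)) ≡ k
  absMod-inverse {a} a-inv@(unit a⁻¹ aa⁻¹≡1) k k∈ = trans (sym (absMod-* a⁻¹ (a * + k) m∤))
    (proj₂ (half-system h {Sign.+} k∈ (mod-trans (mod-refl (ℤ.*-identityˡ _)) (mod-sym a⁻¹ak≡k))))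
    where
    eq : ∀ a b k → b * (a * k) ≡ a * b * k
    eq = ℤSolver.solve-∀
    a⁻¹ak≡k : a⁻¹ * (a * + k) ≡ + k [mod m ]
    a⁻¹ak≡k = mod-trans (mod-refl (eq a a⁻¹ (+ k))) (mod-trans (mod-*ʳ (+ k) aa⁻¹≡1) (mod-refl (ℤ.*-identityˡ _)))
    m∤ : ¬ (+ m ∣ℤ a⁻¹ * (a * + k))
    m∤ m∣ = ∤-half-system h k∈ (mod-0⇒∣ (mod-trans (mod-sym a⁻¹ak≡k) (∣⇒mod-0 m∣)))

  -- Up to sign a unit permutes the half-system, and the inverse unit gives the inverse permutation.
  ∏-absMod : ∀ {a} → Invertible m a → ∀ f → ∏ h (λ k → f (absMod h (a * + k))) ≡ ∏ h f
  ∏-absMod {a} a-inv@(unit a⁻¹ aa⁻¹≡1) f = ∏-permute h f (λ k → absMod h (a * + k)) (λ k → absMod h (a⁻¹ * + k))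
    (λ k k∈ → absMod∈ h (invertible-∤ a-inv k∈)) (λ k k∈ → absMod∈ h (invertible-∤ a⁻¹-inv k∈))
    (absMod-inverse a-inv) (absMod-inverse a⁻¹-inv)
    where
    a⁻¹-inv : Invertible m a⁻¹
    a⁻¹-inv = unit a (mod-trans (mod-refl (ℤ.*-comm a⁻¹ a)) aa⁻¹≡1)

  jacobi-* : ∀ {a b} → Invertible m a → Invertible m b →
             jacobi (a * b) h ≡ jacobi a h Sign.* jacobi b h
  jacobi-* {a} {b} a-inv b-inv = begin
    jacobi (a * b) h
      ≡⟨ jacobi-def (a * b) h ⟩
    ∏ h (λ k → signMod h (a * b * + k))
      ≡⟨ ∏-cong h (λ k k∈ → trans (cong (signMod h) (ℤ.*-assoc a b (+ k)))
           (signMod-* a (b * + k) (invertible-∤ b-inv k∈ ∘ invertible-cancel _ a-inv))) ⟩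
    ∏ h (λ k → signMod h (b * + k) Sign.* signMod h (a * + absMod h (b * + k)))
      ≡⟨ ∏-distrib-* h (λ k → signMod h (b * + k)) (λ k → signMod h (a * + absMod h (b * + k))) ⟩
    ∏ h (λ k → signMod h (b * + k)) Sign.* ∏ h (λ k → signMod h (a * + absMod h (b * + k)))
      ≡⟨ cong₂ Sign._*_ (sym (jacobi-def b h)) (trans (∏-absMod b-inv (λ k → signMod h (a * + k))) (sym (jacobi-def a h))) ⟩
    jacobi b h Sign.* jacobi a h
      ≡⟨ Sign.*-comm (jacobi b h) (jacobi a h) ⟩
    jacobi a h Sign.* jacobi b h ∎
    where open ≡-Reasoning

  jacobi-cong : ∀ {a b} → a ≡ b [mod m ] → jacobi a h ≡ jacobi b h
  jacobi-cong {a} {b} a≡b = trans (jacobi-def a h) (trans (∏-cong h (λ k _ → signMod-cong h (mod-*ʳ (+ k) a≡b))) (sym (jacobi-def b h)))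

  jacobi-² : ∀ {a} → Invertible m a → jacobi (a * a) h ≡ Sign.+
  jacobi-² {a} a-inv = trans (jacobi-* a-inv a-inv) (Sign.s*s≡+ (jacobi a h))

  jacobi-neg1 : jacobi -1ℤ h ≡ ∏ h (λ _ → Sign.-)
  jacobi-neg1 = trans (jacobi-def -1ℤ h) (∏-cong h (λ k k∈ → proj₁ (half-system h {Sign.-} {k} {t = -1ℤ * + k} k∈ (mod-refl refl))))

-- Squares modulo an odd prime

when : ∀ {P : Set} → Dec P → Sign → Sign
when (yes _) s = s
when (no  _) _ = Sign.+

when-yes : ∀ {P : Set} (P? : Dec P) {s} → P → when P? s ≡ s
when-yes (yes _) _ = refl
when-yes (no ¬p) p = contradiction p ¬p

when-no : ∀ {P : Set} (P? : Dec P) {s} → ¬ P → when P? s ≡ Sign.+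
when-no (yes p) ¬p = contradiction p ¬p
when-no (no _)  _  = refl

when-cong : ∀ {P : Set} (P? : Dec P) {s t} → (P → s ≡ t) → when P? s ≡ when P? t
when-cong (yes p) s≡t = s≡t p
when-cong (no _)  _   = refl

when-+ : ∀ {P : Set} (P? : Dec P) → when P? Sign.+ ≡ Sign.+
when-+ (yes _) = refl
when-+ (no _)  = refl

when-* : ∀ {P : Set} (P? : Dec P) {s t} → when P? s Sign.* when P? t ≡ when P? (s Sign.* t)
when-* (yes _) = refl
when-* (no  _) = refl

-- The two-element orbits of an involution contribute squares.
∏-involution : ∀ n f (τ : ℕ → ℕ) → (∀ k → k ∈[1‥ n ] → τ k ∈[1‥ n ]) →
               (∀ k → k ∈[1‥ n ] → τ (τ k) ≡ k) → (∀ k → k ∈[1‥ n ] → f (τ k) ≡ f k) →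
               ∏ n f ≡ ∏ n (λ k → when (τ k ℕ.≟ k) (f k))
∏-involution n f τ τ∈ ττ fτ = begin
  ∏ n f                                    ≡⟨ ∏-cong n (λ k _ → split k) ⟩
  ∏ n (λ k → below k Sign.* (above k Sign.* fixed k))
    ≡⟨ trans (∏-distrib-* n below (λ k → above k Sign.* fixed k))
             (cong (∏ n below Sign.*_) (∏-distrib-* n above fixed)) ⟩
  ∏ n below Sign.* (∏ n above Sign.* ∏ n fixed)
    ≡⟨ cong (λ s → s Sign.* (∏ n above Sign.* ∏ n fixed)) below≡above ⟩
  ∏ n above Sign.* (∏ n above Sign.* ∏ n fixed)
    ≡⟨ sym (Sign.*-assoc (∏ n above) (∏ n above) (∏ n fixed)) ⟩
  ∏ n above Sign.* ∏ n above Sign.* ∏ n fixed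
    ≡⟨ cong (Sign._* ∏ n fixed) (Sign.s*s≡+ (∏ n above)) ⟩
  ∏ n fixed ∎
  where
  open ≡-Reasoning
  below above fixed : ℕ → Sign
  below k = when (k ℕ.<? τ k) (f k)
  above k = when (τ k ℕ.<? k) (f k)
  fixed k = when (τ k ℕ.≟ k) (f k)
  split : ∀ k → f k ≡ below k Sign.* (above k Sign.* fixed k)
  split k with ℕ.<-cmp (τ k) k
  ... | tri< a ¬b ¬c = sym (trans (cong₂ Sign._*_ (when-no (k ℕ.<? τ k) ¬c) (cong₂ Sign._*_ (when-yes (τ k ℕ.<? k) a) (when-no (τ k ℕ.≟ k) ¬b))) (Sign.*-identityʳ (f k)))
  ... | tri≈ ¬a b ¬c = sym (cong₂ Sign._*_ (when-no (k ℕ.<? τ k) ¬c) (cong₂ Sign._*_ (when-no (τ k ℕ.<? k) ¬a) (when-yes (τ k ℕ.≟ k) b)))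
  ... | tri> ¬a ¬b c = sym (trans (cong₂ Sign._*_ (when-yes (k ℕ.<? τ k) c) (cong₂ Sign._*_ (when-no (τ k ℕ.<? k) ¬a) (when-no (τ k ℕ.≟ k) ¬b))) (Sign.*-identityʳ (f k)))
  below≡above : ∏ n below ≡ ∏ n above
  below≡above = sym (trans (∏-cong n (λ k k∈ → step k k∈)) (∏-permute n below τ τ τ∈ τ∈ ττ ττ))
    where
    step : ∀ k → k ∈[1‥ n ] → above k ≡ below (τ k)
    step k k∈ rewrite ττ k k∈ | fτ k k∈ = refl

∏-single : ∀ n → 1 ≤ n → ∏ n (λ k → when (k ℕ.≟ 1) Sign.-) ≡ Sign.-
∏-single (suc n) _ = cong Sign.opposite (trans (∏-cong n rest) (∏-+ n))
  where
  rest : ∀ k → k ∈[1‥ n ] → when (suc k ℕ.≟ 1) Sign.- ≡ Sign.+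
  rest (suc k) _ = when-no (suc (suc k) ℕ.≟ 1) {Sign.-} (λ ())

-- For a fixed invertible a the map τ sending k to the representative of ± a / k is an involution of
-- {1, …, h} along which the sign δ is constant.  Its fixed points solve k² ≡ δ a, so δ is negative at all
-- of them if a is not a square, and at all of them except k = 1 if a = 1.  Counting fixed points modulo 2,
-- the products of δ for a and for 1 are opposite, and their quotient is (a / p).
module _ (h : ℕ) (p-prime : Prime (odd h)) where

  private
    p = odd h

    opaque

      -- Total, with the default 0 outside {1, ..., h}, so that τ and δ below are plain functions on
      -- ℕ, as `∏` expects.
      inv : ℕ → ℤ
      inv k with (1 ℕ.≤? k) Dec.×-dec (k ℕ.≤? h)
      ... | yes k∈ = inverse (prime∤⇒invertible p-prime (+ k) (∤-half-system h k∈))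
      ... | no  _  = 0ℤ

      inv-right : ∀ {k} → k ∈[1‥ h ] → + k * inv k ≡ 1ℤ [mod p ]
      inv-right {k} k∈ with (1 ℕ.≤? k) Dec.×-dec (k ℕ.≤? h)
      ... | yes k∈′ = isInverse (prime∤⇒invertible p-prime (+ k) (∤-half-system h k∈′))
      ... | no  k∉  = contradiction k∈ k∉

    inv-invertible : ∀ {k} → k ∈[1‥ h ] → Invertible p (inv k)
    inv-invertible {k} k∈ = unit (+ k) (mod-trans (mod-refl (ℤ.*-comm (inv k) (+ k))) (inv-right k∈))

    inv-unique : ∀ {k x} → k ∈[1‥ h ] → + k * x ≡ 1ℤ [mod p ] → inv k ≡ x [mod p ]
    inv-unique {k} {x} k∈ kx≡1 = mod-trans (mod-sym (mod-trans (mod-*ˡ (inv k) kx≡1) (mod-refl (ℤ.*-identityʳ (inv k)))))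
      (mod-trans (mod-refl (eq (inv k) (+ k) x)) (mod-trans (mod-*ʳ x (inv-right k∈)) (mod-refl (ℤ.*-identityˡ x))))
      where
      eq : ∀ i k x → i * (k * x) ≡ k * i * x
      eq = ℤSolver.solve-∀

    module Involution {a} (a-inv : Invertible p a) where

      τ : ℕ → ℕ
      τ k = absMod h (a * inv k)

      δ : ℕ → Sign
      δ k = signMod h (a * inv k)

      δτ≡ : ∀ k → ⟦ δ k ⟧ * + τ k ≡ a * inv k [mod p ]
      δτ≡ k = sign-abs h (a * inv k)

      p∤a/k : ∀ {k} → k ∈[1‥ h ] → ¬ (+ p ∣ℤ a * inv k)
      p∤a/k {k} k∈ p∣ = ∤-half-system h {1} (s≤s z≤n , ℕ.≤-trans (proj₁ k∈) (proj₂ k∈))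
        (invertible-cancel 1ℤ (invertible-* a-inv (inv-invertible k∈)) (ℤ∣.∣m⇒∣m*n 1ℤ p∣))

      τ∈ : ∀ k → k ∈[1‥ h ] → τ k ∈[1‥ h ]
      τ∈ k k∈ = absMod∈ h (p∤a/k k∈)

      -- From δ τ ≡ a / k the inverse of τ is δ k / a, so a / τ ≡ δ k; uniqueness of the
      -- representation of a / τ gives both equations.
      τδ-involutive : ∀ k → k ∈[1‥ h ] → δ (τ k) ≡ δ k × τ (τ k) ≡ k
      τδ-involutive k k∈ = half-system h {δ k} k∈ (mod-sym (mod-trans (mod-*ˡ a (inv-unique (τ∈ k k∈) inverse-of-τ)) a/τ≡))
        where
        a⁻¹ = inverse a-inv
        d = ⟦ δ k ⟧
        eq₁ : ∀ t d k a⁻¹ → t * (d * k * a⁻¹) ≡ d * t * (k * a⁻¹)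
        eq₁ = ℤSolver.solve-∀
        eq₂ : ∀ a i k a⁻¹ → a * i * (k * a⁻¹) ≡ a * a⁻¹ * (k * i)
        eq₂ = ℤSolver.solve-∀
        eq₃ : ∀ a d k a⁻¹ → a * (d * k * a⁻¹) ≡ a * a⁻¹ * (d * k)
        eq₃ = ℤSolver.solve-∀
        inverse-of-τ : + τ k * (d * + k * a⁻¹) ≡ 1ℤ [mod p ]
        inverse-of-τ = mod-trans (mod-refl (eq₁ (+ τ k) d (+ k) a⁻¹)) (mod-trans (mod-*ʳ (+ k * a⁻¹) (δτ≡ k))
          (mod-trans (mod-refl (eq₂ a (inv k) (+ k) a⁻¹)) (mod-* (isInverse a-inv) (inv-right k∈))))
        a/τ≡ : a * (d * + k * a⁻¹) ≡ d * + k [mod p ]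
        a/τ≡ = mod-trans (mod-refl (eq₃ a d (+ k) a⁻¹)) (mod-trans (mod-*ʳ (d * + k) (isInverse a-inv)) (mod-refl (ℤ.*-identityˡ _)))

      fixed-point : ∀ {k} → k ∈[1‥ h ] → τ k ≡ k → + k * + k ≡ ⟦ δ k ⟧ * a [mod p ]
      fixed-point {k} k∈ τk≡k = mod-trans (mod-refl eq) (mod-trans (mod-*ˡ ⟦ δ k ⟧ (mod-*ʳ (+ k) (subst (λ t → ⟦ δ k ⟧ * + t ≡ a * inv k [mod p ]) τk≡k (δτ≡ k))))
        (mod-trans (mod-refl (eq₂ ⟦ δ k ⟧ a (inv k) (+ k))) (mod-trans (mod-*ˡ (⟦ δ k ⟧ * a) (inv-right k∈)) (mod-refl (ℤ.*-identityʳ _)))))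
        where
        eq₁ : ∀ d k → d * (d * k * k) ≡ d * d * (k * k)
        eq₁ = ℤSolver.solve-∀
        eq₂ : ∀ d a i k → d * (a * i * k) ≡ d * a * (k * i)
        eq₂ = ℤSolver.solve-∀
        eq : + k * + k ≡ ⟦ δ k ⟧ * (⟦ δ k ⟧ * + k * + k)
        eq = sym (trans (eq₁ ⟦ δ k ⟧ (+ k)) (trans (cong (_* (+ k * + k)) (⟦s⟧²≡1 (δ k))) (ℤ.*-identityˡ _)))

      ∏-fixed : ∏ h δ ≡ ∏ h (λ k → when (τ k ℕ.≟ k) (δ k))
      ∏-fixed = ∏-involution h δ τ τ∈ (λ k k∈ → proj₂ (τδ-involutive k k∈)) (λ k k∈ → proj₁ (τδ-involutive k k∈))

      -- A constant function is invariant under τ too, so the number of fixed points has the parity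
      -- of h for every a. This makes the counts for a and for 1 comparable.
      ∏-count-fixed : ∏ h (λ _ → Sign.-) ≡ ∏ h (λ k → when (τ k ℕ.≟ k) Sign.-)
      ∏-count-fixed = ∏-involution h (λ _ → Sign.-) τ τ∈ (λ k k∈ → proj₂ (τδ-involutive k k∈)) (λ _ _ → refl)

    1-inv : Invertible p 1ℤ
    1-inv = unit 1ℤ (mod-refl refl)

    module I₁ = Involution {1ℤ} 1-inv

    ∏δ₁ : 1 ≤ h → ∏ h I₁.δ Sign.* ∏ h (λ _ → Sign.-) ≡ Sign.-
    ∏δ₁ 1≤h = begin
      ∏ h I₁.δ Sign.* ∏ h (λ _ → Sign.-)   ≡⟨ cong₂ Sign._*_ I₁.∏-fixed I₁.∏-count-fixed ⟩
      ∏ h (λ k → when (I₁.τ k ℕ.≟ k) (I₁.δ k)) Sign.* ∏ h (λ k → when (I₁.τ k ℕ.≟ k) Sign.-)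
        ≡⟨ sym (∏-distrib-* h (λ k → when (I₁.τ k ℕ.≟ k) (I₁.δ k)) (λ k → when (I₁.τ k ℕ.≟ k) Sign.-)) ⟩
      ∏ h (λ k → when (I₁.τ k ℕ.≟ k) (I₁.δ k) Sign.* when (I₁.τ k ℕ.≟ k) Sign.-)
        ≡⟨ ∏-cong h (λ k k∈ → trans (when-* (I₁.τ k ℕ.≟ k) {I₁.δ k} {Sign.-}) (pointwise k k∈)) ⟩
      ∏ h (λ k → when (k ℕ.≟ 1) Sign.-)    ≡⟨ ∏-single h 1≤h ⟩
      Sign.- ∎
      where
      open ≡-Reasoning
      δτ-1 : I₁.δ 1 ≡ Sign.+ × I₁.τ 1 ≡ 1
      δτ-1 = half-system h {Sign.+} (s≤s z≤n , 1≤h) (mod-sym (mod-*ˡ 1ℤ (inv-unique {1} {1ℤ} (s≤s z≤n , 1≤h) (mod-refl refl))))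
      eq : ∀ k → (1ℤ + k) * (1ℤ + k) - 1ℤ ≡ k * (+ 2 + k)
      eq = ℤSolver.solve-∀
      multiple<p : ∀ k → p ∣ k → k < p → k ≡ 0
      multiple<p zero    _   _   = refl
      multiple<p (suc k) p∣k k<p = contradiction p∣k (ℕ.>⇒∤ k<p)
      root-of-1 : ∀ k → k ∈[1‥ h ] → + k * + k ≡ 1ℤ [mod p ] → k ≡ 1
      root-of-1 (suc k) k∈@(_ , k≤h) k²≡1 with euclidsLemma k (2 ℕ.+ k) p-prime
        (subst (p ∣_) (trans (cong ℤ.∣_∣ (eq (+ k))) (ℤ.abs-* (+ k) (+ (2 ℕ.+ k)))) (ℤ∣.∣⇒∣ᵤ (divides k²≡1)))
      ... | inj₁ p∣k   = cong suc (multiple<p k p∣k (≤⇒<odd (ℕ.≤-trans (ℕ.n≤1+n k) k≤h)))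
      ... | inj₂ p∣2+k = contradiction p∣2+k (ℕ.>⇒∤ (s≤s (ℕ.+-mono-≤ 1≤h k≤h)))
      pointwise : ∀ k → k ∈[1‥ h ] → when (I₁.τ k ℕ.≟ k) (I₁.δ k Sign.* Sign.-) ≡ when (k ℕ.≟ 1) Sign.-
      pointwise k k∈ with k ℕ.≟ 1
      ... | yes refl = trans (when-yes (I₁.τ 1 ℕ.≟ 1) (proj₂ δτ-1)) (cong (Sign._* Sign.-) (proj₁ δτ-1))
      ... | no  k≢1  = trans (when-cong (I₁.τ k ℕ.≟ k) (λ τk≡k → δ≡- (I₁.δ k) (I₁.fixed-point k∈ τk≡k))) (when-+ (I₁.τ k ℕ.≟ k))
        where
        δ≡- : ∀ s → + k * + k ≡ ⟦ s ⟧ * 1ℤ [mod p ] → s Sign.* Sign.- ≡ Sign.+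
        δ≡- Sign.+ k²≡1 = contradiction (root-of-1 k k∈ k²≡1) k≢1
        δ≡- Sign.- _    = refl

  nonsquare⇒jacobi≡- : ∀ {a} → Invertible p a → 1 ≤ h →
                       (∀ k → k ∈[1‥ h ] → ¬ (+ k * + k ≡ a [mod p ])) → jacobi a h ≡ Sign.-
  nonsquare⇒jacobi≡- {a} a-inv 1≤h nonsquare = begin
    -- `I₁.τ` is inversion up to sign. Reindexing by it turns a k into a times the representative of
    -- 1 / k, whose sign is the sign of a / k divided by that of 1 / k.
    jacobi a h                                                 ≡⟨ trans (jacobi-def a h) (sym (∏-τ₁ (λ k → signMod h (a * + k)))) ⟩
    ∏ h (λ k → signMod h (a * + I₁.τ k))                       ≡⟨ cancel (∏ h I₁.δ) _ ⟩
    ∏ h I₁.δ Sign.* (∏ h I₁.δ Sign.* ∏ h (λ k → signMod h (a * + I₁.τ k)))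
      ≡⟨ cong (∏ h I₁.δ Sign.*_) (sym (trans (∏-cong h δ-split) (∏-distrib-* h I₁.δ (λ k → signMod h (a * + I₁.τ k))))) ⟩
    ∏ h I₁.δ Sign.* ∏ h Iₐ.δ                                   ≡⟨ cong (∏ h I₁.δ Sign.*_) ∏δₐ ⟩
    ∏ h I₁.δ Sign.* ∏ h (λ _ → Sign.-)                         ≡⟨ ∏δ₁ 1≤h ⟩
    Sign.- ∎
    where
    open ≡-Reasoning
    module Iₐ = Involution {a} a-inv
    cancel : ∀ s t → t ≡ s Sign.* (s Sign.* t)
    cancel Sign.+ t = refl
    cancel Sign.- t = sym (Sign.opposite-involutive t)
    ∏-τ₁ : ∀ f → ∏ h (f ∘ I₁.τ) ≡ ∏ h f
    ∏-τ₁ f = ∏-permute h f I₁.τ I₁.τ I₁.τ∈ I₁.τ∈ (λ k k∈ → proj₂ (I₁.τδ-involutive k k∈)) (λ k k∈ → proj₂ (I₁.τδ-involutive k k∈))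
    δ-split : ∀ k → k ∈[1‥ h ] → Iₐ.δ k ≡ I₁.δ k Sign.* signMod h (a * + I₁.τ k)
    δ-split k k∈ = trans (cong (λ x → signMod h (a * x)) (sym (ℤ.*-identityˡ (inv k))))
      (signMod-* h a (1ℤ * inv k) (I₁.p∤a/k k∈ ∘ invertible-cancel _ a-inv))
    ∏δₐ : ∏ h Iₐ.δ ≡ ∏ h (λ _ → Sign.-)
    ∏δₐ = trans Iₐ.∏-fixed (trans (∏-cong h pointwise) (sym Iₐ.∏-count-fixed))
      where
      δ≡- : ∀ k → k ∈[1‥ h ] → ∀ s → + k * + k ≡ ⟦ s ⟧ * a [mod p ] → s ≡ Sign.-
      δ≡- k k∈ Sign.+ k²≡a = contradiction (mod-trans k²≡a (mod-refl (ℤ.*-identityˡ a))) (nonsquare k k∈)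
      δ≡- k k∈ Sign.- _    = refl
      pointwise : ∀ k → k ∈[1‥ h ] → when (Iₐ.τ k ℕ.≟ k) (Iₐ.δ k) ≡ when (Iₐ.τ k ℕ.≟ k) Sign.-
      pointwise k k∈ = when-cong (Iₐ.τ k ℕ.≟ k) (λ τk≡k → δ≡- k k∈ (Iₐ.δ k) (Iₐ.fixed-point k∈ τk≡k))

  opaque

    -- A root is searched for among 0, ..., h; if there were none, the symbol would be -. The case h
    -- = 0 is excluded because the modulus 1 is not prime.
    jacobi≡+⇒square : ∀ {a} → Invertible p a → jacobi a h ≡ Sign.+ → ∃[ r ] r * r ≡ a [mod p ]
    jacobi≡+⇒square {a} a-inv a≡+ with ℕ.anyUpTo? (λ k → (+ p) ℤ∣.∣? (+ k * + k - a)) (suc h)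
    ... | yes (k , _ , k²≡a) = + k , mod k²≡a
    ... | no nonsquare with 1 ℕ.≤? h
    ...   | yes 1≤h = contradiction (trans (sym a≡+) (nonsquare⇒jacobi≡- a-inv 1≤h λ k k∈ k²≡a → nonsquare (k , s≤s (proj₂ k∈) , divides k²≡a))) λ ()
    ...   | no  h≡0 with refl ← ℕ.n<1⇒n≡0 (ℕ.≰⇒> h≡0) = contradiction p-prime ¬prime[1]

  jacobi≡-⇒nonsquare : ∀ {a} → Invertible p a → jacobi a h ≡ Sign.- → ∀ r → ¬ (r * r ≡ a [mod p ])
  jacobi≡-⇒nonsquare {a} a-inv a≡- r r²≡a = contradiction (trans (sym a≡-) (trans (jacobi-cong h (mod-sym r²≡a)) (jacobi-² h r-inv))) λ ()
    where
    r-inv : Invertible p r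
    r-inv = unit (r * inverse a-inv) (mod-trans (mod-refl (sym (ℤ.*-assoc r r _))) (mod-trans (mod-*ʳ _ r²≡a) (isInverse a-inv)))

-- Quadratic reciprocity

σ : ℕ → ℕ → Sign
σ x y with y ℕ.<? x
... | yes _ = Sign.+
... | no  _ = Sign.-

σ-< : ∀ {x y} → y < x → σ x y ≡ Sign.+
σ-< {x} {y} y<x with y ℕ.<? x
... | yes _   = refl
... | no  y≮x = contradiction y<x y≮x

σ-≥ : ∀ {x y} → x ≤ y → σ x y ≡ Sign.-
σ-≥ {x} {y} x≤y with y ℕ.<? x
... | yes y<x = contradiction x≤y (ℕ.<⇒≱ y<x)
... | no  _   = refl

σ-cong : ∀ {x y x′ y′} → (y < x → y′ < x′) → (y′ < x′ → y < x) → σ x y ≡ σ x′ y′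
σ-cong {x} {y} f g with y ℕ.<? x
... | yes y<x = sym (σ-< (f y<x))
... | no  y≮x = sym (σ-≥ (ℕ.≮⇒≥ (y≮x ∘ g)))

σ-flip : ∀ {x y} → x ≢ y → σ x y Sign.* σ y x ≡ Sign.-
σ-flip {x} {y} x≢y with ℕ.<-cmp x y
... | tri< x<y _ _ = cong₂ Sign._*_ (σ-≥ (ℕ.<⇒≤ x<y)) (σ-< x<y)
... | tri≈ _ x≡y _ = contradiction x≡y x≢y
... | tri> _ _ y<x = cong₂ Sign._*_ (σ-< y<x) (σ-≥ (ℕ.<⇒≤ y<x))

-- The half-integer multiples of m below t determine on which side of m / 2 the residue of t lies.
signMod-∏ : ∀ h N t → t ℕ.+ t < suc N ℕ.* odd h →
            signMod h (+ t) ≡ ∏ N (λ j → σ (j ℕ.* odd h) (t ℕ.+ t))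
signMod-∏ h = go
  where
  m = odd h

  m≤2t : ∀ {t} → h < t → 1 ℕ.* m ≤ t ℕ.+ t
  m≤2t {t} h<t = subst (_≤ t ℕ.+ t) (sym (ℕ.*-identityˡ m)) (ℕ.+-mono-≤ h<t (ℕ.<⇒≤ h<t))

  2m≤2t : ∀ {t} → m ≤ t → 2 ℕ.* m ≤ t ℕ.+ t
  2m≤2t {t} m≤t = subst (_≤ t ℕ.+ t) (cong (m ℕ.+_) (sym (ℕ.+-identityʳ m))) (ℕ.+-mono-≤ m≤t m≤t)

  small-factors : ∀ N {t} → t ≤ h → ∏ N (λ j → σ (j ℕ.* m) (t ℕ.+ t)) ≡ Sign.+
  small-factors N {t} t≤h = trans (∏-cong N pos) (∏-+ N)
    where
    pos : ∀ j → j ∈[1‥ N ] → σ (j ℕ.* m) (t ℕ.+ t) ≡ Sign.+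
    pos (suc j) _ = σ-< (ℕ.<-≤-trans (s≤s (ℕ.+-mono-≤ t≤h t≤h)) (ℕ.m≤m+n m (j ℕ.* m)))

  large-factors : ∀ N {t} → t < m → ∏ N (λ j → σ (suc j ℕ.* m) (t ℕ.+ t)) ≡ Sign.+
  large-factors N {t} t<m = trans (∏-cong N pos) (∏-+ N)
    where
    pos : ∀ j → j ∈[1‥ N ] → σ (suc j ℕ.* m) (t ℕ.+ t) ≡ Sign.+
    pos (suc j) _ = σ-< (ℕ.<-≤-trans (ℕ.+-mono-<-≤ t<m (ℕ.<⇒≤ t<m)) (ℕ.+-monoʳ-≤ m (ℕ.m≤m+n m (j ℕ.* m))))

  shift : ∀ t → (m ℕ.+ t) ℕ.+ (m ℕ.+ t) ≡ 2 ℕ.* m ℕ.+ (t ℕ.+ t)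
  shift t = eq m t
    where
    eq : ∀ m t → (m ℕ.+ t) ℕ.+ (m ℕ.+ t) ≡ 2 ℕ.* m ℕ.+ (t ℕ.+ t)
    eq = ℕSolver.solve-∀

  go : ∀ N t → t ℕ.+ t < suc N ℕ.* m → signMod h (+ t) ≡ ∏ N (λ j → σ (j ℕ.* m) (t ℕ.+ t))

  -- Adding m to t keeps the residue and adds 2m to 2t: the factors for j = 1 and j = 2 are both -
  -- and cancel, and the remaining ones are the old factors shifted by two.
  step : ∀ N t → (m ℕ.+ t) ℕ.+ (m ℕ.+ t) < suc (suc (suc N)) ℕ.* m →
         signMod h (+ (m ℕ.+ t)) ≡ ∏ (suc (suc N)) (λ j → σ (j ℕ.* m) ((m ℕ.+ t) ℕ.+ (m ℕ.+ t)))
  step N t 2t< = begin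
    signMod h (+ (m ℕ.+ t))                 ≡⟨ cong (signRes h) (trans (ℕ.%-congˡ (ℕ.+-comm m t)) (ℕ.[m+n]%n≡m%n t m)) ⟩
    signMod h (+ t)                         ≡⟨ go N t (ℕ.+-cancelˡ-< (2 ℕ.* m) _ _ (subst₂ _<_ (shift t) (eq m N) 2t<)) ⟩
    ∏ N (λ j → σ (j ℕ.* m) (t ℕ.+ t))       ≡⟨ ∏-cong N (λ j _ → σ-cong (into j) (out j)) ⟩
    rest                                    ≡⟨ sym (Sign.opposite-involutive rest) ⟩
    Sign.- Sign.* (Sign.- Sign.* rest)
      ≡⟨ sym (cong₂ Sign._*_ (σ-≥ (m≤2t (ℕ.≤-trans (s≤s (ℕ.m≤m+n h h)) (ℕ.m≤m+n m t))))
                             (cong (Sign._* rest) (σ-≥ (2m≤2t (ℕ.m≤m+n m t))))) ⟩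
    ∏ (suc (suc N)) (λ j → σ (j ℕ.* m) ((m ℕ.+ t) ℕ.+ (m ℕ.+ t))) ∎
    where
    open ≡-Reasoning
    rest = ∏ N (λ j → σ ((2 ℕ.+ j) ℕ.* m) ((m ℕ.+ t) ℕ.+ (m ℕ.+ t)))
    eq : ∀ m N → (3 ℕ.+ N) ℕ.* m ≡ 2 ℕ.* m ℕ.+ (1 ℕ.+ N) ℕ.* m
    eq = ℕSolver.solve-∀
    eq′ : ∀ j → (2 ℕ.+ j) ℕ.* m ≡ 2 ℕ.* m ℕ.+ j ℕ.* m
    eq′ j = ℕ.*-distribʳ-+ m 2 j
    into : ∀ j → t ℕ.+ t < j ℕ.* m → (m ℕ.+ t) ℕ.+ (m ℕ.+ t) < (2 ℕ.+ j) ℕ.* m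
    into j lt = subst₂ _<_ (sym (shift t)) (sym (eq′ j)) (ℕ.+-monoʳ-< (2 ℕ.* m) lt)
    out : ∀ j → (m ℕ.+ t) ℕ.+ (m ℕ.+ t) < (2 ℕ.+ j) ℕ.* m → t ℕ.+ t < j ℕ.* m
    out j lt = ℕ.+-cancelˡ-< (2 ℕ.* m) _ _ (subst₂ _<_ (shift t) (eq′ j) lt)

  -- For t < m all factors with j ≥ 2 are +, and the one for j = 1 is - exactly if t > h.
  go-small : ∀ N t → t < m → t ℕ.+ t < suc N ℕ.* m → signRes h t ≡ ∏ N (λ j → σ (j ℕ.* m) (t ℕ.+ t))
  go-small N t t<m 2t< with t ℕ.≤? h
  go-small N       t t<m 2t< | yes t≤h = trans (signRes-≤ t≤h) (sym (small-factors N t≤h))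
  go-small zero    t t<m 2t< | no t≰h  = contradiction (m≤2t (ℕ.≰⇒> t≰h)) (ℕ.<⇒≱ 2t<)
  go-small (suc N) t t<m 2t< | no t≰h  = trans (signRes-> t≰h) (sym (cong₂ Sign._*_ (σ-≥ (m≤2t (ℕ.≰⇒> t≰h))) (large-factors N t<m)))

  go N t 2t< with t ℕ.<? m
  go N t 2t< | yes t<m = trans (cong (signRes h) (ℕ.m<n⇒m%n≡m t<m)) (go-small N t t<m 2t<)
  go zero          t 2t< | no t≮m = contradiction (ℕ.≤-trans (ℕ.*-monoˡ-≤ m (s≤s (z≤n {1}))) (2m≤2t (ℕ.≮⇒≥ t≮m))) (ℕ.<⇒≱ 2t<)
  go (suc zero)    t 2t< | no t≮m = contradiction (2m≤2t (ℕ.≮⇒≥ t≮m)) (ℕ.<⇒≱ 2t<)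
  go (suc (suc N)) t 2t< | no t≮m = subst (λ t → t ℕ.+ t < (3 ℕ.+ N) ℕ.* m → signMod h (+ t) ≡ ∏ (suc (suc N)) (λ j → σ (j ℕ.* m) (t ℕ.+ t)))
    (ℕ.m+[n∸m]≡n (ℕ.≮⇒≥ t≮m)) (step N (t ℕ.∸ m)) 2t<

-- The odd indices up to 2n are enumerated as 1 + 2n - 2i rather than 2i - 1, so that the second
-- factor belongs to ½ - i / (1 + 2n) when the first belongs to i / (1 + 2n).
∏-odd-even : ∀ n g → ∏ (n ℕ.+ n) g ≡ ∏ n (λ i → g (i ℕ.+ i) Sign.* g (odd n ℕ.∸ (i ℕ.+ i)))
∏-odd-even n g = begin
  ∏ (n ℕ.+ n) g                                                         ≡⟨ pairs n g ⟩
  ∏ n (λ i → g (i ℕ.+ i) Sign.* g (ℕ.pred (i ℕ.+ i)))                   ≡⟨ ∏-distrib-* n (λ i → g (i ℕ.+ i)) (λ i → g (ℕ.pred (i ℕ.+ i))) ⟩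
  ∏ n (λ i → g (i ℕ.+ i)) Sign.* ∏ n (λ i → g (ℕ.pred (i ℕ.+ i)))
    ≡⟨ cong (∏ n (λ i → g (i ℕ.+ i)) Sign.*_) (sym (trans (∏-cong n (λ i i∈ → cong g (mirror i i∈)))
         (∏-permute n (λ i → g (ℕ.pred (i ℕ.+ i))) (suc n ℕ.∸_) (suc n ℕ.∸_) flip∈ flip∈ flip-flip flip-flip))) ⟩
  ∏ n (λ i → g (i ℕ.+ i)) Sign.* ∏ n (λ i → g (odd n ℕ.∸ (i ℕ.+ i)))    ≡⟨ sym (∏-distrib-* n (λ i → g (i ℕ.+ i)) (λ i → g (odd n ℕ.∸ (i ℕ.+ i)))) ⟩
  ∏ n (λ i → g (i ℕ.+ i) Sign.* g (odd n ℕ.∸ (i ℕ.+ i)))                ∎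
  where
  open ≡-Reasoning
  pairs : ∀ n g → ∏ (n ℕ.+ n) g ≡ ∏ n (λ i → g (i ℕ.+ i) Sign.* g (ℕ.pred (i ℕ.+ i)))
  pairs zero    g = refl
  pairs (suc n) g = begin
    ∏ (suc n ℕ.+ suc n) g                          ≡⟨ cong (λ k → ∏ (suc k) g) (ℕ.+-suc n n) ⟩
    g 1 Sign.* (g 2 Sign.* ∏ (n ℕ.+ n) (g ∘ suc ∘ suc))
      ≡⟨ trans (sym (Sign.*-assoc (g 1) (g 2) _)) (cong₂ Sign._*_ (Sign.*-comm (g 1) (g 2)) (pairs n (g ∘ suc ∘ suc))) ⟩
    g 2 Sign.* g 1 Sign.* ∏ n (λ i → g (2 ℕ.+ (i ℕ.+ i)) Sign.* g (2 ℕ.+ ℕ.pred (i ℕ.+ i)))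
      ≡⟨ cong (g 2 Sign.* g 1 Sign.*_) (∏-cong n (λ i i∈ → reindex i i∈)) ⟩
    ∏ (suc n) (λ i → g (i ℕ.+ i) Sign.* g (ℕ.pred (i ℕ.+ i))) ∎
    where
    reindex : ∀ i → i ∈[1‥ n ] → g (2 ℕ.+ (i ℕ.+ i)) Sign.* g (2 ℕ.+ ℕ.pred (i ℕ.+ i)) ≡
              g (suc i ℕ.+ suc i) Sign.* g (ℕ.pred (suc i ℕ.+ suc i))
    reindex (suc i) _ = cong₂ Sign._*_ (cong (g ∘ suc) (sym (ℕ.+-suc (suc i) (suc i)))) (cong g (sym (ℕ.+-suc (suc i) (suc i))))
  mirror : ∀ i → i ∈[1‥ n ] → odd n ℕ.∸ (i ℕ.+ i) ≡ ℕ.pred ((suc n ℕ.∸ i) ℕ.+ (suc n ℕ.∸ i))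
  mirror i (_ , i≤n) = begin
    odd n ℕ.∸ (i ℕ.+ i)                          ≡⟨ cong (λ k → ℕ.pred k ℕ.∸ (i ℕ.+ i)) (sym (ℕ.+-suc (suc n) n)) ⟩
    ℕ.pred (suc n ℕ.+ suc n) ℕ.∸ (i ℕ.+ i)        ≡⟨ ℕ.pred[m∸n]≡m∸[1+n] (suc n ℕ.+ suc n) (i ℕ.+ i) ⟨
    ℕ.pred ((suc n ℕ.+ suc n) ℕ.∸ (i ℕ.+ i))      ≡⟨ cong ℕ.pred (∸-double (suc n) i (ℕ.m≤n⇒m≤1+n i≤n)) ⟩
    ℕ.pred ((suc n ℕ.∸ i) ℕ.+ (suc n ℕ.∸ i))      ∎
    where
    ∸-double : ∀ a i → i ≤ a → (a ℕ.+ a) ℕ.∸ (i ℕ.+ i) ≡ (a ℕ.∸ i) ℕ.+ (a ℕ.∸ i)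
    ∸-double a i i≤a = begin
      (a ℕ.+ a) ℕ.∸ (i ℕ.+ i)          ≡⟨ ℕ.∸-+-assoc (a ℕ.+ a) i i ⟨
      a ℕ.+ a ℕ.∸ i ℕ.∸ i              ≡⟨ cong (ℕ._∸ i) (ℕ.+-∸-assoc a i≤a) ⟩
      a ℕ.+ (a ℕ.∸ i) ℕ.∸ i            ≡⟨ cong (ℕ._∸ i) (ℕ.+-comm a (a ℕ.∸ i)) ⟩
      (a ℕ.∸ i) ℕ.+ a ℕ.∸ i            ≡⟨ ℕ.+-∸-assoc (a ℕ.∸ i) i≤a ⟩
      (a ℕ.∸ i) ℕ.+ (a ℕ.∸ i)          ∎
  flip∈ : ∀ i → i ∈[1‥ n ] → suc n ℕ.∸ i ∈[1‥ n ]
  flip∈ (suc i) (_ , i<n) = ℕ.m<n⇒0<n∸m i<n , ℕ.m∸n≤m n i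
  flip-flip : ∀ i → i ∈[1‥ n ] → suc n ℕ.∸ (suc n ℕ.∸ i) ≡ i
  flip-flip i (_ , i≤n) = ℕ.m∸[m∸n]≡n (ℕ.m≤n⇒m≤1+n i≤n)

-- (-1) to the power n. For m = 1 + 2h the sign ε h is (-1 / m): + if m ≡ 1 and - if m ≡ 3 modulo 4.
ε : ℕ → Sign
ε n = ∏ n (λ _ → Sign.-)

-- For x = k / (1 + 2h) in (0, ½) the zeros i / n and ½ - i / n of sin 2πnx, n = 1 + 2h′, in (0, ½) are
-- compared with x; only the comparison of i / n with k / m changes when the two moduli are exchanged.
module _ (h h′ : ℕ) where

  private
    m n : ℕ
    m = odd h
    n = odd h′

  cross : ℕ → ℕ → Sign
  cross k i = σ ((i ℕ.+ i) ℕ.* odd h) (odd h′ ℕ.* k ℕ.+ odd h′ ℕ.* k)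
    Sign.* σ (n ℕ.* m) (n ℕ.* (k ℕ.+ k) ℕ.+ m ℕ.* (i ℕ.+ i))

  jacobi-∏∏ : jacobi (+ n) h ≡ ∏ h (λ k → ∏ h′ (cross k))
  jacobi-∏∏ = trans (jacobi-def (+ n) h) $ ∏-cong h λ k k∈ → begin
    signMod h (+ n * + k)                    ≡⟨ cong (signMod h) (sym (ℤ.pos-* n k)) ⟩
    signMod h (+ (n ℕ.* k))                  ≡⟨ signMod-∏ h (h′ ℕ.+ h′) (n ℕ.* k) (bound k∈) ⟩
    ∏ (h′ ℕ.+ h′) (λ j → σ (j ℕ.* m) (n ℕ.* k ℕ.+ n ℕ.* k))   ≡⟨ ∏-odd-even h′ (λ j → σ (j ℕ.* m) (n ℕ.* k ℕ.+ n ℕ.* k)) ⟩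
    ∏ h′ (λ i → σ ((i ℕ.+ i) ℕ.* m) (n ℕ.* k ℕ.+ n ℕ.* k) Sign.* σ ((n ℕ.∸ (i ℕ.+ i)) ℕ.* m) (n ℕ.* k ℕ.+ n ℕ.* k))
      ≡⟨ ∏-cong h′ (λ i i∈ → cong (σ ((i ℕ.+ i) ℕ.* m) (n ℕ.* k ℕ.+ n ℕ.* k) Sign.*_) (σ-cong (into k i i∈) (out k i i∈))) ⟩
    ∏ h′ (cross k)                           ∎
    where
    open ≡-Reasoning
    bound : ∀ {k} → k ∈[1‥ h ] → n ℕ.* k ℕ.+ n ℕ.* k < n ℕ.* m
    bound {k} (_ , k≤h) = subst (_< n ℕ.* m) (ℕ.*-distribˡ-+ n k k) (ℕ.*-monoʳ-< n (s≤s (ℕ.+-mono-≤ k≤h k≤h)))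
    2i≤n : ∀ {i} → i ∈[1‥ h′ ] → i ℕ.+ i ≤ n
    2i≤n (_ , i≤h′) = ℕ.m≤n⇒m≤1+n (ℕ.+-mono-≤ i≤h′ i≤h′)
    lhs : ∀ k i → n ℕ.* k ℕ.+ n ℕ.* k ℕ.+ (i ℕ.+ i) ℕ.* m ≡ n ℕ.* (k ℕ.+ k) ℕ.+ m ℕ.* (i ℕ.+ i)
    lhs k i = eq n m k i
      where
      eq : ∀ n m k i → n ℕ.* k ℕ.+ n ℕ.* k ℕ.+ (i ℕ.+ i) ℕ.* m ≡ n ℕ.* (k ℕ.+ k) ℕ.+ m ℕ.* (i ℕ.+ i)
      eq = ℕSolver.solve-∀
    rhs : ∀ {i} → i ∈[1‥ h′ ] → (n ℕ.∸ (i ℕ.+ i)) ℕ.* m ℕ.+ (i ℕ.+ i) ℕ.* m ≡ n ℕ.* m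
    rhs {i} i∈ = trans (sym (ℕ.*-distribʳ-+ m (n ℕ.∸ (i ℕ.+ i)) (i ℕ.+ i))) (cong (ℕ._* m) (ℕ.m∸n+n≡m (2i≤n i∈)))
    into : ∀ k i → i ∈[1‥ h′ ] → n ℕ.* k ℕ.+ n ℕ.* k < (n ℕ.∸ (i ℕ.+ i)) ℕ.* m → n ℕ.* (k ℕ.+ k) ℕ.+ m ℕ.* (i ℕ.+ i) < n ℕ.* m
    into k i i∈ lt = subst₂ _<_ (lhs k i) (rhs i∈) (ℕ.+-monoˡ-< ((i ℕ.+ i) ℕ.* m) lt)
    out : ∀ k i → i ∈[1‥ h′ ] → n ℕ.* (k ℕ.+ k) ℕ.+ m ℕ.* (i ℕ.+ i) < n ℕ.* m → n ℕ.* k ℕ.+ n ℕ.* k < (n ℕ.∸ (i ℕ.+ i)) ℕ.* m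
    out k i i∈ lt = ℕ.+-cancelʳ-< ((i ℕ.+ i) ℕ.* m) _ _ (subst₂ _<_ (sym (lhs k i)) (sym (rhs i∈)) lt)

infixl 7 _⊛_

-- (-1) to the power h h′, the sign in the reciprocity law.
_⊛_ : ℕ → ℕ → Sign
h ⊛ h′ = ∏ h (λ _ → ε h′)

-- In the combined double product the pair (k, i) contributes the comparison of i / n with k / m in
-- both orders, of which exactly one is -; the other factors are symmetric and cancel. The two
-- fractions differ, since otherwise m would divide k ≤ h.
reciprocity : ∀ h h′ → Coprime (odd h) (odd h′) → jacobi (+ odd h′) h Sign.* jacobi (+ odd h) h′ ≡ h ⊛ h′
reciprocity h h′ m⊥n = begin
  jacobi (+ n) h Sign.* jacobi (+ m) h′
    ≡⟨ cong₂ Sign._*_ (jacobi-∏∏ h h′) (trans (jacobi-∏∏ h′ h) (∏-comm h′ h (cross h′ h))) ⟩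
  ∏ h (λ k → ∏ h′ (cross h h′ k)) Sign.* ∏ h (λ k → ∏ h′ (λ i → cross h′ h i k))
    ≡⟨ sym (∏-distrib-* h (λ k → ∏ h′ (cross h h′ k)) (λ k → ∏ h′ (λ i → cross h′ h i k))) ⟩
  ∏ h (λ k → ∏ h′ (cross h h′ k) Sign.* ∏ h′ (λ i → cross h′ h i k))
    ≡⟨ ∏-cong h (λ k k∈ → trans (sym (∏-distrib-* h′ (cross h h′ k) (λ i → cross h′ h i k)))
         (∏-cong h′ (λ i i∈ → pointwise k i k∈ i∈))) ⟩
  h ⊛ h′ ∎
  where
  open ≡-Reasoning
  m n : ℕ
  m = odd h
  n = odd h′
  regroup : ∀ a b c d → b ≡ d → a Sign.* b Sign.* (c Sign.* d) ≡ a Sign.* c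
  regroup a b c .b refl = begin
    a Sign.* b Sign.* (c Sign.* b)     ≡⟨ cong (a Sign.* b Sign.*_) (Sign.*-comm c b) ⟩
    a Sign.* b Sign.* (b Sign.* c)     ≡⟨ Sign.*-assoc a b (b Sign.* c) ⟩
    a Sign.* (b Sign.* (b Sign.* c))   ≡⟨ cong (a Sign.*_) (sym (Sign.*-assoc b b c)) ⟩
    a Sign.* (b Sign.* b Sign.* c)     ≡⟨ cong (λ s → a Sign.* (s Sign.* c)) (Sign.s*s≡+ b) ⟩
    a Sign.* c                         ∎
  double : ∀ m i → (i ℕ.+ i) ℕ.* m ≡ m ℕ.* i ℕ.+ m ℕ.* i
  double = ℕSolver.solve-∀
  halve : ∀ x y → x ℕ.+ x ≡ y ℕ.+ y → x ≡ y
  halve x y eq = ℕ.*-cancelˡ-≡ x y 2 (trans (cong (x ℕ.+_) (ℕ.+-identityʳ x)) (trans eq (cong (y ℕ.+_) (sym (ℕ.+-identityʳ y)))))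
  pointwise : ∀ k i → k ∈[1‥ h ] → i ∈[1‥ h′ ] → cross h h′ k i Sign.* cross h′ h i k ≡ Sign.-
  pointwise k i k∈ i∈ = trans (regroup (σ ((i ℕ.+ i) ℕ.* m) (n ℕ.* k ℕ.+ n ℕ.* k)) (σ (n ℕ.* m) (n ℕ.* (k ℕ.+ k) ℕ.+ m ℕ.* (i ℕ.+ i))) _ _
      (cong₂ σ (ℕ.*-comm n m) (ℕ.+-comm (n ℕ.* (k ℕ.+ k)) _)))
    (trans (cong₂ (λ x y → σ x (n ℕ.* k ℕ.+ n ℕ.* k) Sign.* σ y (m ℕ.* i ℕ.+ m ℕ.* i)) (double m i) (double n k)) (σ-flip distinct))
    where
    distinct : m ℕ.* i ℕ.+ m ℕ.* i ≢ n ℕ.* k ℕ.+ n ℕ.* k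
    distinct eq = ∤-half-system h k∈ (ℤ∣.∣ᵤ⇒∣ (Coprime.coprime-divisor m⊥n (ℕ.divides i (trans (sym (halve _ _ eq)) (ℕ.*-comm m i)))))

-- Bilinearity of the signs and multiplicativity in the modulus

ε-+ : ∀ m n → ε (m ℕ.+ n) ≡ ε m Sign.* ε n
ε-+ zero    n = refl
ε-+ (suc m) n = trans (cong Sign.opposite (ε-+ m n)) (sym (Sign.*-assoc Sign.- (ε m) (ε n)))

ε-double : ∀ n → ε (n ℕ.+ n) ≡ Sign.+
ε-double n = trans (ε-+ n n) (Sign.s*s≡+ (ε n))

infixl 7 _⊛ˢ_

-- (-1)^(i j) as a function of (-1)^i and (-1)^j.
_⊛ˢ_ : Sign → Sign → Sign
Sign.- ⊛ˢ Sign.- = Sign.-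
Sign.- ⊛ˢ Sign.+ = Sign.+
Sign.+ ⊛ˢ _      = Sign.+

⊛-ε : ∀ h h′ → h ⊛ h′ ≡ ε h ⊛ˢ ε h′
⊛-ε h h′ with ε h′
... | Sign.+ = trans (∏-+ h) (sym (zeroʳ (ε h)))
  where
  zeroʳ : ∀ s → s ⊛ˢ Sign.+ ≡ Sign.+
  zeroʳ Sign.+ = refl
  zeroʳ Sign.- = refl
... | Sign.- = sym (identityʳ (ε h))
  where
  identityʳ : ∀ s → s ⊛ˢ Sign.- ≡ s
  identityʳ Sign.+ = refl
  identityʳ Sign.- = refl

⊛-distrib : ∀ h {x y z} → ε x ≡ ε y Sign.* ε z → h ⊛ x ≡ h ⊛ y Sign.* (h ⊛ z)
⊛-distrib h {x} {y} {z} eq = trans (∏-cong h (λ _ _ → eq)) (∏-distrib-* h (λ _ → ε y) (λ _ → ε z))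

reciprocity′ : ∀ h h′ → Coprime (odd h) (odd h′) → jacobi (+ odd h′) h ≡ h ⊛ h′ Sign.* jacobi (+ odd h) h′
reciprocity′ h h′ m⊥n = Sign.*-cancelʳ-≡ t s _ (trans (reciprocity h h′ m⊥n)
  (sym (trans (Sign.*-assoc (h ⊛ h′) t t) (trans (cong (h ⊛ h′ Sign.*_) (Sign.s*s≡+ t)) (Sign.*-identityʳ _)))))
  where
  s = jacobi (+ odd h′) h
  t = jacobi (+ odd h) h′

infixl 7 _⊙_

_⊙_ : ℕ → ℕ → ℕ
h ⊙ h′ = h ℕ.+ h′ ℕ.+ (h ℕ.* h′ ℕ.+ h ℕ.* h′)

odd-⊙ : ∀ h h′ → odd h ℕ.* odd h′ ≡ odd (h ⊙ h′)
odd-⊙ = eq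
  where
  eq : ∀ h h′ → (1 ℕ.+ (h ℕ.+ h)) ℕ.* (1 ℕ.+ (h′ ℕ.+ h′)) ≡
       1 ℕ.+ ((h ℕ.+ h′ ℕ.+ (h ℕ.* h′ ℕ.+ h ℕ.* h′)) ℕ.+ (h ℕ.+ h′ ℕ.+ (h ℕ.* h′ ℕ.+ h ℕ.* h′)))
  eq = ℕSolver.solve-∀

ε-⊙ : ∀ h h′ → ε (h ⊙ h′) ≡ ε h Sign.* ε h′
ε-⊙ h h′ = trans (ε-+ (h ℕ.+ h′) _) (trans (cong (ε (h ℕ.+ h′) Sign.*_) (ε-double (h ℕ.* h′)))
  (trans (Sign.*-identityʳ _) (ε-+ h h′)))

parity : ∀ n → ∃[ h ] (n ≡ h ℕ.+ h ⊎ n ≡ odd h)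
parity zero = 0 , inj₁ refl
parity (suc n) with parity n
... | h , inj₁ refl = h , inj₂ refl
... | h , inj₂ refl = suc h , inj₁ (cong suc (sym (ℕ.+-suc h h)))

mod-∣ : ∀ {d m a b} → d ∣ m → a ≡ b [mod m ] → a ≡ b [mod d ]
mod-∣ d∣m (mod m∣) = mod (ℤ∣.∣-trans (ℤ∣.∣ᵤ⇒∣ d∣m) m∣)

invertible-∣ : ∀ {d m a} → d ∣ m → Invertible m a → Invertible d a
invertible-∣ d∣m (unit a⁻¹ aa⁻¹≡1) = unit a⁻¹ (mod-∣ d∣m aa⁻¹≡1)

invertible⇒coprime : ∀ {m a} → Invertible m (+ a) → Coprime a m
invertible⇒coprime {m} {a} a-inv {d} (d∣a , d∣m) = ℕ.∣1⇒≡1 (ℤ∣.∣⇒∣ᵤ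
  (invertible-cancel 1ℤ (invertible-∣ d∣m a-inv) (ℤ∣.∣m⇒∣m*n 1ℤ (ℤ∣.∣ᵤ⇒∣ {+ d} {+ a} d∣a))))

coprime-∣ʳ : ∀ {a d m} → d ∣ m → Coprime a m → Coprime a d
coprime-∣ʳ d∣m a⊥m (e∣a , e∣d) = a⊥m (e∣a , ℕ.∣-trans e∣d d∣m)

coprime-* : ∀ {a b c} → Coprime a b → Coprime a c → Coprime a (b ℕ.* c)
coprime-* a⊥b a⊥c {d} (d∣a , d∣bc) = a⊥c (d∣a , Coprime.coprime-divisor d⊥b d∣bc)
  where
  d⊥b : Coprime d _
  d⊥b (e∣d , e∣b) = a⊥b (ℕ.∣-trans e∣d d∣a , e∣b)

-- Reciprocity is available for odd positive upper arguments; if the least residue is even, adding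
-- the odd modulus makes it odd.
odd-representative : ∀ h c → ∃[ b ] c ≡ + odd b [mod odd h ]
odd-representative h c with parity (residue h c)
... | b , inj₂ r≡ = b , mod-trans (mod-sym (residue-mod h c)) (mod-refl (cong +_ r≡))
... | b , inj₁ r≡ = b ℕ.+ h , mod-trans (mod-sym (residue-mod h c)) (mod-trans (mod-refl (cong +_ r≡)) (mod-sym (mod
  (ℤ∣.divides 1ℤ (begin
    + odd (b ℕ.+ h) - + (b ℕ.+ b)             ≡⟨ cong (_- + (b ℕ.+ b)) (cong +_ (eq b h)) ⟩
    + (odd h ℕ.+ (b ℕ.+ b)) - + (b ℕ.+ b)     ≡⟨ cong (_- + (b ℕ.+ b)) (ℤ.pos-+ (odd h) (b ℕ.+ b)) ⟩
    + odd h + + (b ℕ.+ b) - + (b ℕ.+ b)       ≡⟨ eq′ (+ odd h) (+ (b ℕ.+ b)) ⟩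
    1ℤ * + odd h                              ∎)))))
  where
  open ≡-Reasoning
  eq : ∀ b h → 1 ℕ.+ ((b ℕ.+ h) ℕ.+ (b ℕ.+ h)) ≡ 1 ℕ.+ (h ℕ.+ h) ℕ.+ (b ℕ.+ b)
  eq = ℕSolver.solve-∀
  eq′ : ∀ x y → x + y - y ≡ 1ℤ * x
  eq′ = ℤSolver.solve-∀

exchange : ∀ s t u v → s Sign.* t Sign.* (u Sign.* v) ≡ s Sign.* u Sign.* (t Sign.* v)
exchange = ∏S.solve 4 (λ s t u v → (s ∏S.⊕ t) ∏S.⊕ (u ∏S.⊕ v) ∏S.⊜ (s ∏S.⊕ u) ∏S.⊕ (t ∏S.⊕ v)) refl

-- Reciprocity moves the modulus into the upper argument, where multiplicativity is already known,
-- and back. The reciprocity signs match because h ⊙ h′ has the parity of h + h′.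
jacobi-⊙ : ∀ h h′ {c} → Invertible (odd (h ⊙ h′)) c → jacobi c (h ⊙ h′) ≡ jacobi c h Sign.* jacobi c h′
jacobi-⊙ h h′ {c} c-inv with b , c≡b ← odd-representative (h ⊙ h′) c = begin
  jacobi c (h ⊙ h′)                                            ≡⟨ jacobi-cong (h ⊙ h′) c≡b ⟩
  jacobi (+ odd b) (h ⊙ h′)                                    ≡⟨ reciprocity′ (h ⊙ h′) b (Coprime.sym b⊥) ⟩
  (h ⊙ h′) ⊛ b Sign.* jacobi (+ odd (h ⊙ h′)) b
    ≡⟨ cong₂ Sign._*_ ⊛-split (trans (cong (λ x → jacobi x b) (trans (cong +_ (sym (odd-⊙ h h′))) (ℤ.pos-* (odd h) (odd h′))))
         (jacobi-* b (inv h b⊥h) (inv h′ b⊥h′))) ⟩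
  (h ⊛ b Sign.* (h′ ⊛ b)) Sign.* (jacobi (+ odd h) b Sign.* jacobi (+ odd h′) b)
    ≡⟨ exchange (h ⊛ b) (h′ ⊛ b) (jacobi (+ odd h) b) (jacobi (+ odd h′) b) ⟩
  (h ⊛ b Sign.* jacobi (+ odd h) b) Sign.* (h′ ⊛ b Sign.* jacobi (+ odd h′) b)
    ≡⟨ sym (cong₂ Sign._*_ (reciprocity′ h b (Coprime.sym b⊥h)) (reciprocity′ h′ b (Coprime.sym b⊥h′))) ⟩
  jacobi (+ odd b) h Sign.* jacobi (+ odd b) h′
    ≡⟨ sym (cong₂ Sign._*_ (jacobi-cong h (mod-∣ h∣ c≡b)) (jacobi-cong h′ (mod-∣ h′∣ c≡b))) ⟩
  jacobi c h Sign.* jacobi c h′ ∎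
  where
  open ≡-Reasoning
  h∣ : odd h ∣ odd (h ⊙ h′)
  h∣ = ℕ.divides (odd h′) (trans (sym (odd-⊙ h h′)) (ℕ.*-comm (odd h) (odd h′)))
  h′∣ : odd h′ ∣ odd (h ⊙ h′)
  h′∣ = ℕ.divides (odd h) (sym (odd-⊙ h h′))
  b⊥ = invertible⇒coprime (invertible-cong c≡b c-inv)
  b⊥h : Coprime (odd b) (odd h)
  b⊥h = coprime-∣ʳ h∣ b⊥
  b⊥h′ : Coprime (odd b) (odd h′)
  b⊥h′ = coprime-∣ʳ h′∣ b⊥
  inv : ∀ k → Coprime (odd b) (odd k) → Invertible (odd b) (+ odd k)
  inv k b⊥k = coprime⇒invertible (+ odd k) (Coprime.sym b⊥k)
  ⊛-comm : ∀ h h′ → h ⊛ h′ ≡ h′ ⊛ h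
  ⊛-comm h h′ = trans (⊛-ε h h′) (trans (comm (ε h) (ε h′)) (sym (⊛-ε h′ h)))
    where
    comm : ∀ s t → s ⊛ˢ t ≡ t ⊛ˢ s
    comm Sign.+ Sign.+ = refl
    comm Sign.+ Sign.- = refl
    comm Sign.- Sign.+ = refl
    comm Sign.- Sign.- = refl
  ⊛-split : (h ⊙ h′) ⊛ b ≡ h ⊛ b Sign.* (h′ ⊛ b)
  ⊛-split = trans (⊛-comm (h ⊙ h′) b) (trans (⊛-distrib b {h ⊙ h′} {h} {h′} (ε-⊙ h h′)) (cong₂ Sign._*_ (⊛-comm b h) (⊛-comm b h′)))

neg1-invertible : ∀ {m} → Invertible m -1ℤ
neg1-invertible = unit -1ℤ (mod-refl refl)

2-invertible : ∀ h → Invertible (odd h) (+ 2)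
2-invertible h = unit (- (+ h)) $ mod (ℤ∣.divides -1ℤ (trans (eq (+ h)) (cong (-1ℤ *_) (sym (trans (ℤ.pos-+ 1 (h ℕ.+ h)) (cong (λ z → 1ℤ + z) (ℤ.pos-+ h h)))))))
  where
  eq : ∀ h → + 2 * - h - 1ℤ ≡ -1ℤ * (1ℤ + (h + h))
  eq = ℤSolver.solve-∀

-- (-1) to the power 1 + 2 + … + h, the value of (2 / 1 + 2h).
Δ : ℕ → Sign
Δ zero    = Sign.+
Δ (suc h) = ε (suc h) Sign.* Δ h

-- Induction on h: 2 ≡ m + 2 modulo m, and m ≡ - 2 modulo m + 2.
jacobi-2 : ∀ h → jacobi (+ 2) h ≡ Δ h
jacobi-2 zero    = jacobi-def (+ 2) 0
jacobi-2 (suc h) = begin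
  jacobi (+ 2) (suc h)                             ≡⟨ cancel (ε (suc h)) _ ⟩
  ε (suc h) Sign.* (ε (suc h) Sign.* jacobi (+ 2) (suc h))
    ≡⟨ cong (λ s → ε (suc h) Sign.* (s Sign.* jacobi (+ 2) (suc h))) (sym (jacobi-neg1 (suc h))) ⟩
  ε (suc h) Sign.* (jacobi -1ℤ (suc h) Sign.* jacobi (+ 2) (suc h))
    ≡⟨ cong (ε (suc h) Sign.*_) (sym (jacobi-* (suc h) neg1-invertible (2-invertible (suc h)))) ⟩
  ε (suc h) Sign.* jacobi (- (+ 2)) (suc h)        ≡⟨ cong (ε (suc h) Sign.*_) (sym (jacobi-cong (suc h) m≡-2)) ⟩
  ε (suc h) Sign.* jacobi (+ odd h) (suc h)
    ≡⟨ cong (ε (suc h) Sign.*_) (sym (trans (reciprocity′ h (suc h) coprime) (cong (Sign._* jacobi (+ odd h) (suc h)) consecutive))) ⟩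
  ε (suc h) Sign.* jacobi (+ odd (suc h)) h        ≡⟨ cong (ε (suc h) Sign.*_) (jacobi-cong h m+2≡2) ⟩
  ε (suc h) Sign.* jacobi (+ 2) h                  ≡⟨ cong (ε (suc h) Sign.*_) (jacobi-2 h) ⟩
  ε (suc h) Sign.* Δ h                             ∎
  where
  open ≡-Reasoning
  cancel : ∀ s t → t ≡ s Sign.* (s Sign.* t)
  cancel Sign.+ t = refl
  cancel Sign.- t = sym (Sign.opposite-involutive t)
  odd-suc : odd (suc h) ≡ 2 ℕ.+ odd h
  odd-suc = cong (suc ∘ suc) (ℕ.+-suc h h)
  pos-odd-suc : + odd (suc h) ≡ + 2 + + odd h
  pos-odd-suc = trans (cong +_ odd-suc) (ℤ.pos-+ 2 (odd h))
  m+2≡2 : + odd (suc h) ≡ + 2 [mod odd h ]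
  m+2≡2 = mod (ℤ∣.divides 1ℤ (trans (cong (_- + 2) pos-odd-suc) (eq (+ odd h))))
    where
    eq : ∀ m → + 2 + m - + 2 ≡ 1ℤ * m
    eq = ℤSolver.solve-∀
  m≡-2 : + odd h ≡ - (+ 2) [mod odd (suc h) ]
  m≡-2 = mod (ℤ∣.divides 1ℤ (trans (eq (+ odd h)) (cong (1ℤ *_) (sym pos-odd-suc))))
    where
    eq : ∀ m → m - - (+ 2) ≡ 1ℤ * (+ 2 + m)
    eq = ℤSolver.solve-∀
  coprime : Coprime (odd h) (odd (suc h))
  coprime = Coprime.sym (invertible⇒coprime (invertible-cong (mod-sym m+2≡2) (2-invertible h)))
  consecutive : h ⊛ suc h ≡ Sign.+
  consecutive = trans (⊛-ε h (suc h)) (s⊛-s (ε h))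
    where
    s⊛-s : ∀ s → s ⊛ˢ Sign.opposite s ≡ Sign.+
    s⊛-s Sign.+ = refl
    s⊛-s Sign.- = refl

-- The value of (-BC/A)(-AC/B)(-AB/C) for positive odd A = 1 + 2a, B = 1 + 2b, C = 1 + 2c.
Φ : Sign → Sign → Sign → Sign
Φ s t u = s Sign.* t Sign.* u Sign.* (s ⊛ˢ t) Sign.* (s ⊛ˢ u) Sign.* (t ⊛ˢ u)

-- In the applications t is the 2-part of the first coefficient, 1 or 2. Each of the three factors
-- -1 gives an ε, each pair of moduli meets in both orders and gives a reciprocity sign, and only
-- the symbols of t remain.
legendre-product : ∀ t a b c → Invertible (odd b) (+ t) → Invertible (odd c) (+ t) →
  Coprime (odd a) (odd b) → Coprime (odd a) (odd c) → Coprime (odd b) (odd c) →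
  jacobi (- (+ odd b * + odd c)) a Sign.*
  (jacobi (- (+ t * + odd a * + odd c)) b Sign.* jacobi (- (+ t * + odd a * + odd b)) c)
  ≡ Φ (ε a) (ε b) (ε c) Sign.* (jacobi (+ t) b Sign.* jacobi (+ t) c)
legendre-product t a b c t⊥b t⊥c a⊥b a⊥c b⊥c = begin
  jacobi (- (+ odd b * + odd c)) a Sign.*
  (jacobi (- (+ t * + odd a * + odd c)) b Sign.* jacobi (- (+ t * + odd a * + odd b)) c)
    ≡⟨ cong₂ Sign._*_ (expand a (inv b (Coprime.sym a⊥b)) (inv c (Coprime.sym a⊥c)))
      (cong₂ Sign._*_
        (trans (expand b (invertible-* t⊥b (inv a a⊥b)) (inv c (Coprime.sym b⊥c)))
          (cong (λ s → ε b Sign.* (s Sign.* jacobi (+ odd c) b)) (jacobi-* b t⊥b (inv a a⊥b))))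
        (trans (expand c (invertible-* t⊥c (inv a a⊥c)) (inv b b⊥c))
          (cong (λ s → ε c Sign.* (s Sign.* jacobi (+ odd b) c)) (jacobi-* c t⊥c (inv a a⊥c))))) ⟩
  ε a Sign.* (ba Sign.* ca) Sign.* ((ε b Sign.* (tb Sign.* ab Sign.* cb)) Sign.* (ε c Sign.* (tc Sign.* ac Sign.* bc)))
    ≡⟨ ∏S.solve 11 (λ ea eb ec ba ca ab cb ac bc tb tc →
         (ea ∏S.⊕ (ba ∏S.⊕ ca)) ∏S.⊕ ((eb ∏S.⊕ ((tb ∏S.⊕ ab) ∏S.⊕ cb)) ∏S.⊕ (ec ∏S.⊕ ((tc ∏S.⊕ ac) ∏S.⊕ bc)))
         ∏S.⊜ (((((ea ∏S.⊕ eb) ∏S.⊕ ec) ∏S.⊕ (ba ∏S.⊕ ab)) ∏S.⊕ (ca ∏S.⊕ ac)) ∏S.⊕ (cb ∏S.⊕ bc)) ∏S.⊕ (tb ∏S.⊕ tc))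
         refl (ε a) (ε b) (ε c) ba ca ab cb ac bc tb tc ⟩
  ε a Sign.* ε b Sign.* ε c Sign.* (ba Sign.* ab) Sign.* (ca Sign.* ac) Sign.* (cb Sign.* bc) Sign.* (tb Sign.* tc)
    ≡⟨ cong (Sign._* (tb Sign.* tc)) (cong₂ Sign._*_ (cong₂ Sign._*_ (cong (ε a Sign.* ε b Sign.* ε c Sign.*_)
         (recip a b a⊥b)) (recip a c a⊥c)) (recip b c b⊥c)) ⟩
  Φ (ε a) (ε b) (ε c) Sign.* (tb Sign.* tc) ∎
  where
  open ≡-Reasoning
  ba = jacobi (+ odd b) a
  ca = jacobi (+ odd c) a
  ab = jacobi (+ odd a) b
  cb = jacobi (+ odd c) b
  ac = jacobi (+ odd a) c
  bc = jacobi (+ odd b) c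
  tb = jacobi (+ t) b
  tc = jacobi (+ t) c
  inv : ∀ k {m} → Coprime (odd k) m → Invertible m (+ odd k)
  inv k = coprime⇒invertible (+ odd k)
  expand : ∀ h {x y} → Invertible (odd h) x → Invertible (odd h) y →
           jacobi (- (x * y)) h ≡ ε h Sign.* (jacobi x h Sign.* jacobi y h)
  expand h {x} {y} x-inv y-inv = trans (cong (λ z → jacobi z h) (sym (ℤ.-1*i≡-i (x * y))))
    (trans (jacobi-* h neg1-invertible (invertible-* x-inv y-inv)) (cong₂ Sign._*_ (jacobi-neg1 h) (jacobi-* h x-inv y-inv)))
  recip : ∀ h h′ → Coprime (odd h) (odd h′) → jacobi (+ odd h′) h Sign.* jacobi (+ odd h) h′ ≡ ε h ⊛ˢ ε h′
  recip h h′ m⊥n = trans (reciprocity h h′ m⊥n) (⊛-ε h h′)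

-- Four consecutive integers contain two odd ones, so four steps of Δ change the sign twice: (2 / 1
-- + 2h) depends only on 1 + 2h modulo 8.
Δ-period : ∀ h q → Δ (h ℕ.+ q ℕ.* 4) ≡ Δ h
Δ-period h zero    = cong Δ (ℕ.+-identityʳ h)
Δ-period h (suc q) = trans (cong Δ (eq h q)) (trans (four (h ℕ.+ q ℕ.* 4)) (Δ-period h q))
  where
  eq : ∀ h q → h ℕ.+ (4 ℕ.+ q ℕ.* 4) ≡ 4 ℕ.+ (h ℕ.+ q ℕ.* 4)
  eq = ℕSolver.solve-∀
  four : ∀ n → Δ (4 ℕ.+ n) ≡ Δ n
  four n with ε n
  ... | Sign.+ = Sign.opposite-involutive (Δ n)
  ... | Sign.- = Sign.opposite-involutive (Δ n)

ε-period : ∀ h q → ε (h ℕ.+ q ℕ.* 4) ≡ ε h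
ε-period h q = trans (ε-+ h (q ℕ.* 4)) (trans (cong (ε h Sign.*_) (trans (cong ε (eq q)) (ε-double (q ℕ.* 2)))) (Sign.*-identityʳ (ε h)))
  where
  eq : ∀ q → q ℕ.* 4 ≡ q ℕ.* 2 ℕ.+ q ℕ.* 2
  eq = ℕSolver.solve-∀

record Mod4 (h : ℕ) : Set where
  constructor mod4
  field
    r  : Fin 4
    q  : ℕ
    eq : h ≡ toℕ r ℕ.+ q ℕ.* 4

mod4? : ∀ h → Mod4 h
mod4? h = mod4 (D.remainder) (D.quotient) (D.property)
  where module D = ℕ.DivMod (h ℕ.divMod 4)

odd-mod4 : ∀ r q → odd (r ℕ.+ q ℕ.* 4) ≡ odd r ℕ.+ 8 ℕ.* q
odd-mod4 = eq
  where
  eq : ∀ r q → 1 ℕ.+ ((r ℕ.+ q ℕ.* 4) ℕ.+ (r ℕ.+ q ℕ.* 4)) ≡ 1 ℕ.+ (r ℕ.+ r) ℕ.+ 8 ℕ.* q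
  eq = ℕSolver.solve-∀

-- The hypothesis makes exactly one of B and C congruent to 3 modulo 4. Their signs t, u then
-- satisfy t u = - and t ⊛ˢ u = +, and Φ becomes - s (s ⊛ˢ -) = - s s.
4∣B+C⇒Φ : ∀ a b c → 4 ∣ odd b ℕ.+ odd c → Φ (ε a) (ε b) (ε c) ≡ Sign.-
4∣B+C⇒Φ a b c 4∣ = signs (ε a) (ε b) (ε c) (trans (sym (ε-+ b c)) (opposite 4∣))
  where
  signs : ∀ s t u → t Sign.* u ≡ Sign.- → Φ s t u ≡ Sign.-
  signs Sign.+ Sign.+ Sign.- _ = refl
  signs Sign.+ Sign.- Sign.+ _ = refl
  signs Sign.- Sign.+ Sign.- _ = refl
  signs Sign.- Sign.- Sign.+ _ = refl
  opposite : 4 ∣ odd b ℕ.+ odd c → ε (b ℕ.+ c) ≡ Sign.-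
  opposite (ℕ.divides q eq) = trans (sym (Sign.opposite-involutive _)) (cong Sign.opposite (trans (cong ε half) (ε-double q)))
    where
    eq₁ : ∀ b c → (1 ℕ.+ (b ℕ.+ b)) ℕ.+ (1 ℕ.+ (c ℕ.+ c)) ≡ 2 ℕ.* (1 ℕ.+ (b ℕ.+ c))
    eq₁ = ℕSolver.solve-∀
    eq₂ : ∀ q → q ℕ.* 4 ≡ 2 ℕ.* (q ℕ.+ q)
    eq₂ = ℕSolver.solve-∀
    half : suc (b ℕ.+ c) ≡ q ℕ.+ q
    half = ℕ.*-cancelˡ-≡ _ _ 2 (trans (sym (eq₁ b c)) (trans eq (eq₂ q)))

-- Hypothesis and conclusion depend only on a, b, c modulo 4, that is on the three odd numbers
-- modulo 8; the 64 cases are decided by computation in `finite`.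
8∣A[B+C]+2BC⇒Φ : ∀ a b c → 8 ∣ odd b ℕ.+ odd c ⊎ 8 ∣ odd a ℕ.* (odd b ℕ.+ odd c) ℕ.+ 2 ℕ.* (odd b ℕ.* odd c) →
                 Φ (ε a) (ε b) (ε c) Sign.* (Δ b Sign.* Δ c) ≡ Sign.-
8∣A[B+C]+2BC⇒Φ a b c 8∣ with mod4 r₁ q₁ refl ← mod4? a | mod4 r₂ q₂ refl ← mod4? b | mod4 r₃ q₃ refl ← mod4? c
  rewrite ε-period (toℕ r₁) q₁ | ε-period (toℕ r₂) q₂ | ε-period (toℕ r₃) q₃ | Δ-period (toℕ r₂) q₂ | Δ-period (toℕ r₃) q₃
  = finite r₁ r₂ r₃ (reduce 8∣)
  where
  finite : ∀ (r₁ r₂ r₃ : Fin 4) →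
    8 ∣ odd (toℕ r₂) ℕ.+ odd (toℕ r₃) ⊎ 8 ∣ odd (toℕ r₁) ℕ.* (odd (toℕ r₂) ℕ.+ odd (toℕ r₃)) ℕ.+ 2 ℕ.* (odd (toℕ r₂) ℕ.* odd (toℕ r₃)) →
    Φ (ε (toℕ r₁)) (ε (toℕ r₂)) (ε (toℕ r₃)) Sign.* (Δ (toℕ r₂) Sign.* Δ (toℕ r₃)) ≡ Sign.-
  finite = Dec.toWitness {a? = Fin.all? λ _ → Fin.all? λ _ → Fin.all? λ _ → ((8 ℕ.∣? _) Dec.⊎-dec (8 ℕ.∣? _)) Dec.→-dec (_ Sign.≟ _)} _
  sum-eq : ∀ β γ q₂ q₃ → (β ℕ.+ 8 ℕ.* q₂) ℕ.+ (γ ℕ.+ 8 ℕ.* q₃) ≡ 8 ℕ.* (q₂ ℕ.+ q₃) ℕ.+ (β ℕ.+ γ)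
  sum-eq = ℕSolver.solve-∀
  carry : ℕ → ℕ → ℕ → ℕ
  carry α β γ = q₁ ℕ.* (β ℕ.+ γ ℕ.+ 8 ℕ.* q₂ ℕ.+ 8 ℕ.* q₃) ℕ.+ α ℕ.* (q₂ ℕ.+ q₃) ℕ.+ 2 ℕ.* (β ℕ.* q₃ ℕ.+ γ ℕ.* q₂ ℕ.+ 8 ℕ.* q₂ ℕ.* q₃)
  form-eq : ∀ α β γ q₁ q₂ q₃ →
    (α ℕ.+ 8 ℕ.* q₁) ℕ.* ((β ℕ.+ 8 ℕ.* q₂) ℕ.+ (γ ℕ.+ 8 ℕ.* q₃)) ℕ.+ 2 ℕ.* ((β ℕ.+ 8 ℕ.* q₂) ℕ.* (γ ℕ.+ 8 ℕ.* q₃)) ≡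
    8 ℕ.* (q₁ ℕ.* (β ℕ.+ γ ℕ.+ 8 ℕ.* q₂ ℕ.+ 8 ℕ.* q₃) ℕ.+ α ℕ.* (q₂ ℕ.+ q₃) ℕ.+ 2 ℕ.* (β ℕ.* q₃ ℕ.+ γ ℕ.* q₂ ℕ.+ 8 ℕ.* q₂ ℕ.* q₃))
      ℕ.+ (α ℕ.* (β ℕ.+ γ) ℕ.+ 2 ℕ.* (β ℕ.* γ))
  form-eq = ℕSolver.solve-∀
  reduce : _ → _
  reduce (inj₁ 8∣B+C) = inj₁ (ℕ.∣m+n∣m⇒∣n (subst (8 ∣_) (trans (cong₂ ℕ._+_ (odd-mod4 (toℕ r₂) q₂) (odd-mod4 (toℕ r₃) q₃))
    (sum-eq (odd (toℕ r₂)) (odd (toℕ r₃)) q₂ q₃)) 8∣B+C) (ℕ.m∣m*n (q₂ ℕ.+ q₃)))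
  reduce (inj₂ 8∣form) = inj₂ (ℕ.∣m+n∣m⇒∣n (subst (8 ∣_) (trans (cong₂ ℕ._+_
      (cong₂ ℕ._*_ (odd-mod4 (toℕ r₁) q₁) (cong₂ ℕ._+_ (odd-mod4 (toℕ r₂) q₂) (odd-mod4 (toℕ r₃) q₃)))
      (cong (2 ℕ.*_) (cong₂ ℕ._*_ (odd-mod4 (toℕ r₂) q₂) (odd-mod4 (toℕ r₃) q₃))))
    (form-eq (odd (toℕ r₁)) (odd (toℕ r₂)) (odd (toℕ r₃)) q₁ q₂ q₃)) 8∣form) (ℕ.m∣m*n (carry (odd (toℕ r₁)) (odd (toℕ r₂)) (odd (toℕ r₃)))))

-- Normal forms of ternary quadratic forms

0<* : ∀ {a b} → 0 < a → 0 < b → 0 < a ℕ.* b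
0<* {suc a} {suc b} _ _ = s≤s z≤n

0<-∣ : ∀ {a b} → 0 < b → a ∣ b → 0 < a
0<-∣ {zero}  0<b 0∣b = contradiction (ℕ.0∣⇒≡0 0∣b) (ℕ.n>0⇒n≢0 0<b)
0<-∣ {suc a} _ _ = s≤s z≤n

*-cancelˡ : ∀ k {a b} → 0 < k → k ℕ.* a ≡ k ℕ.* b → a ≡ b
*-cancelˡ k {a} {b} 0<k = ℕ.*-cancelˡ-≡ a b k {{ℕ.>-nonZero 0<k}}

Squarefree : ℕ → Set
Squarefree A = ∀ d → d ℕ.* d ∣ A → d ≡ 1

-- The forms u₁X² + u₂Y² + u₃Z² and AX² + BY² + CZ² agree up to a common factor and squares.
record Scaled (u₁ u₂ u₃ A B C : ℕ) : Set where
  constructor scaled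
  field
    k x y z : ℕ
    0<k : 0 < k
    0<x : 0 < x
    0<y : 0 < y
    0<z : 0 < z
    eq₁ : k ℕ.* u₁ ≡ A ℕ.* (x ℕ.* x)
    eq₂ : k ℕ.* u₂ ≡ B ℕ.* (y ℕ.* y)
    eq₃ : k ℕ.* u₃ ≡ C ℕ.* (z ℕ.* z)

record Reduced (A B C : ℕ) : Set where
  constructor reduced
  field
    0<A : 0 < A
    0<B : 0 < B
    0<C : 0 < C
    A⊥B : Coprime A B
    A⊥C : Coprime A C
    B⊥C : Coprime B C
    A-squarefree : Squarefree A
    B-squarefree : Squarefree B
    C-squarefree : Squarefree C

module _ {u₁ u₂ u₃ A B C : ℕ} where

  scaled-swap₁₂ : Scaled u₁ u₂ u₃ A B C → Scaled u₂ u₁ u₃ B A C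
  scaled-swap₁₂ (scaled k x y z 0<k 0<x 0<y 0<z eq₁ eq₂ eq₃) = scaled k y x z 0<k 0<y 0<x 0<z eq₂ eq₁ eq₃

  scaled-swap₂₃ : Scaled u₁ u₂ u₃ A B C → Scaled u₁ u₃ u₂ A C B
  scaled-swap₂₃ (scaled k x y z 0<k 0<x 0<y 0<z eq₁ eq₂ eq₃) = scaled k x z y 0<k 0<x 0<z 0<y eq₁ eq₃ eq₂

module _ {A B C : ℕ} where

  reduced-swap₁₂ : Reduced A B C → Reduced B A C
  reduced-swap₁₂ (reduced a b c ab ac bc sa sb sc) = reduced b a c (Coprime.sym ab) bc ac sb sa sc

  reduced-swap₂₃ : Reduced A B C → Reduced A C B
  reduced-swap₂₃ (reduced a b c ab ac bc sa sb sc) = reduced a c b ac ab (Coprime.sym bc) sa sc sb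

NormalForm : ℕ → ℕ → ℕ → Set
NormalForm u₁ u₂ u₃ = ∃[ A ] ∃[ B ] ∃[ C ] Reduced A B C × Scaled u₁ u₂ u₃ A B C

normalForm-swap₁₂ : ∀ {u₁ u₂ u₃} → NormalForm u₁ u₂ u₃ → NormalForm u₂ u₁ u₃
normalForm-swap₁₂ (A , B , C , r , s) = B , A , C , reduced-swap₁₂ r , scaled-swap₁₂ s

normalForm-swap₂₃ : ∀ {u₁ u₂ u₃} → NormalForm u₁ u₂ u₃ → NormalForm u₁ u₃ u₂
normalForm-swap₂₃ (A , B , C , r , s) = A , C , B , reduced-swap₂₃ r , scaled-swap₂₃ s

squarefree? : ∀ A → 0 < A → Squarefree A ⊎ ∃[ d ] 1 < d × d ℕ.* d ∣ A
squarefree? A 0<A with ℕ.anyUpTo? (λ d → (1 ℕ.<? d) Dec.×-dec (d ℕ.* d ℕ.∣? A)) (suc A)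
... | yes (d , _ , 1<d , d²∣A) = inj₂ (d , 1<d , d²∣A)
... | no  none = inj₁ λ { zero d²∣A → contradiction (0<-∣ 0<A d²∣A) λ () ; 1 _ → refl ; d@(suc (suc e)) d²∣A →
        contradiction (d , s≤s (ℕ.≤-trans (ℕ.m≤m*n d d) (ℕ.∣⇒≤ {{ℕ.>-nonZero 0<A}} d²∣A)) , s≤s (s≤s z≤n) , d²∣A) none }

module _ {u₁ u₂ u₃ : ℕ} where

  -- g (A g X² + B g Y² + C Z²) = A (g X)² + B (g Y)² + C g Z². In the product of the coefficients
  -- g² is exchanged for a single g.
  remove-gcd : ∀ g {A B C} → 0 < g → Scaled u₁ u₂ u₃ (A ℕ.* g) (B ℕ.* g) C → Scaled u₁ u₂ u₃ A B (C ℕ.* g)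
  remove-gcd g {A} {B} {C} 0<g (scaled k x y z 0<k 0<x 0<y 0<z eq₁ eq₂ eq₃) =
    scaled (k ℕ.* g) (x ℕ.* g) (y ℕ.* g) z (0<* 0<k 0<g) (0<* 0<x 0<g) (0<* 0<y 0<g) 0<z
      (trans (shift k u₁) (trans (cong (ℕ._* g) eq₁) (square A x)))
      (trans (shift k u₂) (trans (cong (ℕ._* g) eq₂) (square B y)))
      (trans (shift k u₃) (trans (cong (ℕ._* g) eq₃) (shift′ C (z ℕ.* z))))
    where
    shift : ∀ k u → k ℕ.* g ℕ.* u ≡ k ℕ.* u ℕ.* g
    shift k u = eq k g u
      where
      eq : ∀ k g u → k ℕ.* g ℕ.* u ≡ k ℕ.* u ℕ.* g
      eq = ℕSolver.solve-∀
    square : ∀ A x → A ℕ.* g ℕ.* (x ℕ.* x) ℕ.* g ≡ A ℕ.* (x ℕ.* g ℕ.* (x ℕ.* g))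
    square A x = eq A g x
      where
      eq : ∀ A g x → A ℕ.* g ℕ.* (x ℕ.* x) ℕ.* g ≡ A ℕ.* (x ℕ.* g ℕ.* (x ℕ.* g))
      eq = ℕSolver.solve-∀
    shift′ : ∀ C w → C ℕ.* w ℕ.* g ≡ C ℕ.* g ℕ.* w
    shift′ C w = sym (shift C w)

  remove-square : ∀ d {A B C} → 0 < d → Scaled u₁ u₂ u₃ (A ℕ.* (d ℕ.* d)) B C → Scaled u₁ u₂ u₃ A B C
  remove-square d {A} {B} {C} 0<d (scaled k x y z 0<k 0<x 0<y 0<z eq₁ eq₂ eq₃) =
    scaled k (d ℕ.* x) y z 0<k (0<* 0<d 0<x) 0<y 0<z (trans eq₁ (eq A d x)) eq₂ eq₃
    where
    eq : ∀ A d x → A ℕ.* (d ℕ.* d) ℕ.* (x ℕ.* x) ≡ A ℕ.* (d ℕ.* x ℕ.* (d ℕ.* x))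
    eq = ℕSolver.solve-∀

0<-*ˡ : ∀ a b → 0 < a ℕ.* b → 0 < a
0<-*ˡ (suc a) b _ = s≤s z≤n

0<-*ʳ : ∀ a b → 0 < a ℕ.* b → 0 < b
0<-*ʳ a b 0<ab = 0<-*ˡ b a (subst (0 <_) (ℕ.*-comm a b) 0<ab)

<-*-gain : ∀ {g} a → 1 < g → 0 < a → a < a ℕ.* g
<-*-gain {g} a 1<g 0<a = ℕ.m<m*n a g {{ℕ.>-nonZero 0<a}} 1<g

-- The induction hypothesis for the product A B C, which drops when a common factor or a square
-- factor is removed.
Normalises : ℕ → Set
Normalises m = ∀ {u₁ u₂ u₃} A B C → A ℕ.* B ℕ.* C < m → 0 < A → 0 < B → 0 < C → Scaled u₁ u₂ u₃ A B C → NormalForm u₁ u₂ u₃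

normalise-gcd : ∀ {u₁ u₂ u₃} A B C → Normalises (A ℕ.* B ℕ.* C) → 0 < A → 0 < B → 0 < C →
                Scaled u₁ u₂ u₃ A B C → ¬ Coprime A B → NormalForm u₁ u₂ u₃
normalise-gcd A B C rec 0<A 0<B 0<C s ¬A⊥B with GCD.gcd A B in g≡ | GCD.gcd[m,n]∣m A B | GCD.gcd[m,n]∣n A B
... | g | ℕ.divides a refl | ℕ.divides b refl =
  rec a b (C ℕ.* g) smaller 0<a 0<b (0<* 0<C 0<g) (remove-gcd g 0<g s)
  where
  0<a = 0<-*ˡ a g 0<A
  0<b = 0<-*ˡ b g 0<B
  0<g = 0<-*ʳ a g 0<A
  1<g : 1 < g
  1<g = ℕ.≤∧≢⇒< 0<g λ 1≡g → ¬A⊥B (Coprime.gcd≡1⇒coprime (trans g≡ (sym 1≡g)))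
  eq : ∀ a b C g → a ℕ.* g ℕ.* (b ℕ.* g) ℕ.* C ≡ a ℕ.* b ℕ.* (C ℕ.* g) ℕ.* g
  eq = ℕSolver.solve-∀
  smaller : a ℕ.* b ℕ.* (C ℕ.* g) < a ℕ.* g ℕ.* (b ℕ.* g) ℕ.* C
  smaller = subst (a ℕ.* b ℕ.* (C ℕ.* g) <_) (sym (eq a b C g)) (<-*-gain _ 1<g (0<* (0<* 0<a 0<b) (0<* 0<C 0<g)))

normalise-square : ∀ {u₁ u₂ u₃} A B C → Normalises (A ℕ.* B ℕ.* C) → 0 < A → 0 < B → 0 < C →
                   Scaled u₁ u₂ u₃ A B C → ∃[ d ] 1 < d × d ℕ.* d ∣ A → NormalForm u₁ u₂ u₃
normalise-square A B C rec 0<A 0<B 0<C s (d , 1<d , ℕ.divides a refl) =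
  rec a B C smaller 0<a 0<B 0<C (remove-square d 0<d s)
  where
  0<d = ℕ.<-trans (s≤s z≤n) 1<d
  0<a = 0<-*ˡ a (d ℕ.* d) 0<A
  eq : ∀ a B C d → a ℕ.* (d ℕ.* d) ℕ.* B ℕ.* C ≡ a ℕ.* B ℕ.* C ℕ.* (d ℕ.* d)
  eq = ℕSolver.solve-∀
  smaller : a ℕ.* B ℕ.* C < a ℕ.* (d ℕ.* d) ℕ.* B ℕ.* C
  smaller = subst (a ℕ.* B ℕ.* C <_) (sym (eq a B C d))
    (<-*-gain _ (ℕ.<-≤-trans 1<d (ℕ.m≤m*n d d {{ℕ.>-nonZero 0<d}})) (0<* (0<* 0<a 0<B) 0<C))

normalise-step : ∀ {u₁ u₂ u₃} A B C → Normalises (A ℕ.* B ℕ.* C) → 0 < A → 0 < B → 0 < C →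
                 Scaled u₁ u₂ u₃ A B C → NormalForm u₁ u₂ u₃
normalise-step A B C rec 0<A 0<B 0<C s with Coprime.coprime? A B | Coprime.coprime? A C | Coprime.coprime? B C
... | no ¬A⊥B | _ | _ = normalise-gcd A B C rec 0<A 0<B 0<C s ¬A⊥B
... | yes _ | no ¬A⊥C | _ = normalForm-swap₂₃ (normalise-gcd A C B (subst Normalises (eq A B C) rec) 0<A 0<C 0<B (scaled-swap₂₃ s) ¬A⊥C)
  where
  eq : ∀ A B C → A ℕ.* B ℕ.* C ≡ A ℕ.* C ℕ.* B
  eq = ℕSolver.solve-∀
... | yes _ | yes _ | no ¬B⊥C = normalForm-swap₁₂ (normalForm-swap₂₃ (normalise-gcd B C A (subst Normalises (eq A B C) rec)
        0<B 0<C 0<A (scaled-swap₂₃ (scaled-swap₁₂ s)) ¬B⊥C))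
  where
  eq : ∀ A B C → A ℕ.* B ℕ.* C ≡ B ℕ.* C ℕ.* A
  eq = ℕSolver.solve-∀
... | yes A⊥B | yes A⊥C | yes B⊥C with squarefree? A 0<A | squarefree? B 0<B | squarefree? C 0<C
...   | inj₁ sA | inj₁ sB | inj₁ sC = A , B , C , reduced 0<A 0<B 0<C A⊥B A⊥C B⊥C sA sB sC , s
...   | inj₂ d | _ | _ = normalise-square A B C rec 0<A 0<B 0<C s d
...   | inj₁ _ | inj₂ d | _ = normalForm-swap₁₂ (normalise-square B A C (subst Normalises (eq A B C) rec) 0<B 0<A 0<C (scaled-swap₁₂ s) d)
  where
  eq : ∀ A B C → A ℕ.* B ℕ.* C ≡ B ℕ.* A ℕ.* C
  eq = ℕSolver.solve-∀
...   | inj₁ _ | inj₁ _ | inj₂ d = normalForm-swap₂₃ (normalForm-swap₁₂ (normalise-square C A B (subst Normalises (eq A B C) rec)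
          0<C 0<A 0<B (scaled-swap₁₂ (scaled-swap₂₃ s)) d))
  where
  eq : ∀ A B C → A ℕ.* B ℕ.* C ≡ C ℕ.* A ℕ.* B
  eq = ℕSolver.solve-∀

normalise : ∀ {u₁ u₂ u₃} A B C → ℕ.Acc _<_ (A ℕ.* B ℕ.* C) → 0 < A → 0 < B → 0 < C →
            Scaled u₁ u₂ u₃ A B C → NormalForm u₁ u₂ u₃
normalise A B C (ℕ.acc rs) = normalise-step A B C (λ a b c lt → normalise a b c (rs lt))

normalForm : ∀ {u₁ u₂ u₃} → 0 < u₁ → 0 < u₂ → 0 < u₃ → NormalForm u₁ u₂ u₃
normalForm {u₁} {u₂} {u₃} 0<u₁ 0<u₂ 0<u₃ = normalise u₁ u₂ u₃ (ℕ.<-wellFounded _) 0<u₁ 0<u₂ 0<u₃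
  (scaled 1 1 1 1 (s≤s z≤n) (s≤s z≤n) (s≤s z≤n) (s≤s z≤n) (ℕ.*-comm 1 u₁) (ℕ.*-comm 1 u₂) (ℕ.*-comm 1 u₃))

-- Valuations of natural numbers at a prime

module _ {p} (p-prime : Prime p) where

  private instance
    p≢0 : NonZero p
    p≢0 = prime⇒nonZero p-prime

  0<p : 0 < p
  0<p = ℕ.>-nonZero⁻¹ p

  1<p : 1 < p
  1<p = ℕ.nonTrivial⇒n>1 p {{prime⇒nonTrivial p-prime}}

  prime∤* : ∀ {a b} → p ∤ a → p ∤ b → p ∤ a ℕ.* b
  prime∤* {a} {b} p∤a p∤b p∣ab = [ p∤a , p∤b ]′ (euclidsLemma a b p-prime p∣ab)

  p^-coprime : ∀ i {a} → p ∤ a → Coprime (p ℕ.^ i) a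
  p^-coprime zero    p∤a = Coprime.1-coprimeTo _
  p^-coprime (suc i) p∤a = Coprime.sym (coprime-* (prime∤⇒coprime p-prime p∤a) (Coprime.sym (p^-coprime i p∤a)))

  p^∣*ˡ : ∀ i {a} b → p ∤ a → p ℕ.^ i ∣ a ℕ.* b → p ℕ.^ i ∣ b
  p^∣*ˡ i b p∤a = Coprime.coprime-divisor (p^-coprime i p∤a)

record IsVal (p u v w : ℕ) : Set where
  constructor isVal
  field
    eq  : u ≡ p ℕ.^ v ℕ.* w
    p∤w : p ∤ w

record Valued (p u : ℕ) : Set where
  constructor valued
  field
    v w : ℕ
    val : IsVal p u v w

valuation : ∀ {p} → Prime p → ∀ u → 0 < u → Valued p u
valuation {p} p-prime u = go u (ℕ.<-wellFounded u)
  where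
  go : ∀ u → ℕ.Acc _<_ u → 0 < u → Valued p u
  go u (ℕ.acc rs) 0<u with p ℕ.∣? u
  ... | no p∤u = valued 0 u (isVal (sym (ℕ.*-identityˡ u)) p∤u)
  ... | yes (ℕ.divides q refl) with valued v w (isVal eq p∤w) ← go q (rs (<-*-gain q (1<p p-prime) (0<-*ˡ q p 0<u))) (0<-*ˡ q p 0<u) =
    valued (suc v) w (isVal (trans (ℕ.*-comm q p) (trans (cong (p ℕ.*_) eq) (sym (ℕ.*-assoc p (p ℕ.^ v) w)))) p∤w)

valuation-unique : ∀ {p} → Prime p → ∀ i j {s t} → p ∤ s → p ∤ t → p ℕ.^ i ℕ.* s ≡ p ℕ.^ j ℕ.* t → i ≡ j × s ≡ t
valuation-unique p-prime zero zero {s} {t} _ _ eq = refl , trans (sym (ℕ.*-identityˡ s)) (trans eq (ℕ.*-identityˡ t))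
valuation-unique {p} p-prime zero (suc j) {s} {t} p∤s _ eq =
  contradiction (subst (p ∣_) (trans (sym eq) (ℕ.*-identityˡ s)) (ℕ.∣m⇒∣m*n t (ℕ.m∣m*n (p ℕ.^ j)))) p∤s
valuation-unique {p} p-prime (suc i) zero {s} {t} _ p∤t eq =
  contradiction (subst (p ∣_) (trans eq (ℕ.*-identityˡ t)) (ℕ.∣m⇒∣m*n s (ℕ.m∣m*n (p ℕ.^ i)))) p∤t
valuation-unique {p} p-prime (suc i) (suc j) {s} {t} p∤s p∤t eq
  with refl , s≡t ← valuation-unique p-prime i j p∤s p∤t (*-cancelˡ p (0<p p-prime)
    (trans (sym (ℕ.*-assoc p (p ℕ.^ i) s)) (trans eq (ℕ.*-assoc p (p ℕ.^ j) t)))) = refl , s≡t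

-- Valuations of solutions

-- The equation multiplied by n u₁ u₂ u₃, so that valuations can be compared in ℕ.
ErdősStraus : (n u₁ u₂ u₃ : ℕ) → Set
ErdősStraus n u₁ u₂ u₃ = 4 ℕ.* (u₁ ℕ.* u₂ ℕ.* u₃) ≡ n ℕ.* (u₁ ℕ.* u₂ ℕ.+ u₁ ℕ.* u₃ ℕ.+ u₂ ℕ.* u₃)

module _ {n u₁ u₂ u₃ : ℕ} where

  erdősStraus-swap₁₂ : ErdősStraus n u₁ u₂ u₃ → ErdősStraus n u₂ u₁ u₃
  erdősStraus-swap₁₂ eq = trans (eq₁ u₁ u₂ u₃) (trans eq (eq₂ n u₁ u₂ u₃))
    where
    eq₁ : ∀ a b c → 4 ℕ.* (b ℕ.* a ℕ.* c) ≡ 4 ℕ.* (a ℕ.* b ℕ.* c)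
    eq₁ = ℕSolver.solve-∀
    eq₂ : ∀ n a b c → n ℕ.* (a ℕ.* b ℕ.+ a ℕ.* c ℕ.+ b ℕ.* c) ≡ n ℕ.* (b ℕ.* a ℕ.+ b ℕ.* c ℕ.+ a ℕ.* c)
    eq₂ = ℕSolver.solve-∀

  erdősStraus-swap₂₃ : ErdősStraus n u₁ u₂ u₃ → ErdősStraus n u₁ u₃ u₂
  erdősStraus-swap₂₃ eq = trans (eq₁ u₁ u₂ u₃) (trans eq (eq₂ n u₁ u₂ u₃))
    where
    eq₁ : ∀ a b c → 4 ℕ.* (a ℕ.* c ℕ.* b) ≡ 4 ℕ.* (a ℕ.* b ℕ.* c)
    eq₁ = ℕSolver.solve-∀
    eq₂ : ∀ n a b c → n ℕ.* (a ℕ.* b ℕ.+ a ℕ.* c ℕ.+ b ℕ.* c) ≡ n ℕ.* (a ℕ.* c ℕ.+ a ℕ.* b ℕ.+ c ℕ.* b)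
    eq₂ = ℕSolver.solve-∀

erdősStraus-cong : ∀ {n u₁ u₂ u₃ v₁ v₂ v₃} → u₁ ≡ v₁ → u₂ ≡ v₂ → u₃ ≡ v₃ → ErdősStraus n u₁ u₂ u₃ → ErdősStraus n v₁ v₂ v₃
erdősStraus-cong refl refl refl = id

p^-mono-∣ : ∀ p {i j} → i ≤ j → p ℕ.^ i ∣ p ℕ.^ j
p^-mono-∣ p {i} {j} i≤j = subst (p ℕ.^ i ∣_) (trans (sym (ℕ.^-distribˡ-+-* p i (j ℕ.∸ i))) (cong (p ℕ.^_) (ℕ.m+[n∸m]≡n i≤j))) (ℕ.m∣m*n _)

-- The gap e is recorded because p^e turns out to divide w₂ + w₃ when p ∤ n; at p = 2 its size and
-- parity decide which congruence results.
record TopPair (p u₁ u₂ u₃ : ℕ) : Set where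
  constructor topPair
  field
    v e w₁ w₂ w₃ : ℕ
    0<e  : 0 < e
    val₁ : IsVal p u₁ v w₁
    val₂ : IsVal p u₂ (v ℕ.+ e) w₂
    val₃ : IsVal p u₃ (v ℕ.+ e) w₃

record AllEqual (p u₁ u₂ u₃ : ℕ) : Set where
  constructor allEqual
  field
    v w₁ w₂ w₃ : ℕ
    val₁ : IsVal p u₁ v w₁
    val₂ : IsVal p u₂ v w₂
    val₃ : IsVal p u₃ v w₃

data Valuations (p u₁ u₂ u₃ : ℕ) : Set where
  top₂₃ : TopPair p u₁ u₂ u₃ → Valuations p u₁ u₂ u₃
  top₁₃ : TopPair p u₂ u₁ u₃ → Valuations p u₁ u₂ u₃
  top₁₂ : TopPair p u₃ u₁ u₂ → Valuations p u₁ u₂ u₃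
  all   : AllEqual p u₁ u₂ u₃ → Valuations p u₁ u₂ u₃

module _ {p n : ℕ} (p-prime : Prime p) (p∤n : p ∤ n) where

  private
    0<p^ : ∀ i → 0 < p ℕ.^ i
    0<p^ i = ℕ.m^n>0 p {{prime⇒nonZero p-prime}} i

  -- 1/u₁ + 1/u₂ + 1/u₃ = 4/n is p-integral, so its largest p-adic pole must cancel.
  no-strict-max : ∀ {α β γ w₁ w₂ w₃} → p ∤ w₂ → p ∤ w₃ → β < α → γ < α →
                  ¬ ErdősStraus n (p ℕ.^ α ℕ.* w₁) (p ℕ.^ β ℕ.* w₂) (p ℕ.^ γ ℕ.* w₃)
  no-strict-max {α} {β} {γ} {w₁} {w₂} {w₃} p∤w₂ p∤w₃ β<α γ<α eq = prime∤* p-prime p∤w₂ p∤w₃ p∣w₂w₃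
    where
    u₁ = p ℕ.^ α ℕ.* w₁
    u₂ = p ℕ.^ β ℕ.* w₂
    u₃ = p ℕ.^ γ ℕ.* w₃
    -- One more than the valuation of u₂ u₃. The power p^i divides the other two products and, by
    -- the equation and p ∤ n, the whole sum; hence it would divide u₂ u₃.
    i = suc (β ℕ.+ γ)
    D∣u₁u₂ : p ℕ.^ i ∣ u₁ ℕ.* u₂
    D∣u₁u₂ = subst (_∣ u₁ ℕ.* u₂) (trans (sym (ℕ.^-distribˡ-+-* p (suc γ) β)) (cong (λ k → p ℕ.^ suc k) (ℕ.+-comm γ β)))
      (ℕ.*-pres-∣ (ℕ.∣m⇒∣m*n w₁ (p^-mono-∣ p γ<α)) (ℕ.m∣m*n w₂))
    D∣u₁u₃ : p ℕ.^ i ∣ u₁ ℕ.* u₃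
    D∣u₁u₃ = subst (_∣ u₁ ℕ.* u₃) (sym (ℕ.^-distribˡ-+-* p (suc β) γ))
      (ℕ.*-pres-∣ (ℕ.∣m⇒∣m*n w₁ (p^-mono-∣ p β<α)) (ℕ.m∣m*n w₃))
    D∣sum : p ℕ.^ i ∣ u₁ ℕ.* u₂ ℕ.+ u₁ ℕ.* u₃ ℕ.+ u₂ ℕ.* u₃
    D∣sum = p^∣*ˡ p-prime i _ p∤n (subst (p ℕ.^ i ∣_) eq (ℕ.∣n⇒∣m*n 4 (ℕ.∣m⇒∣m*n u₃ D∣u₁u₂)))
    regroup : ∀ P Q w₂ w₃ → P ℕ.* w₂ ℕ.* (Q ℕ.* w₃) ≡ P ℕ.* Q ℕ.* (w₂ ℕ.* w₃)
    regroup = ℕSolver.solve-∀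
    D∣u₂u₃ : p ℕ.^ (β ℕ.+ γ) ℕ.* p ∣ p ℕ.^ (β ℕ.+ γ) ℕ.* (w₂ ℕ.* w₃)
    D∣u₂u₃ = subst₂ _∣_ (ℕ.*-comm p _) (trans (regroup (p ℕ.^ β) (p ℕ.^ γ) w₂ w₃) (cong (ℕ._* (w₂ ℕ.* w₃)) (sym (ℕ.^-distribˡ-+-* p β γ))))
      (ℕ.∣m+n∣m⇒∣n D∣sum (ℕ.∣m∣n⇒∣m+n D∣u₁u₂ D∣u₁u₃))
    p∣w₂w₃ : p ∣ w₂ ℕ.* w₃
    p∣w₂w₃ = ℕ.*-cancelˡ-∣ (p ℕ.^ (β ℕ.+ γ)) {{ℕ.>-nonZero (0<p^ (β ℕ.+ γ))}} D∣u₂u₃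

  valuations : ∀ {u₁ u₂ u₃} → Valued p u₁ → Valued p u₂ → Valued p u₃ → ErdősStraus n u₁ u₂ u₃ → Valuations p u₁ u₂ u₃
  valuations (valued α w₁ val₁@(isVal refl p∤w₁)) (valued β w₂ val₂@(isVal refl p∤w₂)) (valued γ w₃ val₃@(isVal refl p∤w₃)) eq =
    compare (ℕ.<-cmp β γ) (ℕ.<-cmp α β) (ℕ.<-cmp α γ)
    where
    u₁ = p ℕ.^ α ℕ.* w₁
    u₂ = p ℕ.^ β ℕ.* w₂
    u₃ = p ℕ.^ γ ℕ.* w₃
    pair : ∀ {u₁ u₂ u₃ w₁ w₂ w₃ α β} → α < β → IsVal p u₁ α w₁ → IsVal p u₂ β w₂ → IsVal p u₃ β w₃ → TopPair p u₁ u₂ u₃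
    pair {α = α} {β} α<β v₁ v₂ v₃ = topPair α (β ℕ.∸ α) _ _ _ (ℕ.m<n⇒0<n∸m α<β) v₁ (subst (λ b → IsVal p _ b _) β≡ v₂) (subst (λ b → IsVal p _ b _) β≡ v₃)
      where
      β≡ : β ≡ α ℕ.+ (β ℕ.∸ α)
      β≡ = sym (ℕ.m+[n∸m]≡n (ℕ.<⇒≤ α<β))
    max₁ : β < α → γ < α → Valuations p u₁ u₂ u₃
    max₁ β<α γ<α = contradiction eq (no-strict-max p∤w₂ p∤w₃ β<α γ<α)
    compare : Tri (β < γ) (β ≡ γ) (γ < β) → Tri (α < β) (α ≡ β) (β < α) → Tri (α < γ) (α ≡ γ) (γ < α) → Valuations p u₁ u₂ u₃
    compare (tri≈ _ β≡γ _) (tri< α<β _ _)  _               = top₂₃ (pair α<β val₁ val₂ (subst (λ b → IsVal p u₃ b w₃) (sym β≡γ) val₃))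
    compare (tri≈ _ β≡γ _) (tri≈ _ α≡β _)  _               = all (allEqual β w₁ w₂ w₃ (subst (λ b → IsVal p u₁ b w₁) α≡β val₁) val₂ (subst (λ b → IsVal p u₃ b w₃) (sym β≡γ) val₃))
    compare (tri≈ _ β≡γ _) (tri> _ _ β<α)  _               = max₁ β<α (subst (_< α) β≡γ β<α)
    compare (tri< β<γ _ _) _               (tri< α<γ _ _)  = contradiction (erdősStraus-swap₁₂ {n} {u₁} (erdősStraus-swap₂₃ {n} {u₁} eq)) (no-strict-max p∤w₁ p∤w₂ α<γ β<γ)
    compare (tri< β<γ _ _) _               (tri≈ _ α≡γ _)  = top₁₃ (pair β<γ val₂ (subst (λ b → IsVal p u₁ b w₁) α≡γ val₁) val₃)
    compare (tri< β<γ _ _) _               (tri> _ _ γ<α)  = max₁ (ℕ.<-trans β<γ γ<α) γ<α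
    compare (tri> _ _ γ<β) (tri< α<β _ _)  _               = contradiction (erdősStraus-swap₁₂ {n} {u₁} eq) (no-strict-max p∤w₁ p∤w₃ α<β γ<β)
    compare (tri> _ _ γ<β) (tri≈ _ α≡β _)  _               = top₁₂ (pair γ<β val₃ (subst (λ b → IsVal p u₁ b w₁) α≡β val₁) val₂)
    compare (tri> _ _ γ<β) (tri> _ _ β<α)  _               = max₁ β<α (ℕ.<-trans γ<β β<α)

  module _ {u₁ u₂ u₃} (t : TopPair p u₁ u₂ u₃) (eq : ErdősStraus n u₁ u₂ u₃) where

    private
      open TopPair t
      open IsVal val₁ renaming (eq to eq₁; p∤w to p∤w₁)
      open IsVal val₂ renaming (eq to eq₂)
      open IsVal val₃ renaming (eq to eq₃)
      P = p ℕ.^ v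
      Q = p ℕ.^ e

    -- The equation divided by P² Q, the power of p common to the three products. The factors 4 and
    -- P Q on the left are kept: at p = 2 and e = 1 they supply a divisibility by 8.
    top-pair-eq : 4 ℕ.* (P ℕ.* Q ℕ.* (w₁ ℕ.* w₂ ℕ.* w₃)) ≡ n ℕ.* (w₁ ℕ.* (w₂ ℕ.+ w₃) ℕ.+ Q ℕ.* (w₂ ℕ.* w₃))
    top-pair-eq = *-cancelˡ (P ℕ.* P ℕ.* Q) (0<* (0<* (0<p^ v) (0<p^ v)) (0<p^ e))
      (trans (lhs P Q w₁ w₂ w₃) (trans (erdősStraus-cong {n} eq₁ u₂≡ u₃≡ eq)
        (rhs n P Q w₁ w₂ w₃)))
      where
      u₂≡ : u₂ ≡ P ℕ.* Q ℕ.* w₂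
      u₂≡ = trans eq₂ (cong (ℕ._* w₂) (ℕ.^-distribˡ-+-* p v e))
      u₃≡ : u₃ ≡ P ℕ.* Q ℕ.* w₃
      u₃≡ = trans eq₃ (cong (ℕ._* w₃) (ℕ.^-distribˡ-+-* p v e))
      lhs : ∀ P Q w₁ w₂ w₃ → P ℕ.* P ℕ.* Q ℕ.* (4 ℕ.* (P ℕ.* Q ℕ.* (w₁ ℕ.* w₂ ℕ.* w₃))) ≡
            4 ℕ.* (P ℕ.* w₁ ℕ.* (P ℕ.* Q ℕ.* w₂) ℕ.* (P ℕ.* Q ℕ.* w₃))
      lhs = ℕSolver.solve-∀
      rhs : ∀ n P Q w₁ w₂ w₃ →
        n ℕ.* (P ℕ.* w₁ ℕ.* (P ℕ.* Q ℕ.* w₂) ℕ.+ P ℕ.* w₁ ℕ.* (P ℕ.* Q ℕ.* w₃) ℕ.+ P ℕ.* Q ℕ.* w₂ ℕ.* (P ℕ.* Q ℕ.* w₃)) ≡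
        P ℕ.* P ℕ.* Q ℕ.* (n ℕ.* (w₁ ℕ.* (w₂ ℕ.+ w₃) ℕ.+ Q ℕ.* (w₂ ℕ.* w₃)))
      rhs = ℕSolver.solve-∀

    -- In `top-pair-eq` Q divides every term except n w₁ (w₂ + w₃), and p divides neither n nor w₁.
    p^e∣w₂+w₃ : p ℕ.^ e ∣ w₂ ℕ.+ w₃
    p^e∣w₂+w₃ = p^∣*ˡ p-prime e _ p∤w₁ (ℕ.∣m+n∣m⇒∣n (subst (Q ∣_) (ℕ.+-comm (w₁ ℕ.* (w₂ ℕ.+ w₃)) _) Q∣sum) (ℕ.m∣m*n (w₂ ℕ.* w₃)))
      where
      Q∣sum : Q ∣ w₁ ℕ.* (w₂ ℕ.+ w₃) ℕ.+ Q ℕ.* (w₂ ℕ.* w₃)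
      Q∣sum = p^∣*ˡ p-prime e _ p∤n (subst (Q ∣_) top-pair-eq (ℕ.∣n⇒∣m*n 4 (ℕ.∣m⇒∣m*n _ (ℕ.n∣m*n P))))

module _ {p : ℕ} (p-prime : Prime p) where

  cross-multiply : ∀ {k u₁ u₂ A B x y} → 0 < k → k ℕ.* u₁ ≡ A ℕ.* (x ℕ.* x) → k ℕ.* u₂ ≡ B ℕ.* (y ℕ.* y) →
          u₁ ℕ.* (B ℕ.* (y ℕ.* y)) ≡ u₂ ℕ.* (A ℕ.* (x ℕ.* x))
  cross-multiply {k} {u₁} {u₂} 0<k eq₁ eq₂ = *-cancelˡ k 0<k (begin
    k ℕ.* (u₁ ℕ.* _)      ≡⟨ cong (λ s → k ℕ.* (u₁ ℕ.* s)) (sym eq₂) ⟩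
    k ℕ.* (u₁ ℕ.* (k ℕ.* u₂)) ≡⟨ eq k u₁ u₂ ⟩
    k ℕ.* (u₂ ℕ.* (k ℕ.* u₁)) ≡⟨ cong (λ s → k ℕ.* (u₂ ℕ.* s)) eq₁ ⟩
    k ℕ.* (u₂ ℕ.* _)      ∎)
    where
    open ≡-Reasoning
    eq : ∀ k a b → k ℕ.* (a ℕ.* (k ℕ.* b)) ≡ k ℕ.* (b ℕ.* (k ℕ.* a))
    eq = ℕSolver.solve-∀

  -- The ratio u₁ / u₂ is A x² / (B y²), whatever k is. Its valuation gives a parity condition, and
  -- its unit part links w₁ / w₂ to the coefficients.
  cross-valuation : ∀ {k u₁ u₂ A B x y α β a b ξ η w₁ w₂ A′ B′ x′ y′} →
    0 < k → k ℕ.* u₁ ≡ A ℕ.* (x ℕ.* x) → k ℕ.* u₂ ≡ B ℕ.* (y ℕ.* y) →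
    IsVal p u₁ α w₁ → IsVal p u₂ β w₂ → IsVal p A a A′ → IsVal p B b B′ → IsVal p x ξ x′ → IsVal p y η y′ →
    α ℕ.+ (b ℕ.+ (η ℕ.+ η)) ≡ β ℕ.+ (a ℕ.+ (ξ ℕ.+ ξ)) × w₁ ℕ.* (B′ ℕ.* (y′ ℕ.* y′)) ≡ w₂ ℕ.* (A′ ℕ.* (x′ ℕ.* x′))
  cross-valuation {α = α} {β} {a} {b} {ξ} {η} {w₁} {w₂} {A′} {B′} {x′} {y′}
    0<k eq₁ eq₂ (isVal refl p∤w₁) (isVal refl p∤w₂) (isVal refl p∤A′) (isVal refl p∤B′) (isVal refl p∤x′) (isVal refl p∤y′) =
    valuation-unique p-prime _ _ (nondivisible p∤w₁ p∤B′ p∤y′) (nondivisible p∤w₂ p∤A′ p∤x′)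
      (trans (sym (collect α b η w₁ B′ y′)) (trans (cross-multiply {A = p ℕ.^ a ℕ.* A′} {p ℕ.^ b ℕ.* B′} {p ℕ.^ ξ ℕ.* x′} {p ℕ.^ η ℕ.* y′} 0<k eq₁ eq₂) (collect β a ξ w₂ A′ x′)))
    where
    nondivisible : ∀ {w B y} → p ∤ w → p ∤ B → p ∤ y → p ∤ w ℕ.* (B ℕ.* (y ℕ.* y))
    nondivisible p∤w p∤B p∤y = prime∤* p-prime p∤w (prime∤* p-prime p∤B (prime∤* p-prime p∤y p∤y))
    eq : ∀ P Q R w B y → (P ℕ.* w) ℕ.* ((Q ℕ.* B) ℕ.* ((R ℕ.* y) ℕ.* (R ℕ.* y))) ≡ (P ℕ.* (Q ℕ.* (R ℕ.* R))) ℕ.* (w ℕ.* (B ℕ.* (y ℕ.* y)))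
    eq = ℕSolver.solve-∀
    collect : ∀ α b η w B y → (p ℕ.^ α ℕ.* w) ℕ.* ((p ℕ.^ b ℕ.* B) ℕ.* ((p ℕ.^ η ℕ.* y) ℕ.* (p ℕ.^ η ℕ.* y))) ≡
              p ℕ.^ (α ℕ.+ (b ℕ.+ (η ℕ.+ η))) ℕ.* (w ℕ.* (B ℕ.* (y ℕ.* y)))
    collect α b η w B y = trans (eq (p ℕ.^ α) (p ℕ.^ b) (p ℕ.^ η) w B y) (cong (ℕ._* (w ℕ.* (B ℕ.* (y ℕ.* y)))) (sym
      (trans (ℕ.^-distribˡ-+-* p α (b ℕ.+ (η ℕ.+ η))) (cong (p ℕ.^ α ℕ.*_)
        (trans (ℕ.^-distribˡ-+-* p b (η ℕ.+ η)) (cong (p ℕ.^ b ℕ.*_) (ℕ.^-distribˡ-+-* p η η)))))))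

  squarefree-valuation : ∀ {A} → Squarefree A → p ∣ A → ∃[ A′ ] A ≡ A′ ℕ.* p × p ∤ A′
  squarefree-valuation {A} A-squarefree (ℕ.divides A′ refl) = A′ , refl , λ p∣A′ →
    ℕ.<⇒≢ (1<p p-prime) (sym (A-squarefree p (ℕ.*-monoˡ-∣ p p∣A′)))

  coprime⇒∤ : ∀ {A B} → Coprime A B → p ∣ A → p ∤ B
  coprime⇒∤ A⊥B p∣A p∣B = ℕ.<⇒≢ (1<p p-prime) (sym (A⊥B (p∣A , p∣B)))

  unitVal : ∀ {u} → p ∤ u → IsVal p u 0 u
  unitVal p∤u = isVal (sym (ℕ.*-identityˡ _)) p∤u

  pVal : ∀ {u} → p ∤ u → IsVal p (u ℕ.* p) 1 u
  pVal {u} p∤u = isVal (trans (ℕ.*-comm u p) (cong (ℕ._* u) (sym (ℕ.*-identityʳ p)))) p∤u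

  -- w₂ (b + c) = b (w₂ + w₃), because (b, c) is proportional to (w₂, w₃).
  p^∣-transfer : ∀ i {w₂ w₃ b c} → p ∤ w₂ → w₂ ℕ.* c ≡ w₃ ℕ.* b → p ℕ.^ i ∣ w₂ ℕ.+ w₃ → p ℕ.^ i ∣ b ℕ.+ c
  p^∣-transfer i {w₂} {w₃} {b} {c} p∤w₂ eq p^i∣ = p^∣*ˡ p-prime i _ p∤w₂ (subst (p ℕ.^ i ∣_)
    (trans (distrib b w₂ w₃) (trans (cong (w₂ ℕ.* b ℕ.+_) (sym eq)) (sym (ℕ.*-distribˡ-+ w₂ b c)))) (ℕ.∣n⇒∣m*n b p^i∣))
    where
    distrib : ∀ b w₂ w₃ → b ℕ.* (w₂ ℕ.+ w₃) ≡ w₂ ℕ.* b ℕ.+ w₃ ℕ.* b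
    distrib = ℕSolver.solve-∀

even≢odd : ∀ a b → a ℕ.+ a ≢ suc (b ℕ.+ b)
even≢odd (suc a) (suc b) eq = even≢odd a b (ℕ.suc-injective (ℕ.suc-injective
  (trans (cong suc (sym (ℕ.+-suc a a))) (trans eq (cong (suc ∘ suc) (ℕ.+-suc b b))))))
even≢odd (suc a) zero eq = contradiction (trans (sym (ℕ.+-suc a a)) (ℕ.suc-injective eq)) λ ()

-- Since p divides A exactly once and divides neither B nor C, u₁ differs from u₂ and u₃ by odd
-- valuations. So u₁ shares its valuation with neither, and the top pair is u₂, u₃. Then p ∣ B y² +
-- C z² for the unit parts y, z of the square factors; multiplying by B gives r = B y and s = z.
-BC-square : ∀ {p n u₁ u₂ u₃ A B C} → Prime p → p ∤ n → 0 < u₁ → 0 < u₂ → 0 < u₃ → ErdősStraus n u₁ u₂ u₃ →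
             Reduced A B C → Scaled u₁ u₂ u₃ A B C → p ∣ A →
             ∃[ r ] ∃[ s ] p ∤ r × p ∤ s × p ∣ r ℕ.* r ℕ.+ B ℕ.* C ℕ.* (s ℕ.* s)
-BC-square {p} {B = B} {C} p-prime p∤n 0<u₁ 0<u₂ 0<u₃ es (reduced _ _ _ A⊥B A⊥C _ A-sqf _ _)
  (scaled k x y z 0<k 0<x 0<y 0<z eq₁ eq₂ eq₃) p∣A
  with A′ , refl , p∤A′ ← squarefree-valuation p-prime A-sqf p∣A
     | valued ξ x′ x≡ ← valuation p-prime x 0<x
     | valued η y′ y≡ ← valuation p-prime y 0<y
     | valued ζ z′ z≡ ← valuation p-prime z 0<z
  with valuations p-prime p∤n (valuation p-prime _ 0<u₁) (valuation p-prime _ 0<u₂) (valuation p-prime _ 0<u₃) es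
... | top₂₃ t@(topPair v e w₁ w₂ w₃ 0<e e₁ e₂@(isVal _ p∤w₂) e₃) = B ℕ.* y′ , z′ , prime∤* p-prime p∤B (IsVal.p∤w y≡) , IsVal.p∤w z≡ ,
  subst (p ∣_) (regroup B C y′ z′) (ℕ.∣n⇒∣m*n B p∣By²+Cz²)
  where
  p∤B = coprime⇒∤ p-prime A⊥B p∣A
  p∤C = coprime⇒∤ p-prime A⊥C p∣A
  regroup : ∀ B C y z → B ℕ.* (B ℕ.* (y ℕ.* y) ℕ.+ C ℕ.* (z ℕ.* z)) ≡ B ℕ.* y ℕ.* (B ℕ.* y) ℕ.+ B ℕ.* C ℕ.* (z ℕ.* z)
  regroup = ℕSolver.solve-∀
  unit-parts : w₂ ℕ.* (C ℕ.* (z′ ℕ.* z′)) ≡ w₃ ℕ.* (B ℕ.* (y′ ℕ.* y′))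
  unit-parts = proj₂ (cross-valuation p-prime {b = 0} 0<k eq₂ eq₃ e₂ e₃ (unitVal p-prime p∤B) (unitVal p-prime p∤C) y≡ z≡)
  p∣By²+Cz² : p ∣ B ℕ.* (y′ ℕ.* y′) ℕ.+ C ℕ.* (z′ ℕ.* z′)
  p∣By²+Cz² = ℕ.∣-trans (subst (_∣ p ℕ.^ e) (ℕ.*-identityʳ p) (p^-mono-∣ p 0<e))
    (p^∣-transfer p-prime e p∤w₂ unit-parts (p^e∣w₂+w₃ p-prime p∤n t es))
... | top₁₃ (topPair v e w₂ w₁ w₃ 0<e e₂ e₁ e₃) = contradiction
  (ℕ.+-cancelˡ-≡ (v ℕ.+ e) _ _ (proj₁ (cross-valuation p-prime {a = 1} {b = 0} 0<k eq₁ eq₃ e₁ e₃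
    (pVal p-prime p∤A′) (unitVal p-prime (coprime⇒∤ p-prime A⊥C p∣A)) x≡ z≡)))
  (even≢odd ζ ξ)
... | top₁₂ (topPair v e w₃ w₁ w₂ 0<e e₃ e₁ e₂) = contradiction
  (ℕ.+-cancelˡ-≡ (v ℕ.+ e) _ _ (proj₁ (cross-valuation p-prime {a = 1} {b = 0} 0<k eq₁ eq₂ e₁ e₂
    (pVal p-prime p∤A′) (unitVal p-prime (coprime⇒∤ p-prime A⊥B p∣A)) x≡ y≡)))
  (even≢odd η ξ)
... | all (allEqual v w₁ w₂ w₃ e₁ e₂ e₃) = contradiction
  (ℕ.+-cancelˡ-≡ v _ _ (proj₁ (cross-valuation p-prime {a = 1} {b = 0} 0<k eq₁ eq₂ e₁ e₂
    (pVal p-prime p∤A′) (unitVal p-prime (coprime⇒∤ p-prime A⊥B p∣A)) x≡ y≡)))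
  (even≢odd η ξ)

-- The congruences at 2

2∤⇒odd : ∀ {w} → 2 ∤ w → ∃[ h ] w ≡ odd h
2∤⇒odd {w} 2∤w with parity w
... | h , inj₂ w≡ = h , w≡
... | h , inj₁ refl = contradiction (ℕ.divides h (eq h)) 2∤w
  where
  eq : ∀ h → h ℕ.+ h ≡ h ℕ.* 2
  eq = ℕSolver.solve-∀

odd-square : ∀ {x} → 2 ∤ x → ∃[ t ] x ℕ.* x ≡ 1 ℕ.+ 8 ℕ.* t
odd-square {x} 2∤x with 2∤⇒odd 2∤x
... | h , refl with parity h
...   | i , inj₁ refl = i ℕ.* (i ℕ.+ i ℕ.+ 1) , eq i
  where
  eq : ∀ i → (1 ℕ.+ ((i ℕ.+ i) ℕ.+ (i ℕ.+ i))) ℕ.* (1 ℕ.+ ((i ℕ.+ i) ℕ.+ (i ℕ.+ i))) ≡ 1 ℕ.+ 8 ℕ.* (i ℕ.* (i ℕ.+ i ℕ.+ 1))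
  eq = ℕSolver.solve-∀
...   | i , inj₂ refl = (1 ℕ.+ i ℕ.+ i) ℕ.* (1 ℕ.+ i) , eq i
  where
  eq : ∀ i → (1 ℕ.+ ((1 ℕ.+ (i ℕ.+ i)) ℕ.+ (1 ℕ.+ (i ℕ.+ i)))) ℕ.* (1 ℕ.+ ((1 ℕ.+ (i ℕ.+ i)) ℕ.+ (1 ℕ.+ (i ℕ.+ i)))) ≡
       1 ℕ.+ 8 ℕ.* ((1 ℕ.+ i ℕ.+ i) ℕ.* (1 ℕ.+ i))
  eq = ℕSolver.solve-∀

-- The condition at 2 for isotropy of AX² + BY² + CZ², with B and C odd.
data Isotropic₂ (A B C : ℕ) : Set where
  odd-A  : 2 ∤ A → 4 ∣ B ℕ.+ C → Isotropic₂ A B C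
  even-A : ∀ A′ → A ≡ 2 ℕ.* A′ → 2 ∤ A′ → 8 ∣ B ℕ.+ C ⊎ 8 ∣ A′ ℕ.* (B ℕ.+ C) ℕ.+ 2 ℕ.* (B ℕ.* C) → Isotropic₂ A B C

OddSquare : ℕ → Set
OddSquare s = ∃[ t ] s ≡ 1 ℕ.+ 8 ℕ.* t

8∣sum : ∀ D {b c s t} → D ∣ 8 → OddSquare s → OddSquare t → D ∣ b ℕ.* s ℕ.+ c ℕ.* t → D ∣ b ℕ.+ c
8∣sum D {b} {c} D∣8 (i , refl) (j , refl) D∣ = ℕ.∣m+n∣m⇒∣n (subst (D ∣_) (eq b c i j) D∣) (ℕ.∣m⇒∣m*n (b ℕ.* i ℕ.+ c ℕ.* j) D∣8)
  where
  eq : ∀ b c i j → b ℕ.* (1 ℕ.+ 8 ℕ.* i) ℕ.+ c ℕ.* (1 ℕ.+ 8 ℕ.* j) ≡ 8 ℕ.* (b ℕ.* i ℕ.+ c ℕ.* j) ℕ.+ (b ℕ.+ c)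
  eq = ℕSolver.solve-∀

8∣form : ∀ {a b c r s t} → OddSquare r → OddSquare s → OddSquare t →
         8 ∣ a ℕ.* r ℕ.* (b ℕ.* s ℕ.+ c ℕ.* t) ℕ.+ 2 ℕ.* (b ℕ.* s ℕ.* (c ℕ.* t)) → 8 ∣ a ℕ.* (b ℕ.+ c) ℕ.+ 2 ℕ.* (b ℕ.* c)
8∣form {a} {b} {c} (i , refl) (j , refl) (k , refl) 8∣ = ℕ.∣m+n∣m⇒∣n (subst (8 ∣_) (eq a b c i j k) 8∣) (ℕ.m∣m*n (carry a b c i j k))
  where
  carry : (a b c i j k : ℕ) → ℕ
  carry a b c i j k = a ℕ.* i ℕ.* (b ℕ.* (1 ℕ.+ 8 ℕ.* j) ℕ.+ c ℕ.* (1 ℕ.+ 8 ℕ.* k)) ℕ.+ a ℕ.* (b ℕ.* j ℕ.+ c ℕ.* k)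
    ℕ.+ 2 ℕ.* (b ℕ.* c ℕ.* (j ℕ.+ k ℕ.+ 8 ℕ.* j ℕ.* k))
  eq : ∀ a b c i j k →
    a ℕ.* (1 ℕ.+ 8 ℕ.* i) ℕ.* (b ℕ.* (1 ℕ.+ 8 ℕ.* j) ℕ.+ c ℕ.* (1 ℕ.+ 8 ℕ.* k)) ℕ.+ 2 ℕ.* (b ℕ.* (1 ℕ.+ 8 ℕ.* j) ℕ.* (c ℕ.* (1 ℕ.+ 8 ℕ.* k)))
    ≡ 8 ℕ.* (a ℕ.* i ℕ.* (b ℕ.* (1 ℕ.+ 8 ℕ.* j) ℕ.+ c ℕ.* (1 ℕ.+ 8 ℕ.* k)) ℕ.+ a ℕ.* (b ℕ.* j ℕ.+ c ℕ.* k)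
        ℕ.+ 2 ℕ.* (b ℕ.* c ℕ.* (j ℕ.+ k ℕ.+ 8 ℕ.* j ℕ.* k)))
      ℕ.+ (a ℕ.* (b ℕ.+ c) ℕ.+ 2 ℕ.* (b ℕ.* c))
  eq = ℕSolver.solve-∀

-- Equal valuations of u₂ and u₃ force B and C to be both odd, as they are coprime and squarefree.
-- Comparing u₁ with u₂, the gap e has the parity of the valuation of A. If A is odd, then e is
-- even, so e ≥ 2 and 4 ∣ B + C. If A is even, then e = 1 gives the congruence for A′, and e ≥ 3
-- gives 8 ∣ B + C.
isotropic₂ : ∀ {n u₁ u₂ u₃ A B C} → 2 ∤ n → ErdősStraus n u₁ u₂ u₃ → Reduced A B C → Scaled u₁ u₂ u₃ A B C →
             TopPair 2 u₁ u₂ u₃ → 2 ∤ B × 2 ∤ C × Isotropic₂ A B C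
isotropic₂ {n} {u₁} {u₂} {u₃} {A} {B} {C} 2∤n es (reduced _ _ _ A⊥B A⊥C B⊥C A-sqf B-sqf C-sqf)
  (scaled k x y z 0<k 0<x 0<y 0<z eq₁ eq₂ eq₃) t@(topPair v e w₁ w₂ w₃ 0<e val₁@(isVal _ 2∤w₁) val₂@(isVal _ 2∤w₂) val₃)
  with valued ξ x′ x≡ ← valuation prime[2] x 0<x
     | valued η y′ y≡ ← valuation prime[2] y 0<y
     | valued ζ z′ z≡ ← valuation prime[2] z 0<z
  = 2∤B , 2∤C , by-parity (2 ℕ.∣? A)
  where
  2∤B : 2 ∤ B
  2∤B 2∣B with B′ , refl , 2∤B′ ← squarefree-valuation prime[2] B-sqf 2∣B = even≢odd ζ η
    (ℕ.+-cancelˡ-≡ (v ℕ.+ e) _ _ (proj₁ (cross-valuation prime[2] 0<k eq₂ eq₃ val₂ val₃ (pVal prime[2] 2∤B′) (unitVal prime[2] (coprime⇒∤ prime[2] B⊥C 2∣B)) y≡ z≡)))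
  2∤C : 2 ∤ C
  2∤C 2∣C with C′ , refl , 2∤C′ ← squarefree-valuation prime[2] C-sqf 2∣C = even≢odd η ζ
    (sym (ℕ.+-cancelˡ-≡ (v ℕ.+ e) _ _ (proj₁ (cross-valuation prime[2] 0<k eq₂ eq₃ val₂ val₃ (unitVal prime[2] 2∤B) (pVal prime[2] 2∤C′) y≡ z≡))))
  y²-odd = odd-square (IsVal.p∤w y≡)
  z²-odd = odd-square (IsVal.p∤w z≡)
  B,C-units : w₂ ℕ.* (C ℕ.* (z′ ℕ.* z′)) ≡ w₃ ℕ.* (B ℕ.* (y′ ℕ.* y′))
  B,C-units = proj₂ (cross-valuation prime[2] 0<k eq₂ eq₃ val₂ val₃ (unitVal prime[2] 2∤B) (unitVal prime[2] 2∤C) y≡ z≡)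
  2^i∣B+C : ∀ i → i ≤ e → 2 ℕ.^ i ∣ 8 → 2 ℕ.^ i ∣ B ℕ.+ C
  2^i∣B+C i i≤e ∣8 = 8∣sum (2 ℕ.^ i) {B} {C} ∣8 y²-odd z²-odd (p^∣-transfer prime[2] i 2∤w₂ B,C-units
    (ℕ.∣-trans (p^-mono-∣ 2 i≤e) (p^e∣w₂+w₃ prime[2] 2∤n t es)))
  A-odd : 2 ∤ A → 4 ∣ B ℕ.+ C
  A-odd 2∤A = 2^i∣B+C 2 (2≤e e 0<e (ℕ.+-cancelˡ-≡ v _ _ (trans valuations-eq (ℕ.+-assoc v e (ξ ℕ.+ ξ))))) (ℕ.divides 2 refl)
    where
    valuations-eq : v ℕ.+ (η ℕ.+ η) ≡ v ℕ.+ e ℕ.+ (ξ ℕ.+ ξ)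
    valuations-eq = proj₁ (cross-valuation prime[2] 0<k eq₁ eq₂ val₁ val₂ (unitVal prime[2] 2∤A) (unitVal prime[2] 2∤B) x≡ y≡)
    2≤e : ∀ e → 0 < e → η ℕ.+ η ≡ e ℕ.+ (ξ ℕ.+ ξ) → 2 ≤ e
    2≤e 1             _ eq = contradiction eq (even≢odd η ξ)
    2≤e (suc (suc e)) _ _  = s≤s (s≤s z≤n)
  module A-even (A′ : ℕ) (A≡ : A ≡ A′ ℕ.* 2) (2∤A′ : 2 ∤ A′) where
    valA : IsVal 2 A 1 A′
    valA = subst (λ a → IsVal 2 a 1 A′) (sym A≡) (pVal prime[2] 2∤A′)
    A,B : v ℕ.+ (η ℕ.+ η) ≡ v ℕ.+ e ℕ.+ suc (ξ ℕ.+ ξ) × w₁ ℕ.* (B ℕ.* (y′ ℕ.* y′)) ≡ w₂ ℕ.* (A′ ℕ.* (x′ ℕ.* x′))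
    A,B = cross-valuation prime[2] 0<k eq₁ eq₂ val₁ val₂ valA (unitVal prime[2] 2∤B) x≡ y≡
    A,C : w₁ ℕ.* (C ℕ.* (z′ ℕ.* z′)) ≡ w₃ ℕ.* (A′ ℕ.* (x′ ℕ.* x′))
    A,C = proj₂ (cross-valuation prime[2] 0<k eq₁ eq₃ val₁ val₃ valA (unitVal prime[2] 2∤C) x≡ z≡)
    -- The triples (a, b, c) and (w₁, w₂, w₃) are proportional, and both brackets are values of one
    -- quadratic form at them.
    scaled-form : ∀ {w₁ w₂ w₃ a b c} → w₁ ℕ.* b ≡ w₂ ℕ.* a → w₁ ℕ.* c ≡ w₃ ℕ.* a →
      w₁ ℕ.* w₁ ℕ.* (a ℕ.* (b ℕ.+ c) ℕ.+ 2 ℕ.* (b ℕ.* c)) ≡ a ℕ.* a ℕ.* (w₁ ℕ.* (w₂ ℕ.+ w₃) ℕ.+ 2 ℕ.* (w₂ ℕ.* w₃))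
    scaled-form {w₁} {w₂} {w₃} {a} {b} {c} eq₁ eq₂ = trans (lhs w₁ a b c)
      (trans (cong₂ (λ β γ → w₁ ℕ.* a ℕ.* (β ℕ.+ γ) ℕ.+ 2 ℕ.* (β ℕ.* γ)) eq₁ eq₂) (rhs w₁ w₂ w₃ a))
      where
      lhs : ∀ w a b c → w ℕ.* w ℕ.* (a ℕ.* (b ℕ.+ c) ℕ.+ 2 ℕ.* (b ℕ.* c)) ≡ w ℕ.* a ℕ.* (w ℕ.* b ℕ.+ w ℕ.* c) ℕ.+ 2 ℕ.* (w ℕ.* b ℕ.* (w ℕ.* c))
      lhs = ℕSolver.solve-∀
      rhs : ∀ w₁ w₂ w₃ a → w₁ ℕ.* a ℕ.* (w₂ ℕ.* a ℕ.+ w₃ ℕ.* a) ℕ.+ 2 ℕ.* (w₂ ℕ.* a ℕ.* (w₃ ℕ.* a)) ≡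
            a ℕ.* a ℕ.* (w₁ ℕ.* (w₂ ℕ.+ w₃) ℕ.+ 2 ℕ.* (w₂ ℕ.* w₃))
      rhs = ℕSolver.solve-∀
    -- Now Q = 2, so the left side of `top-pair-eq` is a multiple of 4 · 2; the odd factors n and
    -- w₁² and the odd squares are then removed.
    e≡1⇒8∣ : e ≡ 1 → 8 ∣ A′ ℕ.* (B ℕ.+ C) ℕ.+ 2 ℕ.* (B ℕ.* C)
    e≡1⇒8∣ refl = 8∣form {A′} {B} {C} (odd-square (IsVal.p∤w x≡)) y²-odd z²-odd (p^∣*ˡ prime[2] 3 _ (prime∤* prime[2] 2∤w₁ 2∤w₁)
      (subst (8 ∣_) (sym (scaled-form {w₁} {w₂} {w₃} {a} {b} {c} (proj₂ A,B) A,C)) (ℕ.∣n⇒∣m*n (a ℕ.* a) (p^∣*ˡ prime[2] 3 _ 2∤n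
        (subst (8 ∣_) (trans (eq (2 ℕ.^ v) (w₁ ℕ.* w₂ ℕ.* w₃)) (top-pair-eq prime[2] 2∤n t es)) (ℕ.m∣m*n (2 ℕ.^ v ℕ.* (w₁ ℕ.* w₂ ℕ.* w₃))))))))
      where
      a = A′ ℕ.* (x′ ℕ.* x′)
      b = B ℕ.* (y′ ℕ.* y′)
      c = C ℕ.* (z′ ℕ.* z′)
      eq : ∀ P w → 8 ℕ.* (P ℕ.* w) ≡ 4 ℕ.* (P ℕ.* 2 ℕ.* w)
      eq = ℕSolver.solve-∀
    3≤e : ∀ e → 0 < e → e ≢ 1 → η ℕ.+ η ≡ e ℕ.+ suc (ξ ℕ.+ ξ) → 3 ≤ e
    3≤e 1                   _ e≢1 _  = contradiction refl e≢1
    3≤e 2                   _ _   eq = contradiction (trans eq (cong suc (eq₃′ ξ))) (even≢odd η (suc ξ))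
      where
      eq₃′ : ∀ ξ → 1 ℕ.+ (1 ℕ.+ (ξ ℕ.+ ξ)) ≡ 1 ℕ.+ ξ ℕ.+ (1 ℕ.+ ξ)
      eq₃′ = ℕSolver.solve-∀
    3≤e (suc (suc (suc e))) _ _   _  = s≤s (s≤s (s≤s z≤n))
    condition : 8 ∣ B ℕ.+ C ⊎ 8 ∣ A′ ℕ.* (B ℕ.+ C) ℕ.+ 2 ℕ.* (B ℕ.* C)
    condition with e ℕ.≟ 1
    ... | yes e≡1 = inj₂ (e≡1⇒8∣ e≡1)
    ... | no  e≢1 = inj₁ (2^i∣B+C 3 (3≤e e 0<e e≢1 (ℕ.+-cancelˡ-≡ v _ _ (trans (proj₁ A,B) (ℕ.+-assoc v e (suc (ξ ℕ.+ ξ)))))) (ℕ.divides 1 refl))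
  by-parity : Dec (2 ∣ A) → Isotropic₂ A B C
  by-parity (no 2∤A)  = odd-A 2∤A (A-odd 2∤A)
  by-parity (yes 2∣A) with A′ , A≡ , 2∤A′ ← squarefree-valuation prime[2] A-sqf 2∣A =
    even-A A′ (trans A≡ (ℕ.*-comm A′ 2)) 2∤A′ (A-even.condition A′ A≡ 2∤A′)

odd+odd : ∀ {a b} → 2 ∤ a → 2 ∤ b → 2 ∣ a ℕ.+ b
odd+odd 2∤a 2∤b with 2∤⇒odd 2∤a | 2∤⇒odd 2∤b
... | h , refl | i , refl = ℕ.divides (1 ℕ.+ h ℕ.+ i) (eq h i)
  where
  eq : ∀ h i → 1 ℕ.+ (h ℕ.+ h) ℕ.+ (1 ℕ.+ (i ℕ.+ i)) ≡ (1 ℕ.+ h ℕ.+ i) ℕ.* 2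
  eq = ℕSolver.solve-∀

-- With equal valuations the factor 4 on the left would make w₁ w₂ + w₁ w₃ + w₂ w₃ even, but it is a
-- sum of three odd numbers.
not-all-equal₂ : ∀ {n u₁ u₂ u₃} → 2 ∤ n → ErdősStraus n u₁ u₂ u₃ → ¬ AllEqual 2 u₁ u₂ u₃
not-all-equal₂ {n} 2∤n es (allEqual v w₁ w₂ w₃ (isVal refl 2∤w₁) (isVal refl 2∤w₂) (isVal refl 2∤w₃)) =
  prime∤* prime[2] 2∤w₂ 2∤w₃ (ℕ.∣m+n∣m⇒∣n 2∣sum (subst (2 ∣_) (ℕ.*-distribˡ-+ w₁ w₂ w₃) (ℕ.∣n⇒∣m*n w₁ (odd+odd 2∤w₂ 2∤w₃))))
  where
  P = 2 ℕ.^ v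
  lhs : ∀ P w₁ w₂ w₃ → P ℕ.* P ℕ.* (2 ℕ.* (2 ℕ.* P ℕ.* (w₁ ℕ.* w₂ ℕ.* w₃))) ≡ 4 ℕ.* (P ℕ.* w₁ ℕ.* (P ℕ.* w₂) ℕ.* (P ℕ.* w₃))
  lhs = ℕSolver.solve-∀
  rhs : ∀ n P w₁ w₂ w₃ → n ℕ.* (P ℕ.* w₁ ℕ.* (P ℕ.* w₂) ℕ.+ P ℕ.* w₁ ℕ.* (P ℕ.* w₃) ℕ.+ P ℕ.* w₂ ℕ.* (P ℕ.* w₃)) ≡
    P ℕ.* P ℕ.* (n ℕ.* (w₁ ℕ.* w₂ ℕ.+ w₁ ℕ.* w₃ ℕ.+ w₂ ℕ.* w₃))
  rhs = ℕSolver.solve-∀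
  reduced-eq : 2 ℕ.* (2 ℕ.* P ℕ.* (w₁ ℕ.* w₂ ℕ.* w₃)) ≡ n ℕ.* (w₁ ℕ.* w₂ ℕ.+ w₁ ℕ.* w₃ ℕ.+ w₂ ℕ.* w₃)
  reduced-eq = *-cancelˡ (P ℕ.* P) (0<* (ℕ.m^n>0 2 v) (ℕ.m^n>0 2 v)) (trans (lhs P w₁ w₂ w₃) (trans es (rhs n P w₁ w₂ w₃)))
  2∣sum : 2 ∣ w₁ ℕ.* w₂ ℕ.+ w₁ ℕ.* w₃ ℕ.+ w₂ ℕ.* w₃
  2∣sum = p^∣*ˡ prime[2] 1 _ 2∤n (subst (2 ∣_) reduced-eq (ℕ.m∣m*n (2 ℕ.* P ℕ.* (w₁ ℕ.* w₂ ℕ.* w₃))))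

-- Isotropy over ℚₚ

form : (u₁ u₂ u₃ : ℤ) → ℤ → ℤ → ℤ → ℤ
form u₁ u₂ u₃ X Y Z = u₁ * (X * X) + u₂ * (Y * Y) + u₃ * (Z * Z)

scaled-form : ∀ {u₁ u₂ u₃ A B C} (s : Scaled u₁ u₂ u₃ A B C) → ∀ X Y Z →
              + Scaled.k s * form (+ u₁) (+ u₂) (+ u₃) X Y Z ≡
              form (+ A) (+ B) (+ C) (+ Scaled.x s * X) (+ Scaled.y s * Y) (+ Scaled.z s * Z)
scaled-form {u₁} {u₂} {u₃} {A} {B} {C} (scaled k x y z _ _ _ _ eq₁ eq₂ eq₃) X Y Z =
  trans (distrib (+ k) (+ u₁ * (X * X)) (+ u₂ * (Y * Y)) (+ u₃ * (Z * Z)))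
    (cong₂ _+_ (cong₂ _+_ (term u₁ A x eq₁ X) (term u₂ B y eq₂ Y)) (term u₃ C z eq₃ Z))
  where
  distrib : ∀ k a b c → k * (a + b + c) ≡ k * a + k * b + k * c
  distrib = ℤSolver.solve-∀
  regroup : ∀ a x w → a * (x * x) * (w * w) ≡ a * (x * w * (x * w))
  regroup = ℤSolver.solve-∀
  term : ∀ u A x → k ℕ.* u ≡ A ℕ.* (x ℕ.* x) → ∀ W → + k * (+ u * (W * W)) ≡ + A * (+ x * W * (+ x * W))
  term u A x eq W = begin
    + k * (+ u * (W * W))              ≡⟨ sym (ℤ.*-assoc (+ k) (+ u) (W * W)) ⟩
    + k * + u * (W * W)                ≡⟨ cong (_* (W * W)) (trans (sym (ℤ.pos-* k u)) (trans (cong +_ eq) (trans (ℤ.pos-* A (x ℕ.* x)) (cong (+ A *_) (ℤ.pos-* x x))))) ⟩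
    + A * (+ x * + x) * (W * W)        ≡⟨ regroup (+ A) (+ x) W ⟩
    + A * (+ x * W * (+ x * W))        ∎
    where open ≡-Reasoning

module _ {p : ℕ} where

  Zero : ℤₚ p → Set
  Zero X = ∀ k → + (p ℕ.^ k) ∣ℤ approx X k

  record Vanishes (u₁ u₂ u₃ : ℕ) (X Y Z : ℤₚ p) : Set where
    constructor vanishing
    field
      modulo-p^ : ∀ k → + (p ℕ.^ k) ∣ℤ form (+ u₁) (+ u₂) (+ u₃) (approx X k) (approx Y k) (approx Z k)

record Isotropic (p u₁ u₂ u₃ : ℕ) : Set where
  constructor isotropic
  field
    X Y Z      : ℤₚ p
    nontrivial : ¬ (Zero X × Zero Y × Zero Z)
    vanishes   : Vanishes u₁ u₂ u₃ X Y Z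

-- Triviality of every zero is what descent proves directly, and it refutes any non-trivial solution
-- of the Hilbert equation.
Anisotropic : (p u₁ u₂ u₃ : ℕ) → Set
Anisotropic p u₁ u₂ u₃ = (X Y Z : ℤₚ p) → Vanishes u₁ u₂ u₃ X Y Z → Zero X × Zero Y × Zero Z

-- The Hilbert symbol in a form that is symmetric in the uᵢ, since the argument permutes them.
data LocalSymbol (p u₁ u₂ u₃ : ℕ) : Sign → Set where
  iso   : Isotropic p u₁ u₂ u₃   → LocalSymbol p u₁ u₂ u₃ Sign.+
  aniso : Anisotropic p u₁ u₂ u₃ → LocalSymbol p u₁ u₂ u₃ Sign.-

module _ {p u₁ u₂ u₃ : ℕ} where

  private
    swap₁₂ : ∀ u₁ u₂ u₃ X Y Z → u₁ * (X * X) + u₂ * (Y * Y) + u₃ * (Z * Z) ≡ u₂ * (Y * Y) + u₁ * (X * X) + u₃ * (Z * Z)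
    swap₁₂ = ℤSolver.solve-∀
    swap₂₃ : ∀ u₁ u₂ u₃ X Y Z → u₁ * (X * X) + u₂ * (Y * Y) + u₃ * (Z * Z) ≡ u₁ * (X * X) + u₃ * (Z * Z) + u₂ * (Y * Y)
    swap₂₃ = ℤSolver.solve-∀

  vanishes-swap₁₂ : ∀ {X Y Z : ℤₚ p} → Vanishes u₁ u₂ u₃ X Y Z → Vanishes u₂ u₁ u₃ Y X Z
  vanishes-swap₁₂ {X} {Y} {Z} (vanishing v) = vanishing λ k → subst (+ (p ℕ.^ k) ∣ℤ_) (swap₁₂ (+ u₁) (+ u₂) (+ u₃) (approx X k) (approx Y k) (approx Z k)) (v k)

  vanishes-swap₂₃ : ∀ {X Y Z : ℤₚ p} → Vanishes u₁ u₂ u₃ X Y Z → Vanishes u₁ u₃ u₂ X Z Y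
  vanishes-swap₂₃ {X} {Y} {Z} (vanishing v) = vanishing λ k → subst (+ (p ℕ.^ k) ∣ℤ_) (swap₂₃ (+ u₁) (+ u₂) (+ u₃) (approx X k) (approx Y k) (approx Z k)) (v k)

module _ {p u₁ u₂ u₃ : ℕ} where

  isotropic-swap₁₂ : Isotropic p u₁ u₂ u₃ → Isotropic p u₂ u₁ u₃
  isotropic-swap₁₂ (isotropic X Y Z nt v) = isotropic Y X Z (λ (y , x , z) → nt (x , y , z)) (vanishes-swap₁₂ v)

  isotropic-swap₂₃ : Isotropic p u₁ u₂ u₃ → Isotropic p u₁ u₃ u₂
  isotropic-swap₂₃ (isotropic X Y Z nt v) = isotropic X Z Y (λ (x , z , y) → nt (x , y , z)) (vanishes-swap₂₃ v)

  localSymbol-swap₁₂ : ∀ {s} → LocalSymbol p u₁ u₂ u₃ s → LocalSymbol p u₂ u₁ u₃ s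
  localSymbol-swap₁₂ (iso i)   = iso (isotropic-swap₁₂ i)
  localSymbol-swap₁₂ (aniso a) = aniso λ X Y Z v → let y , x , z = a Y X Z (vanishes-swap₁₂ v) in x , y , z

  localSymbol-swap₂₃ : ∀ {s} → LocalSymbol p u₁ u₂ u₃ s → LocalSymbol p u₁ u₃ u₂ s
  localSymbol-swap₂₃ (iso i)   = iso (isotropic-swap₂₃ i)
  localSymbol-swap₂₃ (aniso a) = aniso λ X Y Z v → let x , z , y = a X Z Y (vanishes-swap₂₃ v) in x , y , z

-- Hensel lifting and descent over the p-adic integers

module _ {p : ℕ} (p-prime : Prime p) where

  private
    pow : ℕ → ℤ
    pow k = + (p ℕ.^ k)

    pow-suc : ∀ k → pow (suc k) ≡ + p * pow k
    pow-suc k = ℤ.pos-* p (p ℕ.^ k)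

    pow-1 : pow 1 ≡ + p
    pow-1 = cong +_ (ℕ.*-identityʳ p)

    pow≢0 : ∀ k → ℤ.NonZero (pow k)
    pow≢0 k = ℕ.m^n≢0 p k {{prime⇒nonZero p-prime}}

  pow-mono : ∀ {i j} → i ≤ j → pow i ∣ℤ pow j
  pow-mono {i} {j} i≤j = ℤ∣.∣ᵤ⇒∣ (p^-mono-∣ p {i} {j} i≤j)

  prime∣*ℤ : ∀ a b → + p ∣ℤ a * b → + p ∣ℤ a ⊎ + p ∣ℤ b
  prime∣*ℤ a b p∣ab with euclidsLemma ℤ.∣ a ∣ ℤ.∣ b ∣ p-prime (subst (p ∣_) (ℤ.abs-* a b) (ℤ∣.∣⇒∣ᵤ p∣ab))
  ... | inj₁ p∣a = inj₁ (ℤ∣.∣ᵤ⇒∣ p∣a)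
  ... | inj₂ p∣b = inj₂ (ℤ∣.∣ᵤ⇒∣ p∣b)

  prime∤*ℤ : ∀ {a b} → ¬ (+ p ∣ℤ a) → ¬ (+ p ∣ℤ b) → ¬ (+ p ∣ℤ a * b)
  prime∤*ℤ {a} {b} p∤a p∤b = [ p∤a , p∤b ]′ ∘ prime∣*ℤ a b

  ∤⇒∤ℤ : ∀ {a} → p ∤ a → ¬ (+ p ∣ℤ + a)
  ∤⇒∤ℤ p∤a = p∤a ∘ ℤ∣.∣⇒∣ᵤ

  coherent-+ : ∀ (W : ℤₚ p) k j → pow k ∣ℤ approx W (j ℕ.+ k) - approx W k
  coherent-+ W k zero    = subst (pow k ∣ℤ_) (sym (ℤ.+-inverseʳ (approx W k))) (ℤ∣.divides 0ℤ refl)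
  coherent-+ W k (suc j) = subst (pow k ∣ℤ_) (eq (approx W (suc (j ℕ.+ k))) (approx W (j ℕ.+ k)) (approx W k))
    (ℤ∣.∣m∣n⇒∣m+n (ℤ∣.∣-trans (pow-mono {k} {j ℕ.+ k} (ℕ.m≤n+m k j)) (coherent W (j ℕ.+ k))) (coherent-+ W k j))
    where
    eq : ∀ a b c → (a - b) + (b - c) ≡ a - c
    eq = ℤSolver.solve-∀

  approx-∣ : ∀ (W : ℤₚ p) k j → pow k ∣ℤ approx W (j ℕ.+ k) → pow k ∣ℤ approx W k
  approx-∣ W k j p^k∣ = subst (pow k ∣ℤ_) (eq (approx W (j ℕ.+ k)) (approx W k)) (ℤ∣.∣m∣n⇒∣m-n p^k∣ (coherent-+ W k j))
    where
    eq : ∀ a b → a - (a - b) ≡ b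
    eq = ℤSolver.solve-∀

  -- If p^v is the exact power of p in c, divisibility at level v + k shows that p^k divides the
  -- approximation there, and coherence carries this down to level k.
  torsion-free : ∀ c → 0 < c → (W : ℤₚ p) → (∀ k → pow k ∣ℤ + c * approx W k) → Zero W
  torsion-free c 0<c W p^∣ k with valued v w (isVal refl p∤w) ← valuation p-prime c 0<c =
    approx-∣ W k v (ℤ∣.∣ᵤ⇒∣ (p^∣*ˡ p-prime k _ p∤w (subst (p ℕ.^ k ∣_) (ℤ.abs-* (+ w) Wᵥ₊ₖ) (ℤ∣.∣⇒∣ᵤ p^k∣wW))))
    where
    Wᵥ₊ₖ = approx W (v ℕ.+ k)
    lhs : pow (v ℕ.+ k) ≡ pow v * pow k
    lhs = trans (cong +_ (ℕ.^-distribˡ-+-* p v k)) (ℤ.pos-* (p ℕ.^ v) (p ℕ.^ k))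
    rhs : + (p ℕ.^ v ℕ.* w) * Wᵥ₊ₖ ≡ pow v * (+ w * Wᵥ₊ₖ)
    rhs = trans (cong (_* Wᵥ₊ₖ) (ℤ.pos-* (p ℕ.^ v) w)) (ℤ.*-assoc (pow v) (+ w) Wᵥ₊ₖ)
    p^k∣wW : pow k ∣ℤ + w * Wᵥ₊ₖ
    p^k∣wW = ℤ∣.*-cancelˡ-∣ (pow v) {{pow≢0 v}} (subst₂ _∣ℤ_ lhs rhs (p^∣ (v ℕ.+ k)))

  opaque

    -- Newton iteration for f(x) = a x² - c with the fixed slope 2 a r in place of 2 a x. By
    -- `taylor` the new value is f(x) times a multiple of p, so each step gains one power of p.
    hensel : ∀ a c r → Invertible p (+ 2 * a * r) → + p ∣ℤ a * (r * r) - c →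
             Σ (ℤₚ p) λ X → ∀ k → pow k ∣ℤ a * (approx X k * approx X k) - c
    hensel a c r (unit w 2arw≡1) p∣f = record { approx = x ; coherent = coh } ,
      λ k → ℤ∣.∣-trans (pow-mono {k} {suc k} (ℕ.n≤1+n k)) (proj₂ (proj₂ (newton k)))
      where
      f : ℤ → ℤ
      f x = a * (x * x) - c
      next : ℤ → ℤ
      next x = x - f x * w
      Approximation : ℕ → Set
      -- The starting value r is already a root modulo p; hence the shift by one in the exponent.
      Approximation k = Σ ℤ λ x → x ≡ r [mod p ] × pow (suc k) ∣ℤ f x
      newton : ∀ k → Approximation k
      newton zero    = r , mod-refl refl , subst (_∣ℤ f r) (sym pow-1) p∣f
      newton (suc k) with x , x≡r , p^k∣fx ← newton k = next x , next≡r , p^1+k∣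
        where
        p∣fx : + p ∣ℤ f x
        p∣fx = ℤ∣.∣-trans (subst (_∣ℤ pow (suc k)) pow-1 (pow-mono {1} {suc k} (s≤s z≤n))) p^k∣fx
        next≡r : next x ≡ r [mod p ]
        next≡r = mod-trans (mod (subst (+ p ∣ℤ_) (eq x (f x * w)) (ℤ∣.∣m⇒∣-m (ℤ∣.∣m⇒∣m*n w p∣fx)))) x≡r
          where
          eq : ∀ x y → - y ≡ x - y - x
          eq = ℤSolver.solve-∀
        p∣1-2axw : + p ∣ℤ 1ℤ - + 2 * a * x * w + a * (f x * (w * w))
        p∣1-2axw = ℤ∣.∣m∣n⇒∣m+n (divides (mod-sym (mod-trans (mod-*ʳ w (mod-*ˡ (+ 2 * a) x≡r)) 2arw≡1))) (ℤ∣.∣n⇒∣m*n a (ℤ∣.∣m⇒∣m*n (w * w) p∣fx))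
        taylor : ∀ a x c w → (1ℤ - + 2 * a * x * w + a * ((a * (x * x) - c) * (w * w))) * (a * (x * x) - c) ≡
                 a * ((x - (a * (x * x) - c) * w) * (x - (a * (x * x) - c) * w)) - c
        taylor = ℤSolver.solve-∀
        p^1+k∣ : pow (suc (suc k)) ∣ℤ f (next x)
        p^1+k∣ = subst₂ _∣ℤ_ (sym (pow-suc (suc k))) (taylor a x c w) (product-∣ p∣1-2axw p^k∣fx)
          where
          product-∣ : ∀ {d e m n} → d ∣ℤ m → e ∣ℤ n → d * e ∣ℤ m * n
          product-∣ {d} {e} {m} {n} d∣m e∣n = ℤ∣.∣-trans (ℤ∣.*-monoˡ-∣ e d∣m) (ℤ∣.*-monoʳ-∣ m e∣n)
      x : ℕ → ℤ
      x k = proj₁ (newton k)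
      coh : ∀ k → pow k ∣ℤ x (suc k) - x k
      coh k = subst (pow k ∣ℤ_) (eq (x k) (f (x k) * w)) (ℤ∣.∣m⇒∣-m (ℤ∣.∣m⇒∣m*n w (ℤ∣.∣-trans (pow-mono {k} {suc k} (ℕ.n≤1+n k)) (proj₂ (proj₂ (newton k))))))
        where
        eq : ∀ x y → - y ≡ x - y - x
        eq = ℤSolver.solve-∀

  module _ {A′ B C : ℕ} (p∤A′ : p ∤ A′) (p∤B : p ∤ B) (p∤C : p ∤ C)
           (nonsquare : ∀ r → ¬ (r * r ≡ - (+ B * + C) [mod p ])) where

    private
      A = A′ ℕ.* p

    -- If p did not divide Z, then (B Y / Z)² ≡ - B C modulo p, against `nonsquare`.
    binary-anisotropic : ∀ Y Z → + p ∣ℤ + B * (Y * Y) + + C * (Z * Z) → + p ∣ℤ Y × + p ∣ℤ Z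
    binary-anisotropic Y Z p∣ with (+ p) ℤ∣.∣? Z
    ... | yes p∣Z = [ (λ p∣B → contradiction p∣B (∤⇒∤ℤ p∤B)) , [ id , id ]′ ∘ prime∣*ℤ Y Y ]′ (prime∣*ℤ (+ B) (Y * Y)
      (ℤ∣.∣m+n∣n⇒∣m {m = + B * (Y * Y)} p∣ (ℤ∣.∣n⇒∣m*n (+ C) (ℤ∣.∣m⇒∣m*n Z p∣Z)))) , p∣Z
    ... | no p∤Z with unit w Zw≡1 ← prime∤⇒invertible p-prime Z p∤Z = contradiction
      (mod-trans (mod {a = + B * Y * w * (+ B * Y * w)} {b = - (+ B * + C) * (Z * w * (Z * w))}
        (subst (+ p ∣ℤ_) (eq (+ B) (+ C) Y Z w) (ℤ∣.∣n⇒∣m*n (+ B * (w * w)) p∣)))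
        (mod-trans (mod-*ˡ (- (+ B * + C)) (mod-* Zw≡1 Zw≡1)) (mod-refl (ℤ.*-identityʳ _))))
      (nonsquare (+ B * Y * w))
      where
      eq : ∀ b c y z w → b * (w * w) * (b * (y * y) + c * (z * z)) ≡ b * y * w * (b * y * w) - - (b * c) * (z * w * (z * w))
      eq = ℤSolver.solve-∀

    -- Modulo p only B Y² + C Z² is left, so p divides Y and Z. Modulo p² only p A′ X² is then left,
    -- so p divides X.
    divide : ∀ X Y Z → + p * + p ∣ℤ form (+ A) (+ B) (+ C) X Y Z → + p ∣ℤ X × + p ∣ℤ Y × + p ∣ℤ Z
    divide X Y Z p²∣ = p∣X , p∣Y , p∣Z
      where
      A≡ : + A ≡ + A′ * + p
      A≡ = ℤ.pos-* A′ p
      regroup : ∀ a b c → a + b + c ≡ a + (b + c)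
      regroup = ℤSolver.solve-∀
      p²∣AX²+ : + p * + p ∣ℤ + A * (X * X) + (+ B * (Y * Y) + + C * (Z * Z))
      p²∣AX²+ = subst (+ p * + p ∣ℤ_) (regroup (+ A * (X * X)) (+ B * (Y * Y)) (+ C * (Z * Z))) p²∣
      p∣A : + p ∣ℤ + A
      p∣A = ℤ∣.divides (+ A′) A≡
      p∣YZ : + p ∣ℤ Y × + p ∣ℤ Z
      p∣YZ = binary-anisotropic Y Z (ℤ∣.∣m+n∣m⇒∣n {m = + A * (X * X)} (ℤ∣.∣-trans (ℤ∣.∣m⇒∣m*n (+ p) ℤ∣.∣-refl) p²∣AX²+) (ℤ∣.∣m⇒∣m*n (X * X) p∣A))
      p∣Y = proj₁ p∣YZ
      p∣Z = proj₂ p∣YZ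
      square-∣ : ∀ {W} → + p ∣ℤ W → + p * + p ∣ℤ W * W
      square-∣ (ℤ∣.divides q refl) = ℤ∣.divides (q * q) (eq q (+ p))
        where
        eq : ∀ q p → q * p * (q * p) ≡ q * q * (p * p)
        eq = ℤSolver.solve-∀
      p²∣AX² : + p * + p ∣ℤ + p * (+ A′ * (X * X))
      p²∣AX² = subst (+ p * + p ∣ℤ_) (trans (cong (_* (X * X)) A≡) (eq (+ A′) (+ p) (X * X)))
        (ℤ∣.∣m+n∣n⇒∣m {m = + A * (X * X)} p²∣AX²+ (ℤ∣.∣m∣n⇒∣m+n (ℤ∣.∣n⇒∣m*n (+ B) (square-∣ p∣Y)) (ℤ∣.∣n⇒∣m*n (+ C) (square-∣ p∣Z))))
        where
        eq : ∀ a p x → a * p * x ≡ p * (a * x)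
        eq = ℤSolver.solve-∀
      p∣X : + p ∣ℤ X
      p∣X = [ (λ p∣A′ → contradiction p∣A′ (∤⇒∤ℤ p∤A′)) , [ id , id ]′ ∘ prime∣*ℤ X X ]′ (prime∣*ℤ (+ A′) (X * X)
        (ℤ∣.*-cancelˡ-∣ (+ p) {{prime⇒nonZero p-prime}} p²∣AX²))

    -- Infinite descent cut off at a finite level, as it is applied to approximations: each round
    -- takes p² from the form and p from every variable.
    descent : ∀ j X Y Z → pow (j ℕ.+ j) ∣ℤ form (+ A) (+ B) (+ C) X Y Z → pow j ∣ℤ X × pow j ∣ℤ Y × pow j ∣ℤ Z
    descent zero    X Y Z _ = 1∣ X , 1∣ Y , 1∣ Z
      where
      1∣ : ∀ W → 1ℤ ∣ℤ W
      1∣ W = ℤ∣.divides W (sym (ℤ.*-identityʳ W))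
    descent (suc j) X Y Z p^∣ = step (divide X Y Z (ℤ∣.∣-trans (ℤ∣.∣m⇒∣m*n (pow (j ℕ.+ j)) ℤ∣.∣-refl) p²p^∣))
      where
      p²p^∣ : + p * + p * pow (j ℕ.+ j) ∣ℤ form (+ A) (+ B) (+ C) X Y Z
      p²p^∣ = subst (_∣ℤ form (+ A) (+ B) (+ C) X Y Z) (trans (cong (λ i → pow (suc i)) (ℕ.+-suc j j)) (trans (pow-suc (suc (j ℕ.+ j)))
        (trans (cong (+ p *_) (pow-suc (j ℕ.+ j))) (sym (ℤ.*-assoc (+ p) (+ p) _))))) p^∣
      eq : ∀ a b c x y z p → a * (x * p * (x * p)) + b * (y * p * (y * p)) + c * (z * p * (z * p)) ≡ p * p * (a * (x * x) + b * (y * y) + c * (z * z))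
      eq = ℤSolver.solve-∀
      multiply : ∀ W → pow j ∣ℤ W → pow (suc j) ∣ℤ W * + p
      multiply W p^j∣W = subst (_∣ℤ W * + p) (trans (ℤ.*-comm (pow j) (+ p)) (sym (pow-suc j))) (ℤ∣.*-monoˡ-∣ (+ p) p^j∣W)
      step : + p ∣ℤ X × + p ∣ℤ Y × + p ∣ℤ Z → pow (suc j) ∣ℤ X × pow (suc j) ∣ℤ Y × pow (suc j) ∣ℤ Z
      step (ℤ∣.divides x refl , ℤ∣.divides y refl , ℤ∣.divides z refl)
        = multiply x (proj₁ IH) , multiply y (proj₁ (proj₂ IH)) , multiply z (proj₂ (proj₂ IH))
        where
        instance
          p*p≢0 : ℤ.NonZero (+ p * + p)
          p*p≢0 = ℤ.i*j≢0 (+ p) (+ p) {{prime⇒nonZero p-prime}} {{prime⇒nonZero p-prime}}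
        IH : pow j ∣ℤ x × pow j ∣ℤ y × pow j ∣ℤ z
        IH = descent j x y z (ℤ∣.*-cancelˡ-∣ (+ p * + p)
          (subst (+ p * + p * pow (j ℕ.+ j) ∣ℤ_) (eq (+ A) (+ B) (+ C) x y z (+ p)) p²p^∣))

    scaled-anisotropic : ∀ {u₁ u₂ u₃} → Scaled u₁ u₂ u₃ A B C → Anisotropic p u₁ u₂ u₃
    scaled-anisotropic s@(scaled k x y z 0<k 0<x 0<y 0<z eq₁ eq₂ eq₃) X Y Z (vanishing v) =
      torsion-free x 0<x X (λ j → approx-∣ (fromℤ (+ x) *ᶻ X) j j (proj₁ (zeros j))) ,
      torsion-free y 0<y Y (λ j → approx-∣ (fromℤ (+ y) *ᶻ Y) j j (proj₁ (proj₂ (zeros j)))) ,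
      torsion-free z 0<z Z (λ j → approx-∣ (fromℤ (+ z) *ᶻ Z) j j (proj₂ (proj₂ (zeros j))))
      where
      zeros : ∀ j → pow j ∣ℤ + x * approx X (j ℕ.+ j) × pow j ∣ℤ + y * approx Y (j ℕ.+ j) × pow j ∣ℤ + z * approx Z (j ℕ.+ j)
      -- The approximations at level 2j are used, because `descent` halves the exponent.
      zeros j = descent j _ _ _ (subst (pow (j ℕ.+ j) ∣ℤ_) (scaled-form s Xⱼ Yⱼ Zⱼ) (ℤ∣.∣n⇒∣m*n (+ k) (v (j ℕ.+ j))))
        where
        Xⱼ = approx X (j ℕ.+ j)
        Yⱼ = approx Y (j ℕ.+ j)
        Zⱼ = approx Z (j ℕ.+ j)

  -- The zero is (X / x, Y / y, Z / z), multiplied by x y z to remain in ℤₚ; the factor k of the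
  -- form is cancelled by `torsion-free`.
  scaled-isotropic : ∀ {u₁ u₂ u₃ A B C} → Scaled u₁ u₂ u₃ A B C → Isotropic p A B C → Isotropic p u₁ u₂ u₃
  scaled-isotropic {u₁} {u₂} {u₃} {A} {B} {C} s@(scaled k x y z 0<k 0<x 0<y 0<z _ _ _) (isotropic X Y Z nontrivial (vanishing v)) =
    isotropic X′ Y′ Z′
      (λ (X′≈0 , Y′≈0 , Z′≈0) → nontrivial (torsion-free (y ℕ.* z) (0<* 0<y 0<z) X X′≈0 ,
        torsion-free (x ℕ.* z) (0<* 0<x 0<z) Y Y′≈0 , torsion-free (x ℕ.* y) (0<* 0<x 0<y) Z Z′≈0))
      (vanishing (torsion-free k 0<k F λ i → subst (pow i ∣ℤ_) (sym (trans (scaled-form s (approx X′ i) (approx Y′ i) (approx Z′ i))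
        (scale (approx X i) (approx Y i) (approx Z i)))) (ℤ∣.∣n⇒∣m*n (+ x * + y * + z * (+ x * + y * + z)) (v i))))
    where
    X′ = fromℤ (+ (y ℕ.* z)) *ᶻ X
    Y′ = fromℤ (+ (x ℕ.* z)) *ᶻ Y
    Z′ = fromℤ (+ (x ℕ.* y)) *ᶻ Z
    F : ℤₚ p
    F = fromℤ (+ u₁) *ᶻ (X′ *ᶻ X′) +ᶻ fromℤ (+ u₂) *ᶻ (Y′ *ᶻ Y′) +ᶻ fromℤ (+ u₃) *ᶻ (Z′ *ᶻ Z′)
    eq : ∀ a b c x y z X Y Z →
      a * (x * (y * z * X) * (x * (y * z * X))) + b * (y * (x * z * Y) * (y * (x * z * Y))) + c * (z * (x * y * Z) * (z * (x * y * Z))) ≡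
      x * y * z * (x * y * z) * (a * (X * X) + b * (Y * Y) + c * (Z * Z))
    eq = ℤSolver.solve-∀
    scale : ∀ X Y Z → form (+ A) (+ B) (+ C) (+ x * (+ (y ℕ.* z) * X)) (+ y * (+ (x ℕ.* z) * Y)) (+ z * (+ (x ℕ.* y) * Z)) ≡
            + x * + y * + z * (+ x * + y * + z) * form (+ A) (+ B) (+ C) X Y Z
    scale X Y Z = begin
      G (+ (y ℕ.* z)) (+ (x ℕ.* z)) (+ (x ℕ.* y))  ≡⟨ cong (λ a → G a (+ (x ℕ.* z)) (+ (x ℕ.* y))) (ℤ.pos-* y z) ⟩
      G (+ y * + z) (+ (x ℕ.* z)) (+ (x ℕ.* y))    ≡⟨ cong₂ (G (+ y * + z)) (ℤ.pos-* x z) (ℤ.pos-* x y) ⟩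
      G (+ y * + z) (+ x * + z) (+ x * + y)        ≡⟨ eq (+ A) (+ B) (+ C) (+ x) (+ y) (+ z) X Y Z ⟩
      + x * + y * + z * (+ x * + y * + z) * form (+ A) (+ B) (+ C) X Y Z ∎
      where
      open ≡-Reasoning
      G : ℤ → ℤ → ℤ → ℤ
      G a b c = form (+ A) (+ B) (+ C) (+ x * (a * X)) (+ y * (b * Y)) (+ z * (c * Z))

  Zero-const : ∀ c → Zero {p} (fromℤ c) → + p ∣ℤ c
  Zero-const c c≈0 = subst (_∣ℤ c) pow-1 (c≈0 1)

-- 0 = -BC·C² + C·(CZ)² for a square root Z of -B/C.
-BC-square⇒isotropic : ∀ h {A B C} → Prime (odd h) → odd h ∤ B → odd h ∤ C →
                       ∀ r → r * r ≡ - (+ B * + C) [mod odd h ] → Isotropic (odd h) A B C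
-BC-square⇒isotropic h {A} {B} {C} p-prime p∤B p∤C r r²≡ =
  isotropic (fromℤ 0ℤ) (fromℤ (+ C)) Z (λ (_ , C≈0 , _) → ∤⇒∤ℤ p-prime p∤C (Zero-const p-prime (+ C) C≈0))
    (vanishing λ k → subst (+ (p ℕ.^ k) ∣ℤ_) (eq₂ (+ A) (+ B) (+ C) (approx Z k)) (CZ²≈ k))
  where
  p = odd h
  C-inv = prime∤⇒invertible p-prime (+ C) (∤⇒∤ℤ p-prime p∤C)
  p∤r : ¬ (+ p ∣ℤ r)
  p∤r p∣r = prime∤*ℤ p-prime (∤⇒∤ℤ p-prime p∤B) (∤⇒∤ℤ p-prime p∤C) (subst (+ p ∣ℤ_) (ℤ.neg-involutive (+ B * + C))
    (ℤ∣.∣m⇒∣-m (mod-0⇒∣ (mod-trans (mod-sym r²≡) (∣⇒mod-0 (ℤ∣.∣m⇒∣m*n r p∣r))))))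
  eq₁ : ∀ b c r → c * (r * r - - (b * c)) ≡ c * (r * r) - - (b * (c * c))
  eq₁ = ℤSolver.solve-∀
  eq₂ : ∀ a b c z → c * (z * z) - - (b * (c * c)) ≡ a * (0ℤ * 0ℤ) + b * (c * c) + c * (z * z)
  eq₂ = ℤSolver.solve-∀
  root = hensel p-prime (+ C) (- (+ B * (+ C * + C))) r
    (invertible-* (invertible-* (2-invertible h) C-inv) (prime∤⇒invertible p-prime r p∤r))
    (subst (+ p ∣ℤ_) (eq₁ (+ B) (+ C) r) (ℤ∣.∣n⇒∣m*n (+ C) (divides r²≡)))
  Z = proj₁ root
  CZ²≈ = proj₂ root

-- Local symbols at an odd prime

jacobi-1 : ∀ h → jacobi 1ℤ h ≡ Sign.+
jacobi-1 h = jacobi-² h {1ℤ} (unit 1ℤ (mod-refl refl))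

module _ (h : ℕ) (p-prime : Prime (odd h)) where

  private
    p = odd h

    inv : ∀ {a} → p ∤ a → Invertible p (+ a)
    inv {a} p∤a = prime∤⇒invertible p-prime (+ a) (∤⇒∤ℤ p-prime p∤a)

    root-unit : ∀ {a r} → Invertible p a → r * r ≡ a [mod p ] → Invertible p r
    root-unit {a} {r} (unit w aw≡1) r²≡a = unit (r * w) (mod-trans (mod-refl (sym (ℤ.*-assoc r r w))) (mod-trans (mod-*ʳ w r²≡a) aw≡1))

    1≤h : 1 ≤ h
    1≤h = ℕ.n≢0⇒n>0 λ { refl → ¬prime[1] p-prime }

  -- Going down from the non-residue m + 1 one reaches the residue 1 at the latest, so somewhere a
  -- residue is followed by a non-residue.
  residue-nonresidue : ∀ m → m < p → jacobi (+ suc m) h ≡ Sign.- →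
                       ∃[ j ] 0 < j × j ≤ m × jacobi (+ j) h ≡ Sign.+ × jacobi (+ suc j) h ≡ Sign.-
  residue-nonresidue zero    _   1≡- = contradiction (trans (sym (jacobi-1 h)) 1≡-) λ ()
  residue-nonresidue (suc m) m<p eq = by-sign (jacobi (+ suc m) h) refl
    where
    by-sign : ∀ σ → jacobi (+ suc m) h ≡ σ → ∃[ j ] 0 < j × j ≤ suc m × jacobi (+ j) h ≡ Sign.+ × jacobi (+ suc j) h ≡ Sign.-
    by-sign Sign.+ m≡+ = suc m , s≤s z≤n , ℕ.≤-refl , m≡+ , eq
    by-sign Sign.- m≡- = let j , 0<j , j≤m , j≡+ , j+1≡- = residue-nonresidue m (ℕ.<-trans (ℕ.n<1+n m) m<p) m≡- in
      j , 0<j , ℕ.m≤n⇒m≤1+n j≤m , j≡+ , j+1≡-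

  -- If j is a square and j + 1 is not then -(j + 1) is a square.
  1+t²+w²≡0 : jacobi -1ℤ h ≡ Sign.- → Σ ℤ λ t → Σ ℤ λ w → Invertible p t × t * t + w * w + 1ℤ ≡ 0ℤ [mod p ]
  1+t²+w²≡0 -1≡- = from-j (residue-nonresidue q (s≤s ℕ.pred[n]≤n) (trans (jacobi-cong h p-1≡-1) -1≡-))
    where
    instance
      2h≢0 : NonZero (h ℕ.+ h)
      2h≢0 = ℕ.>-nonZero (ℕ.≤-trans 1≤h (ℕ.m≤m+n h h))
    -- 1 + q = p - 1 ≡ -1 is the non-residue from which the search goes down.
    q = ℕ.pred (h ℕ.+ h)
    suc-q : suc q ≡ h ℕ.+ h
    suc-q = ℕ.suc-pred (h ℕ.+ h)
    eq₁ : ∀ x → x - -1ℤ ≡ 1ℤ * (1ℤ + x)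
    eq₁ = ℤSolver.solve-∀
    eq₂ : ∀ j → j + - (1ℤ + j) + 1ℤ ≡ 0ℤ
    eq₂ = ℤSolver.solve-∀
    p-1≡-1 : + suc q ≡ -1ℤ [mod p ]
    p-1≡-1 = mod-trans (mod-refl (cong +_ suc-q)) (mod (ℤ∣.divides 1ℤ (trans (eq₁ (+ (h ℕ.+ h))) (cong (1ℤ *_) (sym (ℤ.pos-+ 1 (h ℕ.+ h)))))))
    from-roots : ∀ {j} → Invertible p (+ j) → Σ ℤ (λ t → t * t ≡ + j [mod p ]) → Σ ℤ (λ w → w * w ≡ - (+ suc j) [mod p ]) →
                 Σ ℤ λ t → Σ ℤ λ w → Invertible p t × t * t + w * w + 1ℤ ≡ 0ℤ [mod p ]
    from-roots {j} j-inv (t , t²≡j) (w , w²≡) = t , w , root-unit j-inv t²≡j ,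
      mod-trans (mod-+ (mod-+ t²≡j w²≡) (mod-refl refl)) (mod-refl (trans (cong (λ x → + j + - x + 1ℤ) (ℤ.pos-+ 1 j)) (eq₂ (+ j))))
    from-j : ∃[ j ] 0 < j × j ≤ q × jacobi (+ j) h ≡ Sign.+ × jacobi (+ suc j) h ≡ Sign.- →
             Σ ℤ λ t → Σ ℤ λ w → Invertible p t × t * t + w * w + 1ℤ ≡ 0ℤ [mod p ]
    from-j (j , 0<j , j≤q , j≡+ , j+1≡-) = from-roots j-inv (jacobi≡+⇒square h p-prime j-inv j≡+)
      (jacobi≡+⇒square h p-prime (invertible-neg j+1-inv) -[j+1]≡+)
      where
      j+1≤2h : suc j ≤ h ℕ.+ h
      j+1≤2h = ℕ.≤-trans (s≤s j≤q) (ℕ.≤-reflexive suc-q)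
      j-inv : Invertible p (+ j)
      j-inv = inv (ℕ.>⇒∤ {{ℕ.>-nonZero 0<j}} (s≤s (ℕ.<⇒≤ j+1≤2h)))
      j+1-inv : Invertible p (+ suc j)
      j+1-inv = inv (ℕ.>⇒∤ (s≤s j+1≤2h))
      -[j+1]≡+ : jacobi (- (+ suc j)) h ≡ Sign.+
      -[j+1]≡+ = trans (cong (λ x → jacobi x h) (sym (ℤ.-1*i≡-i (+ suc j)))) (trans (jacobi-* h neg1-invertible j+1-inv) (cong₂ Sign._*_ -1≡- j+1≡-))

  jacobi-neg-* : ∀ {a b} → p ∤ a → p ∤ b → jacobi (- (+ a * + b)) h ≡ jacobi -1ℤ h Sign.* (jacobi (+ a) h Sign.* jacobi (+ b) h)
  jacobi-neg-* {a} {b} p∤a p∤b = trans (cong (λ z → jacobi z h) (sym (ℤ.-1*i≡-i (+ a * + b))))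
    (trans (jacobi-* h neg1-invertible (invertible-* (inv p∤a) (inv p∤b))) (cong (jacobi -1ℤ h Sign.*_) (jacobi-* h (inv p∤a) (inv p∤b))))

  neg-*-inv : ∀ {a b} → p ∤ a → p ∤ b → Invertible p (- (+ a * + b))
  neg-*-inv p∤a p∤b = invertible-neg (invertible-* (inv p∤a) (inv p∤b))

  jacobi≡+⇒isotropic : ∀ {A B C} → p ∤ B → p ∤ C → jacobi (- (+ B * + C)) h ≡ Sign.+ → Isotropic p A B C
  jacobi≡+⇒isotropic p∤B p∤C eq = let r , r²≡ = jacobi≡+⇒square h p-prime (neg-*-inv p∤B p∤C) eq in
    -BC-square⇒isotropic h p-prime p∤B p∤C r r²≡

  -- If -BC, -AC and -AB are all non-squares, then -1 is a non-square while AC = s² and BC = r² are squares;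
  -- multiplied by C the form becomes (sX)² + (rY)² + (CZ)².
  module _ {A B C : ℕ} (p∤A : p ∤ A) (p∤B : p ∤ B) (p∤C : p ∤ C) where

    private
      signs : ∀ e a b c → e Sign.* (b Sign.* c) ≡ Sign.- → e Sign.* (a Sign.* c) ≡ Sign.- → e Sign.* (a Sign.* b) ≡ Sign.- →
              e ≡ Sign.- × a Sign.* c ≡ Sign.+ × b Sign.* c ≡ Sign.+
      signs Sign.- Sign.+ Sign.+ Sign.+ _ _ _ = refl , refl , refl
      signs Sign.- Sign.- Sign.- Sign.- _ _ _ = refl , refl , refl
      signs Sign.+ Sign.+ Sign.+ _      _ _ ()
      signs Sign.+ Sign.- Sign.- _      _ _ ()
      signs Sign.+ Sign.+ Sign.- Sign.+ _ () _
      signs Sign.+ Sign.+ Sign.- Sign.- () _ _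
      signs Sign.+ Sign.- Sign.+ Sign.+ () _ _
      signs Sign.+ Sign.- Sign.+ Sign.- _ () _
      signs Sign.- Sign.+ Sign.- _      _ _ ()
      signs Sign.- Sign.- Sign.+ _      _ _ ()
      signs Sign.- Sign.+ Sign.+ Sign.- () _ _
      signs Sign.- Sign.- Sign.- Sign.+ () _ _

      eq₁ : ∀ a b c r s t w → c * (c * (s * r * (s * r)) - - (a * (t * r * c * (t * r * c)) + b * (w * s * c * (w * s * c)))) ≡
            a * c * (t * r * c * (t * r * c)) + b * c * (w * s * c * (w * s * c)) + c * (s * r) * (c * (s * r))
      eq₁ = ℤSolver.solve-∀
      eq₂ : ∀ c r s t w → s * s * (t * r * c * (t * r * c)) + r * r * (w * s * c * (w * s * c)) + c * (s * r) * (c * (s * r)) ≡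
            c * s * r * (c * s * r) * (t * t + w * w + 1ℤ)
      eq₂ = ℤSolver.solve-∀
      arrange : ∀ a b c → c - - (a + b) ≡ a + b + c
      arrange = ℤSolver.solve-∀

    roots⇒isotropic : ∀ r s t w → r * r ≡ + B * + C [mod p ] → s * s ≡ + A * + C [mod p ] → Invertible p t →
                      t * t + w * w + 1ℤ ≡ 0ℤ [mod p ] → Isotropic p A B C
    roots⇒isotropic r s t w r²≡BC s²≡AC t-inv t²+w²+1≡0 = isotropic (fromℤ X) (fromℤ Y) (proj₁ root)
      (λ (X≈0 , _ , _) → ∤-half-system h {1} (s≤s z≤n , 1≤h) (invertible-cancel 1ℤ X-inv (ℤ∣.∣m⇒∣m*n 1ℤ (Zero-const p-prime X X≈0))))
      (vanishing λ k → subst (+ (p ℕ.^ k) ∣ℤ_) (arrange (+ A * (X * X)) (+ B * (Y * Y)) (+ C * (approx (proj₁ root) k * approx (proj₁ root) k))) (proj₂ root k))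
      where
      X Y Z₀ : ℤ
      -- Chosen so that s X, r Y and C Z₀ are C s r times t, w and 1. Hence C times the form is
      -- congruent to (C s r)² (t² + w² + 1) ≡ 0, and the last coordinate can be lifted.
      X  = t * r * + C
      Y  = w * s * + C
      Z₀ = s * r
      r-inv : Invertible p r
      r-inv = root-unit (invertible-* (inv p∤B) (inv p∤C)) r²≡BC
      s-inv : Invertible p s
      s-inv = root-unit (invertible-* (inv p∤A) (inv p∤C)) s²≡AC
      X-inv : Invertible p X
      X-inv = invertible-* (invertible-* t-inv r-inv) (inv p∤C)
      approximate : + p ∣ℤ + C * (Z₀ * Z₀) - - (+ A * (X * X) + + B * (Y * Y))
      approximate = invertible-cancel _ (inv p∤C) (mod-0⇒∣ (mod-trans (mod-refl (eq₁ (+ A) (+ B) (+ C) r s t w))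
        (mod-trans (mod-+ (mod-+ (mod-*ʳ (X * X) (mod-sym s²≡AC)) (mod-*ʳ (Y * Y) (mod-sym r²≡BC))) (mod-refl refl))
        (mod-trans (mod-refl (eq₂ (+ C) r s t w)) (mod-trans (mod-*ˡ (+ C * s * r * (+ C * s * r)) t²+w²+1≡0) (mod-refl (ℤ.*-zeroʳ (+ C * s * r * (+ C * s * r)))))))))
      root : Σ (ℤₚ p) λ Z → ∀ k → + (p ℕ.^ k) ∣ℤ + C * (approx Z k * approx Z k) - - (+ A * (X * X) + + B * (Y * Y))
      root = hensel p-prime (+ C) (- (+ A * (X * X) + + B * (Y * Y))) Z₀
        (invertible-* (invertible-* (2-invertible h) (inv p∤C)) (invertible-* s-inv r-inv)) approximate

    unit-isotropic : Isotropic p A B C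
    unit-isotropic = by-signs (jacobi (- (+ B * + C)) h) (jacobi (- (+ A * + C)) h) (jacobi (- (+ A * + B)) h) refl refl refl
      where
      combine : Σ ℤ (λ r → r * r ≡ + B * + C [mod p ]) → Σ ℤ (λ s → s * s ≡ + A * + C [mod p ]) →
                Σ ℤ (λ t → Σ ℤ λ w → Invertible p t × t * t + w * w + 1ℤ ≡ 0ℤ [mod p ]) → Isotropic p A B C
      combine (r , r²) (s , s²) (t , w , t-inv , eq) = roots⇒isotropic r s t w r² s² t-inv eq
      conclude : jacobi -1ℤ h ≡ Sign.- × jacobi (+ A) h Sign.* jacobi (+ C) h ≡ Sign.+ × jacobi (+ B) h Sign.* jacobi (+ C) h ≡ Sign.+ → Isotropic p A B C
      conclude (-1≡- , AC≡+ , BC≡+) = combine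
        (jacobi≡+⇒square h p-prime (invertible-* (inv p∤B) (inv p∤C)) (trans (jacobi-* h (inv p∤B) (inv p∤C)) BC≡+))
        (jacobi≡+⇒square h p-prime (invertible-* (inv p∤A) (inv p∤C)) (trans (jacobi-* h (inv p∤A) (inv p∤C)) AC≡+))
        (1+t²+w²≡0 -1≡-)
      by-signs : ∀ x y z → jacobi (- (+ B * + C)) h ≡ x → jacobi (- (+ A * + C)) h ≡ y → jacobi (- (+ A * + B)) h ≡ z → Isotropic p A B C
      by-signs Sign.+ _ _ bc _ _ = jacobi≡+⇒isotropic p∤B p∤C bc
      by-signs Sign.- Sign.+ _ _ ac _ = isotropic-swap₁₂ (jacobi≡+⇒isotropic p∤A p∤C ac)
      by-signs Sign.- Sign.- Sign.+ _ _ ab = isotropic-swap₂₃ (isotropic-swap₁₂ (jacobi≡+⇒isotropic p∤A p∤B ab))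
      by-signs Sign.- Sign.- Sign.- bc ac ab = conclude (signs (jacobi -1ℤ h) (jacobi (+ A) h) (jacobi (+ B) h) (jacobi (+ C) h)
        (trans (sym (jacobi-neg-* p∤B p∤C)) bc) (trans (sym (jacobi-neg-* p∤A p∤C)) ac) (trans (sym (jacobi-neg-* p∤A p∤B)) ab))

  localSymbol-unit : ∀ {u₁ u₂ u₃ A B C} → Scaled u₁ u₂ u₃ A B C → p ∤ A → p ∤ B → p ∤ C → LocalSymbol p u₁ u₂ u₃ Sign.+
  localSymbol-unit s p∤A p∤B p∤C = iso (scaled-isotropic p-prime s (unit-isotropic p∤A p∤B p∤C))

  localSymbol-∣ : ∀ {u₁ u₂ u₃ A B C} → Reduced A B C → Scaled u₁ u₂ u₃ A B C → p ∣ A → LocalSymbol p u₁ u₂ u₃ (jacobi (- (+ B * + C)) h)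
  localSymbol-∣ {A = A} {B} {C} r s p∣A with A′ , refl , p∤A′ ← squarefree-valuation p-prime (Reduced.A-squarefree r) p∣A =
    by-sign (jacobi (- (+ B * + C)) h) refl
    where
    p∤B = coprime⇒∤ p-prime (Reduced.A⊥B r) p∣A
    p∤C = coprime⇒∤ p-prime (Reduced.A⊥C r) p∣A
    by-sign : ∀ σ → jacobi (- (+ B * + C)) h ≡ σ → LocalSymbol p _ _ _ σ
    by-sign Sign.+ eq = iso (scaled-isotropic p-prime s (jacobi≡+⇒isotropic p∤B p∤C eq))
    by-sign Sign.- eq = aniso (scaled-anisotropic p-prime p∤A′ p∤B p∤C (jacobi≡-⇒nonsquare h p-prime (neg-*-inv p∤B p∤C) eq) s)

  -- By `-BC-square` the class of -BC is a quotient of squares. This is what allows the odd primes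
  -- of A outside n to be inserted into the product over p ∣ n.
  jacobi≡+-∤n : ∀ {n u₁ u₂ u₃ A B C} → p ∤ n → 0 < u₁ → 0 < u₂ → 0 < u₃ → ErdősStraus n u₁ u₂ u₃ →
                Reduced A B C → Scaled u₁ u₂ u₃ A B C → p ∣ A → jacobi (- (+ B * + C)) h ≡ Sign.+
  jacobi≡+-∤n {B = B} {C} p∤n 0<u₁ 0<u₂ 0<u₃ es red s p∣A
    with r , t , p∤r , p∤t , p∣ ← -BC-square p-prime p∤n 0<u₁ 0<u₂ 0<u₃ es red s p∣A = begin
      jacobi (- (+ B * + C)) h                       ≡⟨ sym (Sign.*-identityʳ _) ⟩
      jacobi (- (+ B * + C)) h Sign.* Sign.+         ≡⟨ cong (jacobi (- (+ B * + C)) h Sign.*_) (sym (jacobi-² h (inv p∤t))) ⟩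
      jacobi (- (+ B * + C)) h Sign.* jacobi (+ t * + t) h  ≡⟨ sym (jacobi-* h (neg-*-inv p∤B p∤C) (invertible-* (inv p∤t) (inv p∤t))) ⟩
      jacobi (- (+ B * + C) * (+ t * + t)) h         ≡⟨ jacobi-cong h (mod-sym (mod (subst (+ p ∣ℤ_) (eq r t) (ℤ∣.∣ᵤ⇒∣ {+ p} {+ (r ℕ.* r ℕ.+ B ℕ.* C ℕ.* (t ℕ.* t))} p∣)))) ⟩
      jacobi (+ r * + r) h                           ≡⟨ jacobi-² h (inv p∤r) ⟩
      Sign.+                                         ∎
    where
    open ≡-Reasoning
    p∤B = coprime⇒∤ p-prime (Reduced.A⊥B red) p∣A
    p∤C = coprime⇒∤ p-prime (Reduced.A⊥C red) p∣A
    eq′ : ∀ r b c t → r * r + b * c * (t * t) ≡ r * r - - (b * c) * (t * t)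
    eq′ = ℤSolver.solve-∀
    eq : ∀ r t → + (r ℕ.* r ℕ.+ B ℕ.* C ℕ.* (t ℕ.* t)) ≡ + r * + r - - (+ B * + C) * (+ t * + t)
    eq r t = trans (trans (ℤ.pos-+ (r ℕ.* r) _) (cong₂ _+_ (ℤ.pos-* r r) (trans (ℤ.pos-* (B ℕ.* C) (t ℕ.* t)) (cong₂ _*_ (ℤ.pos-* B C) (ℤ.pos-* t t)))))
      (eq′ (+ r) (+ B) (+ C) (+ t))

-- The product over the primes dividing n

∏ᴸ : List ℕ → (ℕ → Sign) → Sign
∏ᴸ ps f = List.foldr Sign._*_ Sign.+ (List.map f ps)

∏ᴸ-cong : ∀ {P : ℕ → Set} {ps f g} → All P ps → (∀ p → P p → f p ≡ g p) → ∏ᴸ ps f ≡ ∏ᴸ ps g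
∏ᴸ-cong []         f≗g = refl
∏ᴸ-cong (px ∷ pxs) f≗g = cong₂ Sign._*_ (f≗g _ px) (∏ᴸ-cong pxs f≗g)

∏ᴸ-+ : ∀ ps → ∏ᴸ ps (λ _ → Sign.+) ≡ Sign.+
∏ᴸ-+ []       = refl
∏ᴸ-+ (p ∷ ps) = ∏ᴸ-+ ps

∏ᴸ-distrib-* : ∀ ps f g → ∏ᴸ ps (λ p → f p Sign.* g p) ≡ ∏ᴸ ps f Sign.* ∏ᴸ ps g
∏ᴸ-distrib-* []       f g = refl
∏ᴸ-distrib-* (p ∷ ps) f g = trans (cong (f p Sign.* g p Sign.*_) (∏ᴸ-distrib-* ps f g)) (exchange (f p) (g p) _ _)

∏ᴸ-single-∉ : ∀ ps (f : ℕ → Sign) q → All (_≢ q) ps → ∏ᴸ ps (λ p → when (p ℕ.≟ q) (f p)) ≡ Sign.+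
∏ᴸ-single-∉ ps f q ps≢q = trans (∏ᴸ-cong ps≢q (λ p p≢q → when-no (p ℕ.≟ q) {f p} p≢q)) (∏ᴸ-+ ps)

∏ᴸ-single : ∀ ps (f : ℕ → Sign) q → Unique ps → q ∈ᴸ ps → ∏ᴸ ps (λ p → when (p ℕ.≟ q) (f p)) ≡ f q
∏ᴸ-single (p ∷ ps) f q (p∉ps ∷ _) (here refl) = trans (cong₂ Sign._*_ (when-yes (p ℕ.≟ p) {f p} refl)
  (∏ᴸ-single-∉ ps f p (All.map (λ p≢r r≡p → p≢r (sym r≡p)) p∉ps))) (Sign.*-identityʳ (f p))
∏ᴸ-single (p ∷ ps) f q (p∉ps ∷ ps-unique) (there q∈ps) = trans
  (cong₂ Sign._*_ (when-no (p ℕ.≟ q) {f p} (All.lookup p∉ps q∈ps)) (∏ᴸ-single ps f q ps-unique q∈ps)) refl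

⌊odd/2⌋ : ∀ h → ℕ.⌊ odd h /2⌋ ≡ h
⌊odd/2⌋ h = sym (ℕ.n≡⌈n+n/2⌉ h)

-- The Legendre symbol (c / p) if p is an odd prime; junk at p = 2.
χ : ℤ → ℕ → Sign
χ c p = jacobi c ℕ.⌊ p /2⌋

prime-factor : ∀ {n} → 1 < n → ∃[ q ] Prime q × q ∣ n
prime-factor {n} 1<n = first (PrimeFactorisation.factors f) (PrimeFactorisation.isFactorisation f) (PrimeFactorisation.factorsPrime f)
  where
  f = factorise n {{ℕ.>-nonZero (ℕ.<-trans (s≤s z≤n) 1<n)}}
  first : ∀ qs → n ≡ product qs → All Prime qs → ∃[ q ] Prime q × q ∣ n
  first []       n≡1 _             = contradiction (sym n≡1) (ℕ.<⇒≢ 1<n)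
  first (q ∷ qs) n≡  (q-prime ∷ _) = q , q-prime , subst (q ∣_) (sym n≡) (ℕ.m∣m*n (product qs))

odd⇒2∤ : ∀ h → 2 ∤ odd h
odd⇒2∤ h (ℕ.divides q eq) = even≢odd q h (trans (eq′ q) (sym eq))
  where
  eq′ : ∀ q → q ℕ.+ q ≡ q ℕ.* 2
  eq′ = ℕSolver.solve-∀

module _ (ps : List ℕ) (ps-prime : All Prime ps) (ps-unique : Unique ps) (c : ℤ) where

  -- Induction on the modulus, splitting off a prime factor q. Squarefreeness makes q occur once, so
  -- its symbol enters once on both sides; a q missing from `ps` has symbol + and changes neither
  -- side.
  ∏-χ : ∀ h → ℕ.Acc _<_ h → Squarefree (odd h) → Invertible (odd h) c →
        (∀ q → Prime q → q ∣ odd h → q ∈ᴸ ps ⊎ χ c q ≡ Sign.+) →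
        ∏ᴸ ps (λ p → when (p ℕ.∣? odd h) (χ c p)) ≡ jacobi c h
  ∏-χ zero _ _ _ _ = trans (∏ᴸ-cong ps-prime (λ p p-prime → when-no (p ℕ.∣? 1) {χ c p}
    (λ p∣1 → ℕ.<⇒≢ (1<p p-prime) (sym (ℕ.∣1⇒≡1 p∣1))))) (trans (∏ᴸ-+ ps) (sym (jacobi-def c 0)))
  ∏-χ h@(suc _) (ℕ.acc rs) sqf c-inv trivial = split (prime-factor {odd h} (s≤s (s≤s z≤n)))
    where
    split : ∃[ q ] Prime q × q ∣ odd h → ∏ᴸ ps (λ p → when (p ℕ.∣? odd h) (χ c p)) ≡ jacobi c h
    split (q , q-prime , q∣m) = go (squarefree-valuation q-prime sqf q∣m)
      where
      2∤q : 2 ∤ q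
      2∤q 2∣q = odd⇒2∤ h (ℕ.∣-trans 2∣q q∣m)
      go : ∃[ m′ ] odd h ≡ m′ ℕ.* q × q ∤ m′ → ∏ᴸ ps (λ p → when (p ℕ.∣? odd h) (χ c p)) ≡ jacobi c h
      go (m′ , m≡ , q∤m′) = halves (2∤⇒odd 2∤m′) (2∤⇒odd 2∤q)
        where
        2∤m′ : 2 ∤ m′
        2∤m′ 2∣m′ = odd⇒2∤ h (subst (2 ∣_) (sym m≡) (ℕ.∣m⇒∣m*n q 2∣m′))
        halves : ∃[ h′ ] m′ ≡ odd h′ → ∃[ i ] q ≡ odd i → ∏ᴸ ps (λ p → when (p ℕ.∣? odd h) (χ c p)) ≡ jacobi c h
        halves (h′ , m′≡) (i , q≡) = begin
          ∏ᴸ ps (λ p → when (p ℕ.∣? odd h) (χ c p))                     ≡⟨ ∏ᴸ-cong ps-prime pointwise ⟩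
          ∏ᴸ ps (λ p → when (p ℕ.≟ q) (χ c p) Sign.* when (p ℕ.∣? odd h′) (χ c p))
            ≡⟨ ∏ᴸ-distrib-* ps (λ p → when (p ℕ.≟ q) (χ c p)) (λ p → when (p ℕ.∣? odd h′) (χ c p)) ⟩
          ∏ᴸ ps (λ p → when (p ℕ.≟ q) (χ c p)) Sign.* ∏ᴸ ps (λ p → when (p ℕ.∣? odd h′) (χ c p))
            ≡⟨ cong₂ Sign._*_ single (∏-χ h′ (rs h′<h) sqf′ (invertible-∣ m′∣m c-inv) (λ r r-prime r∣m′ → trivial r r-prime (ℕ.∣-trans r∣m′ m′∣m))) ⟩
          χ c q Sign.* jacobi c h′                                     ≡⟨ cong (Sign._* jacobi c h′) (trans (cong (χ c) q≡) (cong (jacobi c) (⌊odd/2⌋ i))) ⟩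
          jacobi c i Sign.* jacobi c h′                                ≡⟨ sym (jacobi-⊙ i h′ (subst (λ k → Invertible (odd k) c) h≡ c-inv)) ⟩
          jacobi c (i ⊙ h′)                                            ≡⟨ cong (jacobi c) (sym h≡) ⟩
          jacobi c h                                                   ∎
          where
          open ≡-Reasoning
          m≡′ : odd h ≡ odd h′ ℕ.* odd i
          m≡′ = trans m≡ (cong₂ ℕ._*_ m′≡ q≡)
          h≡ : h ≡ i ⊙ h′
          h≡ = trans (sym (⌊odd/2⌋ h)) (trans (cong ℕ.⌊_/2⌋ (trans m≡′ (trans (ℕ.*-comm (odd h′) (odd i)) (odd-⊙ i h′)))) (⌊odd/2⌋ (i ⊙ h′)))
          m′∣m : odd h′ ∣ odd h
          m′∣m = subst (odd h′ ∣_) (sym m≡′) (ℕ.m∣m*n (odd i))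
          sqf′ : Squarefree (odd h′)
          sqf′ d d²∣ = sqf d (ℕ.∣-trans d²∣ m′∣m)
          h′<h : h′ < h
          h′<h = ℕ.*-cancelˡ-< 2 h′ h (ℕ.s<s⁻¹ (subst₂ _<_ (cong (λ x → suc (h′ ℕ.+ x)) (sym (ℕ.+-identityʳ h′)))
            (trans (sym (trans m≡ (cong (ℕ._* q) m′≡))) (cong (λ x → suc (h ℕ.+ x)) (sym (ℕ.+-identityʳ h)))) (<-*-gain (odd h′) (1<p q-prime) (s≤s z≤n))))
          single : ∏ᴸ ps (λ p → when (p ℕ.≟ q) (χ c p)) ≡ χ c q
          single with trivial q q-prime q∣m
          ... | inj₁ q∈ps = ∏ᴸ-single ps (χ c) q ps-unique q∈ps
          ... | inj₂ χ≡+ = trans (∏ᴸ-cong ps-prime (λ p _ → trans (when-cong (p ℕ.≟ q) {χ c p} (λ { refl → χ≡+ })) (when-+ (p ℕ.≟ q))))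
                                 (trans (∏ᴸ-+ ps) (sym χ≡+))
          pointwise : ∀ p → Prime p → when (p ℕ.∣? odd h) (χ c p) ≡ when (p ℕ.≟ q) (χ c p) Sign.* when (p ℕ.∣? odd h′) (χ c p)
          pointwise p p-prime with p ℕ.≟ q
          ... | yes refl = trans (when-yes (p ℕ.∣? odd h) {χ c p} q∣m) (sym (trans (cong (χ c p Sign.*_)
                  (when-no (p ℕ.∣? odd h′) {χ c p} (q∤m′ ∘ subst (p ∣_) (sym m′≡)))) (Sign.*-identityʳ (χ c p))))
          ... | no p≢q with p ℕ.∣? odd h′
          ...   | yes p∣m′ = when-yes (p ℕ.∣? odd h) {χ c p} (ℕ.∣-trans p∣m′ m′∣m)
          ...   | no  p∤m′ = when-no (p ℕ.∣? odd h) {χ c p} λ p∣m →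
                  [ p∤m′ ∘ subst (p ∣_) m′≡ , (λ p∣q → [ (λ p≡1 → ℕ.<⇒≢ (1<p p-prime) (sym p≡1)) , p≢q ]′ (prime⇒irreducible q-prime p∣q)) ]′
                  (euclidsLemma m′ q p-prime (subst (p ∣_) m≡ p∣m))

-- Reciprocity for solutions of the equation

Reciprocity : (n u₁ u₂ u₃ : ℕ) → Set
Reciprocity n u₁ u₂ u₃ = Σ[ s ∈ (ℕ → Sign) ]
  (∀ p → Prime p → p ∣ n → LocalSymbol p u₁ u₂ u₃ (s p)) × ∏ᴸ (primeDivisors n) s ≡ Sign.-

module _ (n : ℕ) .{{_ : NonZero n}} where

  private
    primeDivisor? : ∀ p → Dec (Prime p × p ∣ n)
    primeDivisor? p = prime? p Dec.×-dec p ℕ.∣? n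

  primeDivisors-prime : All Prime (primeDivisors n)
  primeDivisors-prime = All.map proj₁ (All.all-filter primeDivisor? (upTo (suc n)))

  primeDivisors-unique : Unique (primeDivisors n)
  primeDivisors-unique = Unique.filter⁺ primeDivisor? (Unique.upTo⁺ (suc n))

  ∈-primeDivisors : ∀ {p} → Prime p → p ∣ n → p ∈ᴸ primeDivisors n
  ∈-primeDivisors p-prime p∣n = ∈.∈-filter⁺ primeDivisor? (∈.∈-upTo⁺ (s≤s (ℕ.∣⇒≤ p∣n))) (p-prime , p∣n)

module _ {n u₁ u₂ u₃ A B C : ℕ} .{{n≢0 : NonZero n}} (2∤n : 2 ∤ n) (0<u₁ : 0 < u₁) (0<u₂ : 0 < u₂) (0<u₃ : 0 < u₃)
         (es : ErdősStraus n u₁ u₂ u₃) (red : Reduced A B C) (s : Scaled u₁ u₂ u₃ A B C) where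

  private
    module R = Reduced red

    cA cB cC : ℤ
    cA = - (+ B * + C)
    cB = - (+ A * + C)
    cC = - (+ A * + B)

    dividing : ℕ → ℤ → ℕ → Sign
    dividing m c p = when (p ℕ.∣? m) (χ c p)

    odd-prime : ∀ {p} → Prime p → p ∣ n → ∃[ h ] p ≡ odd h
    odd-prime p-prime p∣n = 2∤⇒odd λ 2∣p →
      [ (λ ()) , (λ { refl → 2∤n p∣n }) ]′ (prime⇒irreducible p-prime 2∣p)

    trivial : ∀ {u₁ u₂ u₃ A B C} a → odd a ∣ A → 0 < u₁ → 0 < u₂ → 0 < u₃ → ErdősStraus n u₁ u₂ u₃ → Reduced A B C → Scaled u₁ u₂ u₃ A B C →
              ∀ q → Prime q → q ∣ odd a → q ∈ᴸ primeDivisors n ⊎ χ (- (+ B * + C)) q ≡ Sign.+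
    trivial {A = A} {B} {C} a a∣A 0<u₁ 0<u₂ 0<u₃ es red s q q-prime q∣a with q ℕ.∣? n
    ... | yes q∣n = inj₁ (∈-primeDivisors n q-prime q∣n)
    ... | no  q∤n = inj₂ (by-half (2∤⇒odd λ 2∣q → odd⇒2∤ a (ℕ.∣-trans 2∣q q∣a)) q-prime q∤n q∣a)
      where
      by-half : ∀ {q} → ∃[ h ] q ≡ odd h → Prime q → q ∤ n → q ∣ odd a → χ (- (+ B * + C)) q ≡ Sign.+
      by-half (h , refl) q-prime q∤n q∣a = trans (cong (jacobi (- (+ B * + C))) (⌊odd/2⌋ h))
        (jacobi≡+-∤n h q-prime q∤n 0<u₁ 0<u₂ 0<u₃ es red s (ℕ.∣-trans q∣a a∣A))

    neg-*-invertible : ∀ {m b c} → Coprime m b → Coprime m c → Invertible m (- (+ b * + c))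
    neg-*-invertible {b = b} {c} m⊥b m⊥c = invertible-neg (invertible-* (coprime⇒invertible (+ b) (Coprime.sym m⊥b)) (coprime⇒invertible (+ c) (Coprime.sym m⊥c)))

    ∏-dividing : ∀ {u₁ u₂ u₃ A B C} a → odd a ∣ A → 0 < u₁ → 0 < u₂ → 0 < u₃ → ErdősStraus n u₁ u₂ u₃ → Reduced A B C → Scaled u₁ u₂ u₃ A B C →
                 ∏ᴸ (primeDivisors n) (dividing (odd a) (- (+ B * + C))) ≡ jacobi (- (+ B * + C)) a
    ∏-dividing a a∣A 0<u₁ 0<u₂ 0<u₃ es red s = ∏-χ (primeDivisors n) (primeDivisors-prime n) (primeDivisors-unique n) _ a (ℕ.<-wellFounded a)
      (λ d d²∣a → Reduced.A-squarefree red d (ℕ.∣-trans d²∣a a∣A))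
      (neg-*-invertible (Coprime.sym (coprime-∣ʳ a∣A (Coprime.sym (Reduced.A⊥B red)))) (Coprime.sym (coprime-∣ʳ a∣A (Coprime.sym (Reduced.A⊥C red)))))
      (trivial a a∣A 0<u₁ 0<u₂ 0<u₃ es red s)

  module _ (t a b c : ℕ) (A≡ : A ≡ t ℕ.* odd a) (B≡ : B ≡ odd b) (C≡ : C ≡ odd c)
           (p∤t : ∀ p → Prime p → p ∣ n → p ∤ t) where

    private
      -- As A, B and C are pairwise coprime, at a prime p ∣ n at most one factor differs from +.
      -- Written as a product of three, the symbol lets the product over p ∣ n separate into three
      -- Jacobi symbols.
      symbol : ℕ → Sign
      symbol p = dividing (odd a) cA p Sign.* (dividing (odd b) cB p Sign.* dividing (odd c) cC p)

      a∣A : odd a ∣ A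
      a∣A = subst (odd a ∣_) (sym A≡) (ℕ.n∣m*n t)
      b∣B : odd b ∣ B
      b∣B = ℕ.∣-reflexive (sym B≡)
      c∣C : odd c ∣ C
      c∣C = ℕ.∣-reflexive (sym C≡)

      dividing-no : ∀ m {d p} → p ∤ m → dividing m d p ≡ Sign.+
      dividing-no m {d} {p} p∤m = when-no (p ℕ.∣? m) {χ d p} p∤m

      dividing-yes : ∀ {m d} h → odd h ∣ m → dividing m d (odd h) ≡ jacobi d h
      dividing-yes {m} {d} h p∣m = trans (when-yes (odd h ℕ.∣? m) {χ d (odd h)} p∣m) (cong (jacobi d) (⌊odd/2⌋ h))

      local : ∀ p → Prime p → p ∣ n → LocalSymbol p u₁ u₂ u₃ (symbol p)
      local p p-prime p∣n with odd-prime p-prime p∣n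
      ... | h , refl = by-divisor (odd h ℕ.∣? odd a) (odd h ℕ.∣? odd b) (odd h ℕ.∣? odd c)
        where
        ∤a : p ∤ A → p ∤ odd a
        ∤a p∤A p∣a = p∤A (ℕ.∣-trans p∣a a∣A)
        ∤b : p ∤ B → p ∤ odd b
        ∤b = subst (p ∤_) B≡
        ∤c : p ∤ C → p ∤ odd c
        ∤c = subst (p ∤_) C≡
        by-divisor : Dec (p ∣ odd a) → Dec (p ∣ odd b) → Dec (p ∣ odd c) → LocalSymbol p u₁ u₂ u₃ (symbol p)
        by-divisor (yes p∣a) _ _ = subst (LocalSymbol p u₁ u₂ u₃)
          (sym (trans (cong₂ Sign._*_ (dividing-yes h p∣a) (cong₂ Sign._*_ (dividing-no (odd b) (∤b (coprime⇒∤ p-prime R.A⊥B p∣A))) (dividing-no (odd c) (∤c (coprime⇒∤ p-prime R.A⊥C p∣A)))))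
            (Sign.*-identityʳ _)))
          (localSymbol-∣ h p-prime red s p∣A)
          where
          p∣A = ℕ.∣-trans p∣a a∣A
        by-divisor (no p∤a) (yes p∣b) _ = subst (LocalSymbol p u₁ u₂ u₃)
          (sym (trans (cong₂ Sign._*_ (dividing-no (odd a) p∤a) (cong₂ Sign._*_ (dividing-yes h p∣b) (dividing-no (odd c) (∤c (coprime⇒∤ p-prime R.B⊥C p∣B)))))
            (Sign.*-identityʳ _)))
          (localSymbol-swap₁₂ (localSymbol-∣ h p-prime (reduced-swap₁₂ red) (scaled-swap₁₂ s) p∣B))
          where
          p∣B = ℕ.∣-trans p∣b b∣B
        by-divisor (no p∤a) (no p∤b) (yes p∣c) = subst (LocalSymbol p u₁ u₂ u₃)
          (sym (cong₂ Sign._*_ (dividing-no (odd a) p∤a) (cong₂ Sign._*_ (dividing-no (odd b) p∤b) (dividing-yes h p∣c))))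
          (localSymbol-swap₂₃ (localSymbol-swap₁₂ (localSymbol-∣ h p-prime (reduced-swap₁₂ (reduced-swap₂₃ red)) (scaled-swap₁₂ (scaled-swap₂₃ s)) p∣C)))
          where
          p∣C = ℕ.∣-trans p∣c c∣C
        by-divisor (no p∤a) (no p∤b) (no p∤c) = subst (LocalSymbol p u₁ u₂ u₃)
          (sym (cong₂ Sign._*_ (dividing-no (odd a) p∤a) (cong₂ Sign._*_ (dividing-no (odd b) p∤b) (dividing-no (odd c) p∤c))))
          (localSymbol-unit h p-prime s (subst (p ∤_) (sym A≡) (prime∤* p-prime (p∤t p p-prime p∣n) p∤a)) (subst (p ∤_) (sym B≡) p∤b) (subst (p ∤_) (sym C≡) p∤c))

    -- Used with t = 1 for odd A and t = 2 for even A; the hypothesis on Φ is what the congruence at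
    -- 2 provides.
    reciprocity-from : Invertible (odd b) (+ t) → Invertible (odd c) (+ t) →
                       Φ (ε a) (ε b) (ε c) Sign.* (jacobi (+ t) b Sign.* jacobi (+ t) c) ≡ Sign.- → Reciprocity n u₁ u₂ u₃
    reciprocity-from t⊥b t⊥c Φ≡- = symbol , local , (begin
      ∏ᴸ ps symbol
        ≡⟨ trans (∏ᴸ-distrib-* ps (dividing (odd a) cA) (λ p → dividing (odd b) cB p Sign.* dividing (odd c) cC p))
             (cong (∏ᴸ ps (dividing (odd a) cA) Sign.*_) (∏ᴸ-distrib-* ps (dividing (odd b) cB) (dividing (odd c) cC))) ⟩
      ∏ᴸ ps (dividing (odd a) cA) Sign.* (∏ᴸ ps (dividing (odd b) cB) Sign.* ∏ᴸ ps (dividing (odd c) cC))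
        ≡⟨ cong₂ Sign._*_ (∏-dividing a a∣A 0<u₁ 0<u₂ 0<u₃ es red s) (cong₂ Sign._*_
             (∏-dividing b b∣B 0<u₂ 0<u₁ 0<u₃ (erdősStraus-swap₁₂ {n} {u₁} es) (reduced-swap₁₂ red) (scaled-swap₁₂ s))
             (∏-dividing c c∣C 0<u₃ 0<u₁ 0<u₂ (erdősStraus-swap₁₂ {n} {u₁} (erdősStraus-swap₂₃ {n} {u₁} es)) (reduced-swap₁₂ (reduced-swap₂₃ red)) (scaled-swap₁₂ (scaled-swap₂₃ s)))) ⟩
      jacobi cA a Sign.* (jacobi cB b Sign.* jacobi cC c)
        ≡⟨ cong₂ Sign._*_ (cong (λ x → jacobi x a) (cong -_ (cong₂ _*_ B≡ℤ C≡ℤ))) (cong₂ Sign._*_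
             (cong (λ x → jacobi x b) (cong -_ (cong₂ _*_ A≡ℤ C≡ℤ))) (cong (λ x → jacobi x c) (cong -_ (cong₂ _*_ A≡ℤ B≡ℤ)))) ⟩
      jacobi (- (+ odd b * + odd c)) a Sign.* (jacobi (- (+ t * + odd a * + odd c)) b Sign.* jacobi (- (+ t * + odd a * + odd b)) c)
        ≡⟨ legendre-product t a b c t⊥b t⊥c a⊥b a⊥c (subst₂ Coprime B≡ C≡ R.B⊥C) ⟩
      Φ (ε a) (ε b) (ε c) Sign.* (jacobi (+ t) b Sign.* jacobi (+ t) c)
        ≡⟨ Φ≡- ⟩
      Sign.- ∎)
      where
      open ≡-Reasoning
      ps = primeDivisors n
      A≡ℤ : + A ≡ + t * + odd a
      A≡ℤ = trans (cong +_ A≡) (ℤ.pos-* t (odd a))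
      B≡ℤ : + B ≡ + odd b
      B≡ℤ = cong +_ B≡
      C≡ℤ : + C ≡ + odd c
      C≡ℤ = cong +_ C≡
      a⊥b : Coprime (odd a) (odd b)
      a⊥b = Coprime.sym (coprime-∣ʳ a∣A (subst (λ b → Coprime b A) B≡ (Coprime.sym R.A⊥B)))
      a⊥c : Coprime (odd a) (odd c)
      a⊥c = Coprime.sym (coprime-∣ʳ a∣A (subst (λ c → Coprime c A) C≡ (Coprime.sym R.A⊥C)))

  reciprocity-top : TopPair 2 u₁ u₂ u₃ → Reciprocity n u₁ u₂ u₃
  reciprocity-top top with isotropic₂ 2∤n es red s top
  ... | 2∤B , 2∤C , iso₂ = by-parity iso₂ (2∤⇒odd 2∤B) (2∤⇒odd 2∤C)
    where
    by-parity : Isotropic₂ A B C → ∃[ b ] B ≡ odd b → ∃[ c ] C ≡ odd c → Reciprocity n u₁ u₂ u₃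
    by-parity (odd-A 2∤A 4∣) (b , B≡) (c , C≡) = let a , A≡ = 2∤⇒odd 2∤A in
      reciprocity-from 1 a b c (trans A≡ (sym (ℕ.*-identityˡ (odd a)))) B≡ C≡
        (λ p p-prime _ p∣1 → ℕ.<⇒≢ (1<p p-prime) (sym (ℕ.∣1⇒≡1 p∣1))) 1-invertible 1-invertible
        (trans (cong₂ Sign._*_ (4∣B+C⇒Φ a b c (subst₂ (λ B C → 4 ∣ B ℕ.+ C) B≡ C≡ 4∣)) (cong₂ Sign._*_ (jacobi-1 b) (jacobi-1 c))) refl)
      where
      1-invertible : ∀ {m} → Invertible m 1ℤ
      1-invertible = unit 1ℤ (mod-refl refl)
    by-parity (even-A A′ A≡ 2∤A′ 8∣) (b , B≡) (c , C≡) = let a , A′≡ = 2∤⇒odd 2∤A′ in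
      reciprocity-from 2 a b c (trans A≡ (cong (2 ℕ.*_) A′≡)) B≡ C≡
        (λ p p-prime p∣n p∣2 → [ (λ p≡1 → ℕ.<⇒≢ (1<p p-prime) (sym p≡1)) , (λ p≡2 → 2∤n (subst (_∣ n) p≡2 p∣n)) ]′ (prime⇒irreducible prime[2] p∣2))
        (2-invertible b) (2-invertible c)
        (trans (cong (Φ (ε a) (ε b) (ε c) Sign.*_) (cong₂ Sign._*_ (jacobi-2 b) (jacobi-2 c)))
          (8∣A[B+C]+2BC⇒Φ a b c (congruence {a = a} {b} {c} A′≡ B≡ C≡ 8∣)))
      where
      congruence : ∀ {A′ B C a b c} → A′ ≡ odd a → B ≡ odd b → C ≡ odd c →
        8 ∣ B ℕ.+ C ⊎ 8 ∣ A′ ℕ.* (B ℕ.+ C) ℕ.+ 2 ℕ.* (B ℕ.* C) →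
        8 ∣ odd b ℕ.+ odd c ⊎ 8 ∣ odd a ℕ.* (odd b ℕ.+ odd c) ℕ.+ 2 ℕ.* (odd b ℕ.* odd c)
      congruence refl refl refl = id

reciprocity-swap₁₂ : ∀ {n u₁ u₂ u₃} → Reciprocity n u₁ u₂ u₃ → Reciprocity n u₂ u₁ u₃
reciprocity-swap₁₂ (s , local , ∏≡-) = s , (λ p p-prime p∣n → localSymbol-swap₁₂ (local p p-prime p∣n)) , ∏≡-

reciprocity-swap₂₃ : ∀ {n u₁ u₂ u₃} → Reciprocity n u₁ u₂ u₃ → Reciprocity n u₁ u₃ u₂
reciprocity-swap₂₃ (s , local , ∏≡-) = s , (λ p p-prime p∣n → localSymbol-swap₂₃ (local p p-prime p∣n)) , ∏≡-

-- At 2 the three valuations cannot all be equal, so there is a top pair; moving it to the last two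
-- positions before the normal form is taken makes B and C odd.
erdősStraus-reciprocity : ∀ {n u₁ u₂ u₃} .{{_ : NonZero n}} → 2 ∤ n → 0 < u₁ → 0 < u₂ → 0 < u₃ →
                          ErdősStraus n u₁ u₂ u₃ → Reciprocity n u₁ u₂ u₃
erdősStraus-reciprocity {n} {u₁} {u₂} {u₃} 2∤n 0<u₁ 0<u₂ 0<u₃ es =
  by-valuations (valuations prime[2] 2∤n (valuation prime[2] u₁ 0<u₁) (valuation prime[2] u₂ 0<u₂) (valuation prime[2] u₃ 0<u₃) es)
  where
  top : ∀ {u₁ u₂ u₃} → 0 < u₁ → 0 < u₂ → 0 < u₃ → ErdősStraus n u₁ u₂ u₃ → TopPair 2 u₁ u₂ u₃ → Reciprocity n u₁ u₂ u₃
  top 0<u₁ 0<u₂ 0<u₃ es t = let _ , _ , _ , red , s = normalForm 0<u₁ 0<u₂ 0<u₃ in reciprocity-top 2∤n 0<u₁ 0<u₂ 0<u₃ es red s t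
  by-valuations : Valuations 2 u₁ u₂ u₃ → Reciprocity n u₁ u₂ u₃
  by-valuations (top₂₃ t) = top 0<u₁ 0<u₂ 0<u₃ es t
  by-valuations (top₁₃ t) = reciprocity-swap₁₂ (top 0<u₂ 0<u₁ 0<u₃ (erdősStraus-swap₁₂ {n} {u₁} es) t)
  by-valuations (top₁₂ t) = reciprocity-swap₂₃ (reciprocity-swap₁₂ (top 0<u₃ 0<u₁ 0<u₂ (erdősStraus-swap₁₂ {n} {u₁} (erdősStraus-swap₂₃ {n} {u₁} es)) t))
  by-valuations (all t)   = contradiction t (not-all-equal₂ 2∤n es)

-- Hilbert symbols

toℚᵘ-/ : ∀ i n .{{_ : NonZero n}} → ℚ.toℚᵘ (i / n) ℚᵘ.≃ i ℚᵘ./ n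
toℚᵘ-/ i (suc n) = ℚ.toℚᵘ-fromℚᵘ (mkℚᵘ i n)

≃-terms : ∀ q i w → ℚ.toℚᵘ q ℚᵘ.≃ mkℚᵘ i w → ℚ.↥ q * + suc w ≡ i * + ℚ.↧ₙ q
≃-terms (ℚ.mkℚ _ _ _) i w (*≡* eq) = eq

-- The reduced fraction enters the Hilbert equation through this cross-multiplied identity alone, so
-- no gcd has to be computed.
neg-/-terms : ∀ u w .{{_ : NonZero w}} → ℚ.↥ (ℚ.- (+ u / w)) * + w ≡ - (+ u) * + ℚ.↧ₙ (ℚ.- (+ u / w))
neg-/-terms u (suc w) = ≃-terms (ℚ.- (+ u / suc w)) (- (+ u)) w
  (ℚᵘ.≃-trans (ℚ.toℚᵘ-homo‿- (+ u / suc w)) (ℚᵘ.-‿cong (toℚᵘ-/ (+ u) (suc w))))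

erdősStraus-fromℚ : ∀ n u₁ u₂ u₃ .{{_ : NonZero n}} .{{_ : NonZero u₁}} .{{_ : NonZero u₂}} .{{_ : NonZero u₃}} →
                    + 4 / n ≡ (1ℤ / u₁) ℚ.+ (1ℤ / u₂) ℚ.+ (1ℤ / u₃) → ErdősStraus n u₁ u₂ u₃
erdősStraus-fromℚ n@(suc _) u₁@(suc _) u₂@(suc _) u₃@(suc _) eq
  with ℚᵘ.≃-trans (ℚᵘ.≃-sym (toℚᵘ-/ (+ 4) n)) (ℚᵘ.≃-trans (ℚᵘ.≃-reflexive (cong ℚ.toℚᵘ eq))
    (ℚᵘ.≃-trans (ℚ.toℚᵘ-homo-+ ((1ℤ / u₁) ℚ.+ (1ℤ / u₂)) (1ℤ / u₃)) (ℚᵘ.+-cong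
      (ℚᵘ.≃-trans (ℚ.toℚᵘ-homo-+ (1ℤ / u₁) (1ℤ / u₂)) (ℚᵘ.+-cong (toℚᵘ-/ 1ℤ u₁) (toℚᵘ-/ 1ℤ u₂))) (toℚᵘ-/ 1ℤ u₃))))
... | *≡* eqℤ = ℤ.+-injective (begin
  + (4 ℕ.* (u₁ ℕ.* u₂ ℕ.* u₃))                                     ≡⟨ ℤ.pos-* 4 (u₁ ℕ.* u₂ ℕ.* u₃) ⟩
  + 4 * + (u₁ ℕ.* u₂ ℕ.* u₃)                                       ≡⟨ eqℤ ⟩
  ((1ℤ * + u₂ + 1ℤ * + u₁) * + u₃ + 1ℤ * + (u₁ ℕ.* u₂)) * + n       ≡⟨ cong (λ x → ((1ℤ * + u₂ + 1ℤ * + u₁) * + u₃ + 1ℤ * x) * + n) (ℤ.pos-* u₁ u₂) ⟩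
  ((1ℤ * + u₂ + 1ℤ * + u₁) * + u₃ + 1ℤ * (+ u₁ * + u₂)) * + n       ≡⟨ rearrange (+ n) (+ u₁) (+ u₂) (+ u₃) ⟩
  + n * (+ u₁ * + u₂ + + u₁ * + u₃ + + u₂ * + u₃)
    ≡⟨ cong (+ n *_) (sym (trans (ℤ.pos-+ (u₁ ℕ.* u₂ ℕ.+ u₁ ℕ.* u₃) (u₂ ℕ.* u₃)) (cong₂ _+_
         (trans (ℤ.pos-+ (u₁ ℕ.* u₂) (u₁ ℕ.* u₃)) (cong₂ _+_ (ℤ.pos-* u₁ u₂) (ℤ.pos-* u₁ u₃))) (ℤ.pos-* u₂ u₃)))) ⟩
  + n * + (u₁ ℕ.* u₂ ℕ.+ u₁ ℕ.* u₃ ℕ.+ u₂ ℕ.* u₃)                   ≡⟨ sym (ℤ.pos-* n _) ⟩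
  + (n ℕ.* (u₁ ℕ.* u₂ ℕ.+ u₁ ℕ.* u₃ ℕ.+ u₂ ℕ.* u₃))                 ∎)
  where
  open ≡-Reasoning
  rearrange : ∀ n a b c → ((1ℤ * b + 1ℤ * a) * c + 1ℤ * (a * b)) * n ≡ n * (a * b + a * c + b * c)
  rearrange = ℤSolver.solve-∀

torsion-free-≈ : ∀ {p} → Prime p → ∀ c → 0 < c → (X Y : ℤₚ p) → (∀ k → + (p ℕ.^ k) ∣ℤ + c * (approx X k - approx Y k)) → X ≈ᶻ Y
torsion-free-≈ {p} p-prime c 0<c X Y p^∣ k = subst (+ (p ℕ.^ k) ∣ℤ_) (eq (approx X k) (approx Y k))
  (torsion-free p-prime c 0<c (X +ᶻ fromℤ -1ℤ *ᶻ Y) (λ k → subst (λ z → + (p ℕ.^ k) ∣ℤ + c * z) (sym (eq (approx X k) (approx Y k))) (p^∣ k)) k)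
  where
  eq : ∀ x y → x + -1ℤ * y ≡ x - y
  eq = ℤSolver.solve-∀

module _ {p : ℕ} (p-prime : Prime p) (u₁ u₂ u₃ : ℕ) (0<u₃ : 0 < u₃)
         (α β : ℤ) (d e : ℕ) .{{d≢0 : NonZero d}} .{{e≢0 : NonZero e}}
         (α/d : α * + u₃ ≡ - (+ u₁) * + d) (β/e : β * + u₃ ≡ - (+ u₂) * + e) where

  private
    a b : ℚₚ p
    a = fromℤ α ÷ d
    b = fromℤ β ÷ e

    -- The cross-multiplied difference of the two sides of z² = a x² + b y² at x = X / dx, y = Y /
    -- dy, z = Z / dz, in exactly the shape to which `_≈_` unfolds on approximations.
    difference : (dx dy dz : ℕ) → ℤ → ℤ → ℤ → ℤ
    difference dx dy dz X Y Z = (Z * Z) * + ((d ℕ.* (dx ℕ.* dx)) ℕ.* (e ℕ.* (dy ℕ.* dy)))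
      - ((α * (X * X)) * + (e ℕ.* (dy ℕ.* dy)) + (β * (Y * Y)) * + (d ℕ.* (dx ℕ.* dx))) * + (dz ℕ.* dz)

    -- α / d and β / e are - u₁ / u₃ and - u₂ / u₃, so the factor u₃ turns the difference into the
    -- ternary form; its coordinates are x, y, z multiplied by dx dy dz.
    clear-denominators : ∀ dx dy dz X Y Z →
      + u₃ * difference dx dy dz X Y Z ≡ + (d ℕ.* e) * form (+ u₁) (+ u₂) (+ u₃) (+ (dy ℕ.* dz) * X) (+ (dx ℕ.* dz) * Y) (+ (dx ℕ.* dy) * Z)
    clear-denominators dx dy dz X Y Z = begin
      + u₃ * difference dx dy dz X Y Z
        ≡⟨ cong (+ u₃ *_) (cong₂ _-_ (cong ((Z * Z) *_) (trans (ℤ.pos-* (d ℕ.* (dx ℕ.* dx)) _) (cong₂ _*_ (triple d dx) (triple e dy))))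
             (cong₂ _*_ (cong₂ _+_ (cong ((α * (X * X)) *_) (triple e dy)) (cong ((β * (Y * Y)) *_) (triple d dx))) (ℤ.pos-* dz dz))) ⟩
      + u₃ * ((Z * Z) * (+ d * (+ dx * + dx) * (+ e * (+ dy * + dy)))
        - ((α * (X * X)) * (+ e * (+ dy * + dy)) + (β * (Y * Y)) * (+ d * (+ dx * + dx))) * (+ dz * + dz))
        ≡⟨ separate (+ u₃) α β (+ d) (+ e) (+ dx) (+ dy) (+ dz) X Y Z ⟩
      + u₃ * (+ d * + e) * (+ dx * + dy * Z * (+ dx * + dy * Z))
        - (α * + u₃ * + e * (+ dy * + dz * X * (+ dy * + dz * X)) + β * + u₃ * + d * (+ dx * + dz * Y * (+ dx * + dz * Y)))
        ≡⟨ cong (λ t → + u₃ * (+ d * + e) * (+ dx * + dy * Z * (+ dx * + dy * Z)) - t)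
             (cong₂ (λ s t → s * + e * (+ dy * + dz * X * (+ dy * + dz * X)) + t * + d * (+ dx * + dz * Y * (+ dx * + dz * Y))) α/d β/e) ⟩
      + u₃ * (+ d * + e) * (+ dx * + dy * Z * (+ dx * + dy * Z))
        - (- (+ u₁) * + d * + e * (+ dy * + dz * X * (+ dy * + dz * X)) + - (+ u₂) * + e * + d * (+ dx * + dz * Y * (+ dx * + dz * Y)))
        ≡⟨ collect (+ u₁) (+ u₂) (+ u₃) (+ d) (+ e) (+ dy * + dz * X) (+ dx * + dz * Y) (+ dx * + dy * Z) ⟩
      + d * + e * form (+ u₁) (+ u₂) (+ u₃) (+ dy * + dz * X) (+ dx * + dz * Y) (+ dx * + dy * Z)
        ≡⟨ sym (cong₂ _*_ (ℤ.pos-* d e) (trans (cong (λ s → form (+ u₁) (+ u₂) (+ u₃) (s * X) (+ (dx ℕ.* dz) * Y) (+ (dx ℕ.* dy) * Z)) (ℤ.pos-* dy dz))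
             (cong₂ (λ s t → form (+ u₁) (+ u₂) (+ u₃) (+ dy * + dz * X) (s * Y) (t * Z)) (ℤ.pos-* dx dz) (ℤ.pos-* dx dy)))) ⟩
      + (d ℕ.* e) * form (+ u₁) (+ u₂) (+ u₃) (+ (dy ℕ.* dz) * X) (+ (dx ℕ.* dz) * Y) (+ (dx ℕ.* dy) * Z) ∎
      where
      open ≡-Reasoning
      triple : ∀ d x → + (d ℕ.* (x ℕ.* x)) ≡ + d * (+ x * + x)
      triple d x = trans (ℤ.pos-* d (x ℕ.* x)) (cong (+ d *_) (ℤ.pos-* x x))
      separate : ∀ u α β d e x y z X Y Z →
        u * ((Z * Z) * (d * (x * x) * (e * (y * y))) - ((α * (X * X)) * (e * (y * y)) + (β * (Y * Y)) * (d * (x * x))) * (z * z)) ≡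
        u * (d * e) * (x * y * Z * (x * y * Z)) - (α * u * e * (y * z * X * (y * z * X)) + β * u * d * (x * z * Y * (x * z * Y)))
      separate = ℤSolver.solve-∀
      collect : ∀ u₁ u₂ u₃ d e X Y Z →
        u₃ * (d * e) * (Z * Z) - (- u₁ * d * e * (X * X) + - u₂ * e * d * (Y * Y)) ≡ d * e * (u₁ * (X * X) + u₂ * (Y * Y) + u₃ * (Z * Z))
      collect = ℤSolver.solve-∀

    zero-numerator : ∀ X dx → X * 1ℤ - 0ℤ * + dx ≡ X
    zero-numerator X dx = eq X (+ dx)
      where
      eq : ∀ X d → X * 1ℤ - 0ℤ * d ≡ X
      eq = ℤSolver.solve-∀

  isotropic⇒solvable : Isotropic p u₁ u₂ u₃ → HasNontrivialSolution a b
  isotropic⇒solvable (isotropic X Y Z nontrivial (vanishing v)) = X ÷ 1 , Y ÷ 1 , Z ÷ 1 ,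
    (λ (x≈0 , y≈0 , z≈0) → nontrivial (zero≈ X x≈0 , zero≈ Y y≈0 , zero≈ Z z≈0)) ,
    torsion-free-≈ p-prime u₃ 0<u₃ (num z² *ᶻ fromℤ (+ den ax²+by²)) (num ax²+by² *ᶻ fromℤ (+ den z²)) (λ k → subst (+ (p ℕ.^ k) ∣ℤ_)
      (sym (trans (clear-denominators 1 1 1 (approx X k) (approx Y k) (approx Z k)) (cong (+ (d ℕ.* e) *_)
        (ones (approx X k) (approx Y k) (approx Z k)))))
      (ℤ∣.∣n⇒∣m*n (+ (d ℕ.* e)) (v k)))
    where
    z² ax²+by² : ℚₚ p
    z² = (Z ÷ 1) Defs.* (Z ÷ 1)
    ax²+by² = a Defs.* ((X ÷ 1) Defs.* (X ÷ 1)) Defs.+ b Defs.* ((Y ÷ 1) Defs.* (Y ÷ 1))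
    zero≈ : ∀ X → Defs._≈_ (X ÷ 1) 0ₚ → Zero X
    zero≈ X x≈0 k = subst (+ (p ℕ.^ k) ∣ℤ_) (zero-numerator (approx X k) 1) (x≈0 k)
    ones : ∀ X Y Z → form (+ u₁) (+ u₂) (+ u₃) (1ℤ * X) (1ℤ * Y) (1ℤ * Z) ≡ form (+ u₁) (+ u₂) (+ u₃) X Y Z
    ones X Y Z = trans (cong (λ x → form (+ u₁) (+ u₂) (+ u₃) x (1ℤ * Y) (1ℤ * Z)) (ℤ.*-identityˡ X))
      (cong₂ (form (+ u₁) (+ u₂) (+ u₃) X) (ℤ.*-identityˡ Y) (ℤ.*-identityˡ Z))

  anisotropic⇒unsolvable : Anisotropic p u₁ u₂ u₃ → ¬ HasNontrivialSolution a b
  anisotropic⇒unsolvable anisotropic ((X ÷ dx) , (Y ÷ dy) , (Z ÷ dz) , nontrivial , z²≈) = nontrivial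
    (zero≈ X dx (torsion-free p-prime (dy ℕ.* dz) (0<* 0<dy 0<dz) X (proj₁ zeros)) ,
     zero≈ Y dy (torsion-free p-prime (dx ℕ.* dz) (0<* 0<dx 0<dz) Y (proj₁ (proj₂ zeros))) ,
     zero≈ Z dz (torsion-free p-prime (dx ℕ.* dy) (0<* 0<dx 0<dy) Z (proj₂ (proj₂ zeros))))
    where
    0<dx : 0 < dx
    0<dx = ℕ.>-nonZero⁻¹ dx
    0<dy : 0 < dy
    0<dy = ℕ.>-nonZero⁻¹ dy
    0<dz : 0 < dz
    0<dz = ℕ.>-nonZero⁻¹ dz
    X′ = fromℤ (+ (dy ℕ.* dz)) *ᶻ X
    Y′ = fromℤ (+ (dx ℕ.* dz)) *ᶻ Y
    Z′ = fromℤ (+ (dx ℕ.* dy)) *ᶻ Z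
    F : ℤₚ p
    F = fromℤ (+ u₁) *ᶻ (X′ *ᶻ X′) +ᶻ fromℤ (+ u₂) *ᶻ (Y′ *ᶻ Y′) +ᶻ fromℤ (+ u₃) *ᶻ (Z′ *ᶻ Z′)
    zeros : Zero X′ × Zero Y′ × Zero Z′
    zeros = anisotropic X′ Y′ Z′ (vanishing (torsion-free p-prime (d ℕ.* e) (0<* (ℕ.>-nonZero⁻¹ d) (ℕ.>-nonZero⁻¹ e)) F
      (λ k → subst (+ (p ℕ.^ k) ∣ℤ_) (clear-denominators dx dy dz (approx X k) (approx Y k) (approx Z k)) (ℤ∣.∣n⇒∣m*n (+ u₃) (z²≈ k)))))
    zero≈ : ∀ X dx .{{_ : NonZero dx}} → Zero X → Defs._≈_ (X ÷ dx) 0ₚ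
    zero≈ X dx X≈0 k = subst (+ (p ℕ.^ k) ∣ℤ_) (sym (zero-numerator (approx X k) dx)) (X≈0 k)

localSymbol⇒hilbertSymbol : ∀ {p u₁ u₂ u₃} → Prime p → 0 < u₃ → ∀ q r →
  ℚ.↥ q * + u₃ ≡ - (+ u₁) * + ℚ.↧ₙ q → ℚ.↥ r * + u₃ ≡ - (+ u₂) * + ℚ.↧ₙ r →
  ∀ {σ} → LocalSymbol p u₁ u₂ u₃ σ → HilbertSymbol p (fromℚ q) (fromℚ r) ⟦ σ ⟧
localSymbol⇒hilbertSymbol {u₁ = u₁} {u₂} {u₃} p-prime 0<u₃ q r q≡ r≡ (iso i) =
  solvable (isotropic⇒solvable p-prime u₁ u₂ u₃ 0<u₃ (ℚ.↥ q) (ℚ.↥ r) (ℚ.↧ₙ q) (ℚ.↧ₙ r) q≡ r≡ i)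
localSymbol⇒hilbertSymbol {u₁ = u₁} {u₂} {u₃} p-prime 0<u₃ q r q≡ r≡ (aniso a) =
  unsolvable (anisotropic⇒unsolvable p-prime u₁ u₂ u₃ 0<u₃ (ℚ.↥ q) (ℚ.↥ r) (ℚ.↧ₙ q) (ℚ.↧ₙ r) q≡ r≡ a)

⟦∏ᴸ⟧ : ∀ ps s → List.foldr ℤ._*_ 1ℤ (List.map (⟦_⟧ ∘ s) ps) ≡ ⟦ ∏ᴸ ps s ⟧
⟦∏ᴸ⟧ []       s = refl
⟦∏ᴸ⟧ (p ∷ ps) s = trans (cong (⟦ s p ⟧ *_) (⟦∏ᴸ⟧ ps s)) (sym (⟦⟧-* (s p) (∏ᴸ ps s)))

theorem1p2 : (n u₁ u₂ u₃ : ℕ)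
    .{{_ : NonZero n}} .{{_ : NonZero u₁}} .{{_ : NonZero u₂}} .{{_ : NonZero u₃}} →
    2 ∤ n →
    + 4 / n ≡ (1ℤ / u₁) ℚ.+ (1ℤ / u₂) ℚ.+ (1ℤ / u₃) →
    Σ[ s ∈ (ℕ → ℤ) ]
    (∀ p → Prime p → p ∣ n →
    HilbertSymbol p (fromℚ (ℚ.- (+ u₁ / u₃))) (fromℚ (ℚ.- (+ u₂ / u₃))) (s p))
    × ∏[p∣ n ] s ≡ -1ℤ
theorem1p2 n u₁ u₂ u₃ 2∤n eq =
  let s , local , ∏≡- = erdősStraus-reciprocity 2∤n (ℕ.>-nonZero⁻¹ u₁) (ℕ.>-nonZero⁻¹ u₂) (ℕ.>-nonZero⁻¹ u₃) (erdősStraus-fromℚ n u₁ u₂ u₃ eq)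
  in ⟦_⟧ ∘ s , (λ p p-prime p∣n → localSymbol⇒hilbertSymbol p-prime (ℕ.>-nonZero⁻¹ u₃) (ℚ.- (+ u₁ / u₃)) (ℚ.- (+ u₂ / u₃))
       (neg-/-terms u₁ u₃) (neg-/-terms u₂ u₃) (local p p-prime p∣n)) ,
     trans (⟦∏ᴸ⟧ (primeDivisors n) s) (cong ⟦_⟧ ∏≡-)
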